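{- Let $F$ be a computable family of finite linear orders with $|F|>1$, and let $L=\mathrm{Shuffle}(F)$. Then $\mathrm{PrCat}(L)=\mathrm{Cone}(\Delta^0_3)$.
   Context: For a family $F$ of linear orders, $\mathrm{Shuffle}(F)$ is the linear order obtained by replacing each point of $\eta$ (the order type of the rationals) with a copy of a member of $F$ in such a way that between any two of these inserted copies there is a copy of each member of $F$. A structure is punctual if its domain is $\omega$ and its relations are uniformly primitive recursive. For total $f,g:\omega\to\omega$, write $f\le_{PR}g$ if $f$ is primitive recursive relative to $g$; the induced equivalence classes are PR-degrees, and $f\le_{PR}\mathbf d$ means $f\le_{PR}$ a member of $\mathbf d$. For a punctual structure $A$, $\mathrm{PrCat}(A)$ is the set of PR-degrees $\mathbf d$ such that for every punctual $B\cong A$ there is an isomorphism $f:A\to B$ with $f\le_{PR}\mathbf d$ and $f^{ -1}\le_{PR}\mathbf d$; for an isomorphism type $S$ with a punctual presentation, $\mathrm{PrCat}(S)$ means $\mathrm{PrCat}(A)$ for a punctual $A\cong S$ (independent of the choice of $A$). $\mathrm{Cone}(\Delta^0_3)$ is the set of PR-degrees $\mathbf d$ such that $f\le_{PR}\mathbf d$ for every total $\Delta^0_3$ function $f:\omega\to\omega$. -}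

module Defs where

open import Data.Bool using (Bool; true; false)
open import Data.Nat using (ℕ; zero; suc; _≤_)
open import Data.Fin using (Fin; toℕ)
open import Data.Vec using (Vec; []; _∷_; lookup)
open import Data.Product using (Σ; ∃; ∃-syntax; _×_; _,_)
open import Data.Sum using (_⊎_)
open import Data.Rational as ℚ using (ℚ)
open import Relation.Binary.PropositionalEquality using (_≡_; _≢_)
open import Relation.Binary.Structures using (IsStrictTotalOrder)
open import Function.Bundles using (_↔_; _⇔_; Inverse)

-- Primitive recursive terms, optionally with a unary oracle symbol.
-- Term false n : primitive recursive function terms of arity n
-- Term true  n : terms of arity n that may also call the oracle.

data Term : Bool → ℕ → Set where
  zeroT : ∀ {o n} → Term o n
  succT : ∀ {o} → Term o 1
  projT : ∀ {o n} → Fin n → Term o n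
  orcT  : Term true 1
  compT : ∀ {o m n} → Term o m → Vec (Term o n) m → Term o n
  recT  : ∀ {o n} → Term o n → Term o (suc (suc n)) → Term o (suc n)

primRec : ∀ {n} → (Vec ℕ n → ℕ) → (Vec ℕ (suc (suc n)) → ℕ) → Vec ℕ (suc n) → ℕ
primRec f h (zero  ∷ xs) = f xs
primRec f h (suc k ∷ xs) = h (k ∷ primRec f h (k ∷ xs) ∷ xs)

mutual
  eval : ∀ {o n} → (ℕ → ℕ) → Term o n → Vec ℕ n → ℕ
  eval g zeroT         xs       = 0
  eval g succT         (x ∷ []) = suc x
  eval g (projT i)     xs       = lookup xs i
  eval g orcT          (x ∷ []) = g x
  eval g (compT t ts)  xs       = eval g t (evalVec g ts xs)
  eval g (recT f h)    xs       = primRec (eval g f) (eval g h) xs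

  evalVec : ∀ {o m n} → (ℕ → ℕ) → Vec (Term o n) m → Vec ℕ n → Vec ℕ m
  evalVec g []       xs = []
  evalVec g (t ∷ ts) xs = eval g t xs ∷ evalVec g ts xs

evalPR : ∀ {n} → Term false n → Vec ℕ n → ℕ
evalPR t = eval (λ _ → 0) t

HoldsPR : ∀ {n} → Term false n → Vec ℕ n → Set
HoldsPR t xs = evalPR t xs ≡ 1

_≤PR_ : (ℕ → ℕ) → (ℕ → ℕ) → Set
f ≤PR g = Σ (Term true 1) λ t → ∀ x → eval g t (x ∷ []) ≡ f x

Σ⁰₁ : (ℕ → ℕ → Set) → Set
Σ⁰₁ P = Σ (Term false 3) λ t →
  ∀ x y → P x y ⇔ (∃[ a ] HoldsPR t (x ∷ y ∷ a ∷ []))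

Σ⁰₃ : (ℕ → ℕ → Set) → Set
Σ⁰₃ P = Σ (Term false 5) λ t →
  ∀ x y → P x y ⇔ (∃[ a ] ∀ b → ∃[ c ] HoldsPR t (x ∷ y ∷ a ∷ b ∷ c ∷ []))

Π⁰₃ : (ℕ → ℕ → Set) → Set
Π⁰₃ P = Σ (Term false 5) λ t →
  ∀ x y → P x y ⇔ (∀ a → ∃[ b ] ∀ c → HoldsPR t (x ∷ y ∷ a ∷ b ∷ c ∷ []))

Graph : (ℕ → ℕ) → ℕ → ℕ → Set
Graph f x y = f x ≡ y

-- a total function is computable iff its graph is Σ⁰₁ (= Δ⁰₁ for total f)
Computable : (ℕ → ℕ) → Set
Computable f = Σ⁰₁ (Graph f)

Δ⁰₃Fun : (ℕ → ℕ) → Set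
Δ⁰₃Fun f = Σ⁰₃ (Graph f) × Π⁰₃ (Graph f)

record PunctualLO : Set where
  field
    ordT    : Term false 2
  _<ₒ_ : ℕ → ℕ → Set
  x <ₒ y = HoldsPR ordT (x ∷ y ∷ [])
  field
    isLinOrd : IsStrictTotalOrder _≡_ _<ₒ_

open PunctualLO public using (_<ₒ_)

record LOIso (A B : PunctualLO) : Set where
  field
    bij      : ℕ ↔ ℕ
  open Inverse bij public using (to; from)
  field
    preserves : ∀ x y → (PunctualLO._<ₒ_ A x y ⇔ PunctualLO._<ₒ_ B (to x) (to y))

-- Shuffles.  A family F of finite linear orders is given by the sequence
-- of sizes of its members (a finite linear order is determined up to
-- isomorphism by its size; member i is (Fin (sizes i), <)).
-- A labelling c : ℚ → ℕ says which member is put at each rational point;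
-- the shuffle condition: between any two rationals there is a point
-- carrying a copy of each member.

IsShuffleLabelling : (sizes : ℕ → ℕ) → (ℚ → ℕ) → Set
IsShuffleLabelling sizes c =
  ∀ (i : ℕ) (p q : ℚ) → p ℚ.< q →
    ∃[ r ] (p ℚ.< r × r ℚ.< q × sizes (c r) ≡ sizes i)

ShuffleCarrier : (sizes : ℕ → ℕ) → (ℚ → ℕ) → Set
ShuffleCarrier sizes c = Σ ℚ λ q → Fin (sizes (c q))

_<Sh_ : ∀ {sizes c} → ShuffleCarrier sizes c → ShuffleCarrier sizes c → Set
(p , a) <Sh (q , b) = p ℚ.< q ⊎ (p ≡ q × toℕ a Data.Nat.< toℕ b)

IsShuffle : (sizes : ℕ → ℕ) → PunctualLO → Set
IsShuffle sizes A =
  Σ (ℚ → ℕ) λ c → IsShuffleLabelling sizes c ×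
  Σ (ℕ ↔ ShuffleCarrier sizes c) λ h →
    ∀ x y → (PunctualLO._<ₒ_ A x y ⇔
             _<Sh_ {sizes} {c} (Inverse.to h x) (Inverse.to h y))

-- PrCat and the cone above Δ⁰₃, as predicates on representatives g of
-- PR-degrees (membership depends only on the PR-degree of g).

InPrCat : PunctualLO → (ℕ → ℕ) → Set
InPrCat A g = ∀ (B : PunctualLO) → LOIso A B →
  Σ (LOIso A B) λ f → (LOIso.to f ≤PR g) × (LOIso.from f ≤PR g)

InConeΔ⁰₃ : (ℕ → ℕ) → Set
InConeΔ⁰₃ g = ∀ (f : ℕ → ℕ) → Δ⁰₃Fun f → f ≤PR g

{-# OPTIONS --safe #-}
module Submission where

{-
Cone ⇒ PrCat.  In a shuffle of finite orders "l is the maximal finite block around x" is Π⁰₂, and so,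
given an upper bound on the search, are all the facts needed by a back-and-forth construction on blocks.  A
total Π⁰₂ relation has a Δ⁰₃ choice function, so an oracle in the cone computes the finitely many choice
functions involved, and the back-and-forth is primitive recursive in them.

PrCat ⇒ Cone.  Let the graph of f be given by ∃ a ∀ b ∃ c, and let `small` < `large` be two sizes in F.
We build a punctual shuffle with a convex region for every x, in which each guess w = ⟨y, a⟩ is attached to
blocks that have size `small` if ∀ b ∃ c holds for x and w, and size `large` otherwise: whenever the guess
is confirmed once more, the `large ∸ small` last elements of such a block are cut off.  All blocks of size
`small` in region x then carry a guess with f x = y.  Doing the same with a trivially true condition
gives a copy in which a block of size `small` can be found in any interval; an isomorphism between the two
copies therefore computes f.
-}

open import Defs
open import Level using (0ℓ)
open import Axiom.ExcludedMiddle using (ExcludedMiddle)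
open import Data.Bool using (Bool; true; false; if_then_else_; _∧_; _∨_; not)
open import Data.Bool.Properties using (T-≡)
open import Data.Empty using (⊥; ⊥-elim)
open import Data.Fin using (Fin; zero; suc; toℕ; fromℕ<)
open import Data.Fin.Properties using (toℕ<n; toℕ-fromℕ<)
open import Data.List using (List; []; _∷_; foldl; length; reverse; _++_; _∷ʳ_; initLast; _∷ʳ′_)
open import Data.List.Membership.Propositional using (_∈_)
open import Data.List.Properties using (reverse-++; reverse-involutive; foldl-∷ʳ; ++-assoc; ∷ʳ-injective)
open import Data.List.Relation.Unary.Any using (here; there)
open import Data.Nat
open import Data.Nat.Properties
open import Data.Product using (Σ; ∃; ∃₂; ∃-syntax; _×_; _,_; proj₁; proj₂)
import Data.Rational as ℚ
import Data.Rational.Properties as ℚₚ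
open import Data.Sum using (_⊎_; inj₁; inj₂; map₁; map₂)
open import Data.Unit using (⊤; tt)
open import Data.Vec using (Vec; []; _∷_; lookup; head; tail; tabulate)
open import Data.Vec.Properties using (tabulate∘lookup)
open import Function using (_∘_; id; flip)
open import Function.Bundles using (_⇔_; _↔_; mk⇔; mk↔ₛ′; Equivalence; Inverse)
open import Relation.Binary.Definitions using (tri<; tri≈; tri>; Tri)
open import Relation.Binary.PropositionalEquality
open import Relation.Binary.Structures using (IsStrictTotalOrder)
open import Relation.Binary.Structures.Biased using (isStrictTotalOrderᶜ)
open import Relation.Nullary using (¬_; Dec; yes; no)
open import Relation.Nullary.Decidable using (toWitness)

-- A punctual copy can neither withdraw an element nor wait with one, so a block shrinks only by
-- being cut in two, and both pieces must end in blocks with sizes from F. The piece cut off a guess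
-- is therefore reused: it receives `small` new elements and becomes a block of size `large` of its
-- own, while the guess gets a fresh tail. If confirmations stop, the last tail is never completed
-- and stays with the guess; if they never stop, every tail leaves and exactly `small` elements
-- remain. Nothing may then lie between a guess and its final tail, so larger entries are placed
-- earlier and children at stages that do not fire are empty. A search for a block of size `small`
-- has no primitive recursive bound in general; the copy with the trivial condition replaces it.
-- That the built copies are isomorphic to L at all comes from the same back-and-forth, run without
-- regard to the complexity of its choice functions. In the other direction the cone only speaks of
-- total functions, so each choice problem must have a solution on every input, including
-- meaningless bounds.

-- Primitive recursive functions, plain and relative to an oracle

record Class : Set where
  constructor class
  field
    relative : Bool
    oracle   : ℕ → ℕ
open Class

plain : Class
plain = class false (λ _ → 0)

relativeTo : (ℕ → ℕ) → Class
relativeTo = class true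

-- A term is kept together with its correctness. With the class as a parameter, one set of closure
-- lemmas serves the plain case, needed for the orders of punctual copies, and the case relative to
-- `g`.
record PR (K : Class) {n : ℕ} (f : Vec ℕ n → ℕ) : Set where
  constructor _by_
  field
    term     : Term (relative K) n
    computes : ∀ xs → eval (oracle K) term xs ≡ f xs
open PR

record PRs (K : Class) {m n : ℕ} (f : Vec ℕ m → Vec ℕ n) : Set where
  constructor _by_
  field
    terms    : Vec (Term (relative K) m) n
    computes : ∀ xs → evalVec (oracle K) terms xs ≡ f xs
open PRs

variable
  K : Class
  m n : ℕ

b2n : Bool → ℕ
b2n b = if b then 1 else 0

PRB : (K : Class) {n : ℕ} → (Vec ℕ n → Bool) → Set
PRB K p = PR K (λ xs → b2n (p xs))

var : (i : Fin n) → PR K (λ xs → lookup xs i)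
var i = projT i by λ _ → refl

v0 : PR K {suc n} (λ xs → lookup xs zero)
v0 = var zero
v1 : PR K {2 + n} (λ xs → lookup xs (suc zero))
v1 = var (suc zero)
v2 : PR K {3 + n} (λ xs → lookup xs (suc (suc zero)))
v2 = var (suc (suc zero))
v3 : PR K {4 + n} (λ xs → lookup xs (suc (suc (suc zero))))
v3 = var (suc (suc (suc zero)))
v4 : PR K {5 + n} (λ xs → lookup xs (suc (suc (suc (suc zero)))))
v4 = var (suc (suc (suc (suc zero))))
v5 : PR K {6 + n} (λ xs → lookup xs (suc (suc (suc (suc (suc zero))))))
v5 = var (suc (suc (suc (suc (suc zero)))))

record PR₁ (K : Class) (f : ℕ → ℕ) : Set where
  constructor fun
  field body : PR K {1} (λ xs → f (lookup xs zero))

record PR₂ (K : Class) (f : ℕ → ℕ → ℕ) : Set where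
  constructor fun
  field body : PR K {2} (λ xs → f (lookup xs zero) (lookup xs (suc zero)))

record PR₃ (K : Class) (f : ℕ → ℕ → ℕ → ℕ) : Set where
  constructor fun
  field body : PR K {3} (λ xs → f (lookup xs zero) (lookup xs (suc zero)) (lookup xs (suc (suc zero))))

PRB₄ : Class → (ℕ → ℕ → ℕ → ℕ → Bool) → Set
PRB₄ K R = PRB K {4} (λ xs → R (lookup xs zero) (lookup xs (suc zero)) (lookup xs (suc (suc zero)))
                               (lookup xs (suc (suc (suc zero)))))

PRB₅ : Class → (ℕ → ℕ → ℕ → ℕ → ℕ → Bool) → Set
PRB₅ K R = PRB K {5} (λ xs → R (lookup xs zero) (lookup xs (suc zero)) (lookup xs (suc (suc zero)))
                               (lookup xs (suc (suc (suc zero)))) (lookup xs (suc (suc (suc (suc zero))))))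

abstract
  ext : {f f' : Vec ℕ n → ℕ} → (∀ xs → f xs ≡ f' xs) → PR K f → PR K f'
  ext e (t by p) = t by λ xs → trans (p xs) (e xs)

  exts : {f f' : Vec ℕ m → Vec ℕ n} → (∀ xs → f xs ≡ f' xs) → PRs K f → PRs K f'
  exts e (t by p) = t by λ xs → trans (p xs) (e xs)

  nilV : PRs K {m} (λ _ → [])
  nilV = [] by λ _ → refl

  consV : {f : Vec ℕ m → ℕ} {F : Vec ℕ m → Vec ℕ n} → PR K f → PRs K F → PRs K (λ xs → f xs ∷ F xs)
  consV (t by p) (ts by q) = (t ∷ ts) by λ xs → cong₂ _∷_ (p xs) (q xs)

  tailV : {F : Vec ℕ m → Vec ℕ (suc n)} → PRs K F → PRs K (λ xs → tail (F xs))
  tailV ((t ∷ ts) by q) = ts by λ xs → cong tail (q xs)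

  tabulateV : (F : Fin n → Vec ℕ m → ℕ) → (∀ i → PR K (F i)) → PRs K (λ xs → tabulate (λ i → F i xs))
  tabulateV {n = zero}  F p = nilV
  tabulateV {n = suc n} F p = consV (p zero) (tabulateV (λ i → F (suc i)) (λ i → p (suc i)))

  idV : PRs K {m} (λ xs → xs)
  idV = exts tabulate∘lookup (tabulateV (λ i xs → lookup xs i) var)

  compV : {f : Vec ℕ n → ℕ} {F : Vec ℕ m → Vec ℕ n} → PR K f → PRs K F → PR K (λ xs → f (F xs))
  compV {K = K} {f = f} (t by p) (ts by q) = compT t ts by λ xs → trans (p _) (cong f (q xs))

  const : (k : ℕ) → PR K {n} (λ _ → k)
  const zero    = zeroT by λ _ → refl
  const (suc k) with const k
  ... | t by p = compT succT (t ∷ []) by λ xs → cong suc (p xs)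

  sucPR : {f : Vec ℕ n → ℕ} → PR K f → PR K (λ xs → suc (f xs))
  sucPR (t by p) = compT succT (t ∷ []) by λ xs → cong suc (p xs)

app₁ : ∀ {F} {f : Vec ℕ n → ℕ} → PR₁ K F → PR K f → PR K (λ xs → F (f xs))
app₁ (fun p) a = compV p (consV a nilV)

app₂ : ∀ {F} {f g : Vec ℕ n → ℕ} → PR₂ K F → PR K f → PR K g → PR K (λ xs → F (f xs) (g xs))
app₂ (fun p) a b = compV p (consV a (consV b nilV))

app₃ : ∀ {F} {f g h : Vec ℕ n → ℕ} → PR₃ K F → PR K f → PR K g → PR K h → PR K (λ xs → F (f xs) (g xs) (h xs))
app₃ (fun p) a b c = compV p (consV a (consV b (consV c nilV)))

nrec : ℕ → (ℕ → ℕ → ℕ) → ℕ → ℕ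
nrec z s zero    = z
nrec z s (suc k) = s k (nrec z s k)

abstract
  nrecPR : {z k : Vec ℕ n → ℕ} {s : Vec ℕ (2 + n) → ℕ} → PR K z → PR K s → PR K k →
           PR K (λ xs → nrec (z xs) (λ i r → s (i ∷ r ∷ xs)) (k xs))
  nrecPR {K = K} {z = z} {s = s} (tz by pz) (ts by ps) pk = compV aux (consV pk idV)
    where
    go : ∀ k xs → primRec (eval (oracle K) tz) (eval (oracle K) ts) (k ∷ xs) ≡ nrec (z xs) (λ i r → s (i ∷ r ∷ xs)) k
    go zero    xs = pz xs
    go (suc k) xs = trans (ps _) (cong (λ r → s (k ∷ r ∷ xs)) (go k xs))
    aux : PR K (λ xs → nrec (z (tail xs)) (λ i r → s (i ∷ r ∷ tail xs)) (head xs))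
    aux = recT tz ts by λ { (k ∷ xs) → go k xs }

mutual
  embed : Term false n → Term (relative K) n
  embed zeroT        = zeroT
  embed succT        = succT
  embed (projT i)    = projT i
  embed {K = K} (compT t ts) = compT (embed {K = K} t) (embeds {K = K} ts)
  embed {K = K} (recT t u)   = recT (embed {K = K} t) (embed {K = K} u)

  embeds : Vec (Term false n) m → Vec (Term (relative K) n) m
  embeds []       = []
  embeds {K = K} (t ∷ ts) = embed {K = K} t ∷ embeds {K = K} ts

primRec-ext : {f f' : Vec ℕ n → ℕ} {h h' : Vec ℕ (2 + n) → ℕ} → (∀ xs → f xs ≡ f' xs) → (∀ xs → h xs ≡ h' xs) →
              ∀ xs → primRec f h xs ≡ primRec f' h' xs
primRec-ext p q (zero ∷ xs)  = p xs
primRec-ext {h = h} p q (suc k ∷ xs) = trans (cong (λ r → h (k ∷ r ∷ xs)) (primRec-ext p q (k ∷ xs))) (q _)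

mutual
  embed-eval : (t : Term false n) → ∀ xs → eval (oracle K) (embed {K = K} t) xs ≡ evalPR t xs
  embed-eval zeroT xs = refl
  embed-eval succT (x ∷ []) = refl
  embed-eval (projT i) xs = refl
  embed-eval {K = K} (compT t ts) xs = trans (embed-eval {K = K} t _) (cong (evalPR t) (embeds-eval {K = K} ts xs))
  embed-eval {K = K} (recT t u) xs = primRec-ext (embed-eval {K = K} t) (embed-eval {K = K} u) xs

  embeds-eval : (ts : Vec (Term false n) m) → ∀ xs → evalVec (oracle K) (embeds {K = K} ts) xs ≡ evalVec (λ _ → 0) ts xs
  embeds-eval [] xs = refl
  embeds-eval {K = K} (t ∷ ts) xs = cong₂ _∷_ (embed-eval {K = K} t xs) (embeds-eval {K = K} ts xs)

abstract
  termPR : (t : Term false n) → PR K (evalPR t)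
  termPR {K = K} t = embed {K = K} t by embed-eval {K = K} t

  predPR : PR₁ K pred
  predPR = fun (ext (λ { (zero ∷ []) → refl ; (suc x ∷ []) → refl }) (nrecPR {z = λ _ → 0} (const 0) v0 v0))

  +PR : PR₂ K _+_
  +PR = fun (ext (λ { (x ∷ y ∷ []) → go x y }) (nrecPR v1 (sucPR v1) v0))
    where
    go : ∀ x y → nrec y (λ i r → suc r) x ≡ x + y
    go zero    y = refl
    go (suc x) y = cong suc (go x y)

  ∸PR : PR₂ K _∸_
  ∸PR = fun (ext (λ { (x ∷ y ∷ []) → go x y }) (nrecPR v0 (app₁ predPR v1) v1))
    where
    go : ∀ x y → nrec x (λ i r → pred r) y ≡ x ∸ y
    go x zero    = refl
    go x (suc y) = trans (cong pred (go x y)) (pred[m∸n]≡m∸[1+n] x y)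

  ifzPR : PR₃ K (λ c a b → if c ≡ᵇ 0 then a else b)
  ifzPR = fun (ext (λ { (zero ∷ a ∷ b ∷ []) → refl ; (suc x ∷ a ∷ b ∷ []) → refl }) (nrecPR v1 v4 v0))

  ifPR : {c : Vec ℕ n → Bool} {f g : Vec ℕ n → ℕ} → PRB K c → PR K f → PR K g → PR K (λ xs → if c xs then f xs else g xs)
  ifPR {c = c} {f} {g} pc pf pg = ext (λ xs → go (c xs) (f xs) (g xs)) (app₃ ifzPR pc pg pf)
    where
    go : ∀ c (a b : ℕ) → (if b2n c ≡ᵇ 0 then b else a) ≡ (if c then a else b)
    go true  a b = refl
    go false a b = refl

  notPR : {p : Vec ℕ n → Bool} → PRB K p → PRB K (λ xs → not (p xs))
  notPR {p = p} pp = ext (λ xs → go (p xs)) (ifPR pp (const 0) (const 1))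
    where
    go : ∀ c → (if c then 0 else 1) ≡ b2n (not c)
    go true = refl
    go false = refl

  andPR : {p q : Vec ℕ n → Bool} → PRB K p → PRB K q → PRB K (λ xs → p xs ∧ q xs)
  andPR {p = p} {q} pp pq = ext (λ xs → go (p xs) (q xs)) (ifPR pp pq (const 0))
    where
    go : ∀ c d → (if c then b2n d else 0) ≡ b2n (c ∧ d)
    go true d = refl
    go false d = refl

  orPR : {p q : Vec ℕ n → Bool} → PRB K p → PRB K q → PRB K (λ xs → p xs ∨ q xs)
  orPR {p = p} {q} pp pq = ext (λ xs → go (p xs) (q xs)) (ifPR pp (const 1) pq)
    where
    go : ∀ c d → (if c then 1 else b2n d) ≡ b2n (c ∨ d)
    go true d = refl
    go false d = refl

  zeroB : {f : Vec ℕ n → ℕ} → PR K f → PRB K (λ xs → f xs ≡ᵇ 0)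
  zeroB {f = f} pf = ext (λ xs → go (f xs)) (app₃ ifzPR pf (const 1) (const 0))
    where
    go : ∀ x → (if x ≡ᵇ 0 then 1 else 0) ≡ b2n (x ≡ᵇ 0)
    go x = refl

  ltPR : {f g : Vec ℕ n → ℕ} → PR K f → PR K g → PRB K (λ xs → f xs <ᵇ g xs)
  ltPR {f = f} {g} pf pg = ext (λ xs → go (f xs) (g xs)) (notPR (zeroB (app₂ ∸PR pg pf)))
    where
    go : ∀ x y → b2n (not (y ∸ x ≡ᵇ 0)) ≡ b2n (x <ᵇ y)
    go zero    zero    = refl
    go zero    (suc y) = refl
    go (suc x) zero    = refl
    go (suc x) (suc y) = go x y

  eqPR : {f g : Vec ℕ n → ℕ} → PR K f → PR K g → PRB K (λ xs → f xs ≡ᵇ g xs)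
  eqPR {f = f} {g} pf pg = ext (λ xs → go (f xs) (g xs)) (andPR (notPR (ltPR pf pg)) (notPR (ltPR pg pf)))
    where
    go : ∀ x y → b2n (not (x <ᵇ y) ∧ not (y <ᵇ x)) ≡ b2n (x ≡ᵇ y)
    go zero    zero    = refl
    go zero    (suc y) = refl
    go (suc x) zero    = refl
    go (suc x) (suc y) = go x y

allB : (ℕ → Bool) → ℕ → Bool
allB p zero    = true
allB p (suc k) = p k ∧ allB p k

anyB : (ℕ → Bool) → ℕ → Bool
anyB p zero    = false
anyB p (suc k) = p k ∨ anyB p k

dropSnd : {f : Vec ℕ (suc n) → ℕ} → PR K f → PR K {2 + n} (λ ys → f (head ys ∷ tail (tail ys)))
dropSnd p = compV p (consV (ext (λ { (x ∷ ys) → refl }) v0) (tailV (tailV idV)))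

dropFst : {f : Vec ℕ (suc n) → ℕ} → PR K f → PR K {2 + n} (λ ys → f (tail ys))
dropFst p = compV p (tailV idV)

abstract
  allPR : {p : Vec ℕ (suc n) → Bool} {k : Vec ℕ n → ℕ} → PRB K p → PR K k →
          PRB K (λ xs → allB (λ i → p (i ∷ xs)) (k xs))
  allPR {p = p} {k} pp pk = ext (λ xs → go xs (k xs)) (nrecPR (const 1) (ifPR (dropSnd pp) v1 (const 0)) pk)
    where
    go : ∀ xs k → nrec 1 (λ i r → if p (i ∷ xs) then r else 0) k ≡ b2n (allB (λ i → p (i ∷ xs)) k)
    go xs zero = refl
    go xs (suc k) with p (k ∷ xs)
    ... | true  = go xs k
    ... | false = refl

  anyPR : {p : Vec ℕ (suc n) → Bool} {k : Vec ℕ n → ℕ} → PRB K p → PR K k →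
          PRB K (λ xs → anyB (λ i → p (i ∷ xs)) (k xs))
  anyPR {p = p} {k} pp pk = ext (λ xs → go xs (k xs)) (nrecPR (const 0) (ifPR (dropSnd pp) (const 1) v1) pk)
    where
    go : ∀ xs k → nrec 0 (λ i r → if p (i ∷ xs) then 1 else r) k ≡ b2n (anyB (λ i → p (i ∷ xs)) k)
    go xs zero = refl
    go xs (suc k) with p (k ∷ xs)
    ... | true  = refl
    ... | false = go xs k

infix 3 ✓_
✓_ : Bool → Set
✓ b = b ≡ true

✓∧ : ∀ {a b} → ✓ (a ∧ b) → ✓ a × ✓ b
✓∧ {true} {true} _ = refl , refl

∧✓ : ∀ {a b} → ✓ a → ✓ b → ✓ (a ∧ b)
∧✓ refl refl = refl

✓∨ : ∀ {a b} → ✓ (a ∨ b) → ✓ a ⊎ ✓ b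
✓∨ {true}  _ = inj₁ refl
✓∨ {false} p = inj₂ p

∨✓₁ : ∀ {a b} → ✓ a → ✓ (a ∨ b)
∨✓₁ refl = refl

∨✓₂ : ∀ {a b} → ✓ b → ✓ (a ∨ b)
∨✓₂ {true}  _ = refl
∨✓₂ {false} p = p

✓not : ∀ {a} → ✓ (not a) → ¬ ✓ a
✓not {false} _ ()

not✓ : ∀ {a} → ¬ ✓ a → ✓ (not a)
not✓ {true}  p = ⊥-elim (p refl)
not✓ {false} p = refl

✓? : ∀ b → ✓ b ⊎ b ≡ false
✓? true = inj₁ refl
✓? false = inj₂ refl

false✗ : ∀ {b} → b ≡ false → ¬ ✓ b
false✗ refl ()

✗false : ∀ {b} → ¬ ✓ b → b ≡ false
✗false {true}  p = ⊥-elim (p refl)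
✗false {false} p = refl

✓< : ∀ {x y} → ✓ (x <ᵇ y) → x < y
✓< {x} {y} p = <ᵇ⇒< x y (Equivalence.from T-≡ p)

<✓ : ∀ {x y} → x < y → ✓ (x <ᵇ y)
<✓ p = Equivalence.to T-≡ (<⇒<ᵇ p)

✓≡ : ∀ {x y} → ✓ (x ≡ᵇ y) → x ≡ y
✓≡ {x} {y} p = ≡ᵇ⇒≡ x y (Equivalence.from T-≡ p)

≡✓ : ∀ {x y} → x ≡ y → ✓ (x ≡ᵇ y)
≡✓ {x} {y} p = Equivalence.to T-≡ (≡⇒≡ᵇ x y p)

b2n-✓ : ∀ {b} → b2n b ≡ 1 → ✓ b
b2n-✓ {true} _ = refl

✓-b2n : ∀ {b} → ✓ b → b2n b ≡ 1
✓-b2n refl = refl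

✓all : ∀ {p} k → ✓ (allB p k) → ∀ {i} → i < k → ✓ (p i)
✓all {p} (suc k) a {i} i<k with ✓∧ a | m≤n⇒m<n∨m≡n (≤-pred i<k)
... | q , a' | inj₁ i<k' = ✓all k a' i<k'
... | q , a' | inj₂ refl = q

all✓ : ∀ {p} k → (∀ {i} → i < k → ✓ (p i)) → ✓ (allB p k)
all✓ zero    h = refl
all✓ (suc k) h = ∧✓ (h (n<1+n k)) (all✓ k (λ i<k → h (m<n⇒m<1+n i<k)))

✓any : ∀ {p} k → ✓ (anyB p k) → ∃[ i ] i < k × ✓ (p i)
✓any {p} (suc k) a with ✓∨ {p k} a
... | inj₁ q = k , n<1+n k , q
... | inj₂ a' with ✓any k a'
... | i , i<k , q = i , m<n⇒m<1+n i<k , q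

any✓ : ∀ {p} k {i} → i < k → ✓ (p i) → ✓ (anyB p k)
any✓ {p} (suc k) {i} i<k q with m≤n⇒m<n∨m≡n (≤-pred i<k)
... | inj₁ i<k' = ∨✓₂ {p k} (any✓ k i<k' q)
... | inj₂ refl = ∨✓₁ q

-- Coding of pairs and lists

abstract
  tri : ℕ → ℕ
  tri = nrec 0 (λ i r → suc (i + r))

  -- Cantor's pairing along antidiagonals; `tri` gives the triangular numbers at which the
  -- antidiagonals begin.
  pair : ℕ → ℕ → ℕ
  pair x y = tri (x + y) + y

  -- the largest s with tri s ≤ z
  diag : ℕ → ℕ
  diag = nrec 0 (λ i r → if suc i <ᵇ tri (suc r) then r else suc r)

  snd : ℕ → ℕ
  snd z = z ∸ tri (diag z)

  fst : ℕ → ℕ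
  fst z = diag z ∸ snd z

  triPR : PR₁ K tri
  triPR = fun (nrecPR (const 0) (sucPR (app₂ +PR v0 v1)) v0)

  pairPR : PR₂ K pair
  pairPR = fun (app₂ +PR (app₁ triPR (app₂ +PR v0 v1)) v1)

  diagPR : PR₁ K diag
  diagPR = fun (nrecPR (const 0) (ifPR (ltPR (sucPR v0) (app₁ triPR (sucPR v1))) v1 (sucPR v1)) v0)

  sndPR : PR₁ K snd
  sndPR = fun (app₂ ∸PR v0 (app₁ triPR (app₁ diagPR v0)))

  fstPR : PR₁ K fst
  fstPR = fun (app₂ ∸PR (app₁ diagPR v0) (app₁ sndPR v0))

  tri-mono : ∀ {s t} → s ≤ t → tri s ≤ tri t
  tri-mono {zero}  {t}     _ = z≤n
  tri-mono {suc s} {suc t} (s≤s p) = s≤s (+-mono-≤ p (tri-mono p))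

  diag-spec : ∀ z → tri (diag z) ≤ z × z < tri (suc (diag z))
  diag-spec zero = z≤n , s≤s z≤n
  diag-spec (suc z) with diag-spec z | suc z <ᵇ tri (suc (diag z)) in eq
  ... | lo , hi | true  = m≤n⇒m≤1+n lo , ✓< eq
  ... | lo , hi | false = hi' , s≤s (≤-trans hi (≤-trans (n≤1+n _) (s≤s (m≤n+m _ (diag z)))))
    where
    hi' : tri (suc (diag z)) ≤ suc z
    hi' = ≮⇒≥ (λ lt → false✗ eq (<✓ lt))

  diag-unique : ∀ {z s} → tri s ≤ z → z < tri (suc s) → diag z ≡ s
  diag-unique {z} {s} lo hi with diag-spec z | <-cmp (diag z) s
  ... | _ , hi' | tri< lt _ _ = ⊥-elim (<-irrefl refl (<-≤-trans hi' (≤-trans (tri-mono lt) lo)))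
  ... | _ , _   | tri≈ _ e _ = e
  ... | lo' , _ | tri> _ _ gt = ⊥-elim (<-irrefl refl (<-≤-trans hi (≤-trans (tri-mono gt) lo')))

  diag-pair : ∀ x y → diag (pair x y) ≡ x + y
  diag-pair x y = diag-unique (m≤m+n _ y) (s≤s (subst (_≤ x + y + tri (x + y)) (+-comm y _) (+-monoˡ-≤ _ (m≤n+m y x))))

  snd-pair : ∀ x y → snd (pair x y) ≡ y
  snd-pair x y = trans (cong (λ r → pair x y ∸ tri r) (diag-pair x y)) (m+n∸m≡n (tri (x + y)) y)

  fst-pair : ∀ x y → fst (pair x y) ≡ x
  fst-pair x y = trans (cong₂ _∸_ (diag-pair x y) (snd-pair x y)) (m+n∸n≡m x y)

  snd≤diag : ∀ z → snd z ≤ diag z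
  snd≤diag z with diag-spec z
  ... | lo , s≤s hi = ≤-trans (∸-monoˡ-≤ (tri (diag z)) hi) (≤-reflexive (m+n∸n≡m (diag z) (tri (diag z))))

  pair-eta : ∀ z → pair (fst z) (snd z) ≡ z
  pair-eta z = trans (cong (λ s → tri s + snd z) (m∸n+n≡m (snd≤diag z))) (m+[n∸m]≡n (proj₁ (diag-spec z)))

  tri≥ : ∀ s → s ≤ tri s
  tri≥ zero    = z≤n
  tri≥ (suc s) = s≤s (m≤m+n s _)

  pair≥₁ : ∀ x y → x ≤ pair x y
  pair≥₁ x y = ≤-trans (m≤m+n x y) (≤-trans (tri≥ (x + y)) (m≤m+n _ y))

  pair≥₂ : ∀ x y → y ≤ pair x y
  pair≥₂ x y = m≤n+m y _

snd≤ : ∀ z → snd z ≤ z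
snd≤ z = subst (snd z ≤_) (pair-eta z) (pair≥₂ (fst z) (snd z))

cons : ℕ → ℕ → ℕ
cons x l = suc (pair x l)

hd : ℕ → ℕ
hd l = fst (pred l)

tl : ℕ → ℕ
tl l = snd (pred l)

-- The first argument is fuel. The code of a tail is smaller than that of the list, so the code
-- itself is enough fuel. Every number codes exactly one list, hence equality of nodes can be tested
-- on codes.
decode : ℕ → ℕ → List ℕ
decode zero    l       = []
decode (suc k) zero    = []
decode (suc k) (suc l) = fst l ∷ decode k (snd l)

dec : ℕ → List ℕ
dec l = decode l l

enc : List ℕ → ℕ
enc []       = 0
enc (x ∷ xs) = cons x (enc xs)

decode-enc : ∀ k xs → enc xs ≤ k → decode k (enc xs) ≡ xs
decode-enc zero    []       _ = refl
decode-enc (suc k) []       _ = refl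
decode-enc (suc k) (x ∷ xs) (s≤s p) rewrite fst-pair x (enc xs) | snd-pair x (enc xs) =
  cong (x ∷_) (decode-enc k xs (≤-trans (pair≥₂ x _) p))

dec-enc : ∀ xs → dec (enc xs) ≡ xs
dec-enc xs = decode-enc (enc xs) xs ≤-refl

enc-decode : ∀ k l → l ≤ k → enc (decode k l) ≡ l
enc-decode zero    zero    _ = refl
enc-decode (suc k) zero    _ = refl
enc-decode (suc k) (suc l) (s≤s p) =
  cong suc (trans (cong (pair (fst l)) (enc-decode k (snd l) (≤-trans (snd≤ l) p))) (pair-eta l))

enc-dec : ∀ l → enc (dec l) ≡ l
enc-dec l = enc-decode l l ≤-refl

dec-inj : ∀ {x y} → dec x ≡ dec y → x ≡ y
dec-inj {x} {y} e = trans (sym (enc-dec x)) (trans (cong enc e) (enc-dec y))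

dec-cons : ∀ x l → dec (cons x l) ≡ x ∷ dec l
dec-cons x l = trans (cong (dec ∘ cons x) (sym (enc-dec l))) (dec-enc (x ∷ dec l))

dec-hd-tl : ∀ {l h t} → dec l ≡ h ∷ t → hd l ≡ h × dec (tl l) ≡ t
dec-hd-tl {zero}  ()
dec-hd-tl {suc l} {h} {t} e with trans (sym (dec-cons (fst l) (snd l))) (trans (cong (dec ∘ suc) (pair-eta l)) e)
... | refl = refl , refl

-- Lets the code of a node serve as a bound on its entries when another node has to be placed just
-- before it.
∈≤enc : ∀ {x xs} → x ∈ xs → x < enc xs
∈≤enc {x} (here refl) = s≤s (pair≥₁ x _)
∈≤enc {x} {y ∷ ys} (there p) = s≤s (≤-trans (<⇒≤ (∈≤enc p)) (pair≥₂ y _))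

abstract
  consPR : PR₂ K cons
  consPR = fun (sucPR (app₂ pairPR v0 v1))

  hdPR : PR₁ K hd
  hdPR = fun (app₁ fstPR (app₁ predPR v0))

  tlPR : PR₁ K tl
  tlPR = fun (app₁ sndPR (app₁ predPR v0))

  -- The iterated state pairs the rest of the list with the accumulator. The code of a list bounds
  -- its length, so it can be used as the number of iterations; those after the end of the list
  -- change nothing.
  foldPR : {z l : Vec ℕ n → ℕ} {s : Vec ℕ (2 + n) → ℕ} → PR K s → PR K z → PR K l →
           PR K (λ xs → foldl (λ a e → s (a ∷ e ∷ xs)) (z xs) (dec (l xs)))
  foldPR {n = n} {K = K} {z = z} {l} {s} ps pz pl =
    ext (λ xs → trans (cong snd (trans (iter-decode xs (l xs) (l xs) (z xs)) refl)) (run-spec xs (l xs) (l xs) (z xs)))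
      (app₁ sndPR (nrecPR (app₂ pairPR pl pz) step pl))
    where
    f : Vec ℕ n → ℕ → ℕ → ℕ
    f xs a e = s (a ∷ e ∷ xs)
    stepS : Vec ℕ n → ℕ → ℕ
    stepS xs st = if fst st ≡ᵇ 0 then st else pair (tl (fst st)) (f xs (snd st) (hd (fst st)))
    step : PR K {2 + n} (λ ys → if fst (lookup ys (suc zero)) ≡ᵇ 0 then lookup ys (suc zero)
              else pair (tl (fst (lookup ys (suc zero)))) (s (snd (lookup ys (suc zero)) ∷ hd (fst (lookup ys (suc zero))) ∷ tail (tail ys))))
    step = ifPR (zeroB (app₁ fstPR v1)) v1
             (app₂ pairPR (app₁ tlPR (app₁ fstPR v1))
               (compV ps (consV (app₁ sndPR v1) (consV (app₁ hdPR (app₁ fstPR v1)) (tailV (tailV idV))))))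
    run : Vec ℕ n → ℕ → ℕ → ℕ
    run xs zero    st = st
    run xs (suc k) st = run xs k (stepS xs st)
    run-step : ∀ xs k st → run xs k (stepS xs st) ≡ stepS xs (run xs k st)
    run-step xs zero    st = refl
    run-step xs (suc k) st = run-step xs k (stepS xs st)
    iter-decode : ∀ xs k l a → nrec (pair l a) (λ i st → stepS xs st) k ≡ run xs k (pair l a)
    iter-decode xs zero    l a = refl
    iter-decode xs (suc k) l a = trans (cong (stepS xs) (iter-decode xs k l a)) (sym (run-step xs k _))
    run-spec : ∀ xs k l a → snd (run xs k (pair l a)) ≡ foldl (f xs) a (decode k l)
    run-spec xs zero    l a = snd-pair l a
    run-spec xs (suc k) zero a rewrite fst-pair 0 a = trans (run-spec xs k 0 a) (lemma k)
      where
      lemma : ∀ k → foldl (f xs) a (decode k 0) ≡ a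
      lemma zero    = refl
      lemma (suc k) = refl
    run-spec xs (suc k) (suc l) a rewrite fst-pair (suc l) a | snd-pair (suc l) a = run-spec xs k (snd l) _

anyL : (ℕ → Bool) → List ℕ → Bool
anyL p []       = false
anyL p (x ∷ xs) = p x ∨ anyL p xs

✓anyL : ∀ {p} xs → ✓ (anyL p xs) → ∃[ x ] x ∈ xs × ✓ (p x)
✓anyL {p} (x ∷ xs) a with ✓∨ {p x} a
... | inj₁ q = x , here refl , q
... | inj₂ a' with ✓anyL xs a'
... | y , y∈ , q = y , there y∈ , q

anyL✓ : ∀ {p x} xs → x ∈ xs → ✓ (p x) → ✓ (anyL p xs)
anyL✓ (x ∷ xs) (here refl) q = ∨✓₁ q
anyL✓ {p} (x ∷ xs) (there m) q = ∨✓₂ {p x} (anyL✓ xs m q)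

rev : ℕ → ℕ
rev l = foldl (λ a e → cons e a) 0 (dec l)

len : ℕ → ℕ
len l = foldl (λ a e → suc a) 0 (dec l)

abstract
  anyLPR : {p : Vec ℕ (suc n) → Bool} {l : Vec ℕ n → ℕ} → PRB K p → PR K l →
           PRB K (λ xs → anyL (λ e → p (e ∷ xs)) (dec (l xs)))
  anyLPR {p = p} {l} pp pl = ext (λ xs → go xs false (dec (l xs)))
    (foldPR (orPR (notPR (zeroB v0)) (dropFst pp)) (const 0) pl)
    where
    go : ∀ xs b ys → foldl (λ a e → b2n (not (a ≡ᵇ 0) ∨ p (e ∷ xs))) (b2n b) ys ≡ b2n (b ∨ anyL (λ e → p (e ∷ xs)) ys)
    go xs true  []       = refl
    go xs false []       = refl
    go xs true  (y ∷ ys) = go xs true ys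
    go xs false (y ∷ ys) = go xs (p (y ∷ xs)) ys

  revPR : PR₁ K rev
  revPR = fun (foldPR (app₂ consPR v1 v0) (const 0) v0)

  lenPR : PR₁ K len
  lenPR = fun (foldPR (sucPR v0) (const 0) v0)

dec-rev : ∀ l → dec (rev l) ≡ reverse (dec l)
dec-rev l = go 0 (dec l)
  where
  go : ∀ a xs → dec (foldl (λ a e → cons e a) a xs) ≡ foldl (flip _∷_) (dec a) xs
  go a []       = refl
  go a (x ∷ xs) = trans (go (cons x a) xs) (cong (λ z → foldl (flip _∷_) z xs) (dec-cons x a))

len-spec : ∀ l → len l ≡ length (dec l)
len-spec l = go 0 (dec l)
  where
  go : ∀ a (xs : List ℕ) → foldl (λ a e → suc a) a xs ≡ a + length xs
  go a []       = sym (+-identityʳ a)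
  go a (x ∷ xs) = trans (go (suc a) xs) (sym (+-suc a (length xs)))

memb : ℕ → ℕ → Bool
memb x l = anyL (λ e → e ≡ᵇ x) (dec l)

abstract
  membPR : {x l : Vec ℕ n → ℕ} → PR K x → PR K l → PRB K (λ xs → memb (x xs) (l xs))
  membPR px pl = anyLPR (eqPR v0 (compV px (tailV idV))) pl

✓memb : ∀ {x l} → ✓ memb x l → x ∈ dec l
✓memb {x} {l} p with ✓anyL (dec l) p
... | y , y∈ , q = subst (_∈ dec l) (✓≡ q) y∈

memb✓ : ∀ {x l} → x ∈ dec l → ✓ memb x l
memb✓ {x} {l} p = anyL✓ (dec l) p (≡✓ {x} refl)

snoc : ℕ → ℕ → ℕ
snoc l x = rev (cons x (rev l))

abstract
  snocPR : PR₂ K snoc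
  snocPR = fun (app₁ revPR (app₂ consPR v1 (app₁ revPR v0)))

dec-snoc : ∀ l x → dec (snoc l x) ≡ dec l ∷ʳ x
dec-snoc l x = begin
  dec (rev (cons x (rev l)))     ≡⟨ dec-rev (cons x (rev l)) ⟩
  reverse (dec (cons x (rev l))) ≡⟨ cong reverse (dec-cons x (rev l)) ⟩
  reverse (x ∷ dec (rev l))      ≡⟨ cong (λ z → reverse (x ∷ z)) (dec-rev l) ⟩
  reverse (x ∷ reverse (dec l))  ≡⟨ reverse-++ (x ∷ []) (reverse (dec l)) ⟩
  reverse (reverse (dec l)) ∷ʳ x ≡⟨ cong (_∷ʳ x) (reverse-involutive (dec l)) ⟩
  dec l ∷ʳ x ∎
  where open ≡-Reasoning

-- Collection, minimal witnesses and Δ⁰₃ choice functions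

collect : {P : ℕ → ℕ → Set} → ∀ n → (∀ {i} → i < n → ∃[ k ] P i k) → ∃[ N ] ∀ {i} → i < n → ∃[ k ] k < N × P i k
collect zero    h = 0 , λ ()
collect {P} (suc n) h with collect n (λ i<n → h (m<n⇒m<1+n i<n)) | h (n<1+n n)
... | N , hN | k , pk = N ⊔ suc k , λ i<n → go (m≤n⇒m<n∨m≡n (≤-pred i<n))
  where
  go : ∀ {i} → i < n ⊎ i ≡ n → ∃[ k' ] k' < N ⊔ suc k × P i k'
  go (inj₁ i<n) with hN i<n
  ... | k' , lt , p = k' , <-≤-trans lt (m≤m⊔n N (suc k)) , p
  go (inj₂ refl) = k , m≤n⊔m N (suc k) , pk

module Classical (em : ExcludedMiddle 0ℓ) where

  ¬∀⇒∃¬ : {A : Set} {P : A → Set} → ¬ (∀ x → P x) → ∃[ x ] ¬ P x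
  ¬∀⇒∃¬ {A} {P} h with em {∃[ x ] ¬ P x}
  ... | yes e = e
  ... | no ne = ⊥-elim (h λ x → go x em)
    where
    go : ∀ x → Dec (P x) → P x
    go x (yes p) = p
    go x (no np) = ⊥-elim (ne (x , np))

  least : (P : ℕ → Set) → ∃ P → ∃[ y ] P y × (∀ {i} → i < y → ¬ P i)
  least P (y , py) with go (suc y)
    where
    go : ∀ n → (∃[ y ] P y × (∀ {i} → i < y → ¬ P i)) ⊎ (∀ {i} → i < n → ¬ P i)
    go zero = inj₂ λ ()
    go (suc n) with go n
    ... | inj₁ r = inj₁ r
    ... | inj₂ h with em {P n}
    ... | yes p = inj₁ (n , p , h)
    ... | no np = inj₂ λ i<n → λ pi → np' i<n pi
      where
      np' : ∀ {i} → i < suc n → ¬ P i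
      np' i<n with m≤n⇒m<n∨m≡n (≤-pred i<n)
      ... | inj₁ lt   = h lt
      ... | inj₂ refl = np
  ... | inj₁ r = r
  ... | inj₂ h = ⊥-elim (h (n<1+n y) py)

  greatest : (P : ℕ → Set) → ∃ P → ∀ N → (∀ {i} → N ≤ i → ¬ P i) → ∃[ y ] P y × (∀ {i} → y < i → ¬ P i)
  greatest P (y , py) zero    h = ⊥-elim (h z≤n py)
  greatest P e        (suc N) h with em {P N}
  ... | yes p = N , p , h
  ... | no np = greatest P e N λ {i} N≤i → go (m≤n⇒m<n∨m≡n N≤i)
    where
    go : ∀ {i} → N < i ⊎ N ≡ i → ¬ P i
    go (inj₁ lt)   = h lt
    go (inj₂ refl) = np

  -- Totality yields the Π⁰₃ form of the graph: `f x` is `y` as soon as every combination of another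
  -- value and a Σ⁰₃ witness fails. In `N` the number `a` codes value and witness together, and
  -- their failure has the form ∃ b ∀ c.
  inCone : {f : ℕ → ℕ} (M : ℕ → ℕ → ℕ → ℕ → ℕ → Bool) →
           PRB₅ plain M →
           (∀ x y → f x ≡ y ⇔ (∃[ a ] ∀ b → ∃[ c ] (✓ M x y a b c))) → Δ⁰₃Fun f
  inCone {f} M pM spec = (term pM , σ₃) , (term pN , π₃)
    where
    open PR
    N : ℕ → ℕ → ℕ → ℕ → ℕ → Bool
    N x y a b c = (fst a ≡ᵇ y) ∨ not (M x (fst a) (snd a) b c)
    pN : PRB₅ plain N
    pN = orPR (eqPR (app₁ fstPR v2) v1)
              (notPR (compV pM (consV v0 (consV (app₁ fstPR v2) (consV (app₁ sndPR v2) (consV v3 (consV v4 nilV)))))))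
    open Equivalence
    σ₃ : ∀ x y → f x ≡ y ⇔ (∃[ a ] ∀ b → ∃[ c ] HoldsPR (term pM) (x ∷ y ∷ a ∷ b ∷ c ∷ []))
    σ₃ x y = mk⇔ fwd bwd
      where
      fwd : f x ≡ y → ∃[ a ] ∀ b → ∃[ c ] HoldsPR (term pM) (x ∷ y ∷ a ∷ b ∷ c ∷ [])
      fwd e with to (spec x y) e
      ... | a , h = a , λ b → proj₁ (h b) , trans (computes pM _) (✓-b2n (proj₂ (h b)))
      bwd : (∃[ a ] ∀ b → ∃[ c ] HoldsPR (term pM) (x ∷ y ∷ a ∷ b ∷ c ∷ [])) → f x ≡ y
      bwd (a , h) = from (spec x y) (a , λ b → proj₁ (h b) , b2n-✓ (trans (sym (computes pM _)) (proj₂ (h b))))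
    π₃ : ∀ x y → f x ≡ y ⇔ (∀ a → ∃[ b ] ∀ c → HoldsPR (term pN) (x ∷ y ∷ a ∷ b ∷ c ∷ []))
    π₃ x y = mk⇔ fwd bwd
      where
      fwd : f x ≡ y → ∀ a → ∃[ b ] ∀ c → HoldsPR (term pN) (x ∷ y ∷ a ∷ b ∷ c ∷ [])
      fwd e a with fst a ≟ y
      ... | yes eq = 0 , λ c → trans (computes pN _) (✓-b2n (∨✓₁ (≡✓ eq)))
      ... | no neq with ¬∀⇒∃¬ (λ h → neq (trans (sym (from (spec x (fst a)) (snd a , h))) e))
      ... | b , hb = b , λ c → trans (computes pN _) (✓-b2n (∨✓₂ {fst a ≡ᵇ y} (not✓ (λ q → hb (c , q)))))
      bwd : (∀ a → ∃[ b ] ∀ c → HoldsPR (term pN) (x ∷ y ∷ a ∷ b ∷ c ∷ [])) → f x ≡ y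
      bwd h with f x ≟ y
      ... | yes e = e
      ... | no ne with to (spec x (f x)) refl
      ... | k , hk with h (pair (f x) k)
      ... | b , hb with hk b
      ... | c , q with ✓∨ {fst (pair (f x) k) ≡ᵇ y} (b2n-✓ (trans (sym (computes pN _)) (hb c)))
      ... | inj₁ e = ⊥-elim (ne (trans (sym (fst-pair (f x) k)) (✓≡ e)))
      ... | inj₂ nm = ⊥-elim (✓not nm (subst₂ (λ u v → ✓ M x u v b c) (sym (fst-pair _ _)) (sym (snd-pair _ _)) q))

  -- A total Π⁰₂ relation has a Δ⁰₃ choice function: the least y satisfying it.  The Σ⁰₃ form of its
  -- graph guesses a bound K below which every smaller candidate fails.
  module Uniformize (R : ℕ → ℕ → ℕ → ℕ → Bool)
    (pR : PRB₄ plain R)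
    (total : ∀ z → ∃[ y ] ∀ b → ∃[ c ] (✓ R z y b c)) where

    private
      L : ∀ z → _
      L z = least (λ y → ∀ b → ∃[ c ] (✓ R z y b c)) (total z)

    abstract
      choice : ℕ → ℕ
      choice z = proj₁ (L z)

      choice-ok : ∀ z b → ∃[ c ] (✓ R z (choice z) b c)
      choice-ok z = proj₁ (proj₂ (L z))

      private
        choice-least : ∀ z {i} → i < choice z → ¬ (∀ b → ∃[ c ] (✓ R z i b c))
        choice-least z = proj₂ (proj₂ (L z))

        -- The universal `b` does two jobs: `fst b` feeds the condition on `y`, and `snd b` cuts off
        -- the universal quantifier in the failure of the smaller candidates, whose failing argument
        -- `b'` is bounded by the guessed `k`.
        M : ℕ → ℕ → ℕ → ℕ → ℕ → Bool
        M z y k b c = R z y (fst b) c ∧ allB (λ i → anyB (λ b' → allB (λ c' → not (R z i b' c')) (snd b)) k) y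

        pM : PRB₅ plain M
        pM = andPR (compV pR (consV v0 (consV v1 (consV (app₁ fstPR v3) (consV v4 nilV)))))
                   (allPR (anyPR (allPR (notPR (compV pR (consV v3 (consV v2 (consV v1 (consV v0 nilV)))))) (app₁ sndPR v5)) v3) v1)

        spec : ∀ z y → choice z ≡ y ⇔ (∃[ k ] ∀ b → ∃[ c ] (✓ M z y k b c))
        spec z y = mk⇔ fwd bwd
          where
          fwd : choice z ≡ y → ∃[ k ] ∀ b → ∃[ c ] (✓ M z y k b c)
          fwd refl with collect {λ i b' → ∀ c → ¬ ✓ R z i b' c} y (λ i<y → let b' , h = ¬∀⇒∃¬ (choice-least z i<y) in b' , λ c q → h (c , q))
          ... | k , hk = k , λ b → let c , q = choice-ok z (fst b) in
            c , ∧✓ q (all✓ y λ i<y → let b' , b'<k , h = hk i<y in any✓ k b'<k (all✓ (snd b) (λ {c'} _ → not✓ (h c'))))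
          bwd : (∃[ k ] ∀ b → ∃[ c ] (✓ M z y k b c)) → choice z ≡ y
          bwd (k , h) with <-cmp (choice z) y
          ... | tri≈ _ e _ = e
          ... | tri> _ _ y<c = ⊥-elim (choice-least z y<c λ b → let c , q = h (pair b 0) in
                  c , subst (λ b → ✓ R z y b c) (fst-pair b 0) (proj₁ (✓∧ q)))
          -- The least solution succeeds for all `b'` below `k` with witnesses below a common `t`;
          -- cutting off at `t` therefore refutes its alleged failure.
          ... | tri< c<y _ _ with collect {λ b' c' → ✓ R z (choice z) b' c'} k (λ {b'} _ → choice-ok z b')
          ... | t , ht with h (pair 0 t)
          ... | c , q with ✓any k (✓all y (proj₂ (✓∧ q)) c<y)
          ... | b' , b'<k , a with ht b'<k
          ... | c' , c'<t , r = ⊥-elim (✓not (✓all (snd (pair 0 t)) a (subst (c' <_) (sym (snd-pair 0 t)) c'<t)) r)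

      choice-Δ⁰₃ : Δ⁰₃Fun choice
      choice-Δ⁰₃ = inCone M pM spec

-- Maximal finite blocks of a linear order

module Order (A : PunctualLO) where

  infix 4 _≺_
  _≺_ : ℕ → ℕ → Set
  _≺_ = _<ₒ_ A

  open IsStrictTotalOrder (PunctualLO.isLinOrd A) public
    using () renaming (trans to ≺-trans; compare to ≺-cmp)

  ≺-irrefl : ∀ {x} → ¬ x ≺ x
  ≺-irrefl = IsStrictTotalOrder.irrefl (PunctualLO.isLinOrd A) refl

  ≺-asym : ∀ {x y} → x ≺ y → ¬ y ≺ x
  ≺-asym p q = ≺-irrefl (≺-trans p q)

  lt : ℕ → ℕ → Bool
  lt x y = evalPR (PunctualLO.ordT A) (x ∷ y ∷ []) ≡ᵇ 1

  ✓lt : ∀ {x y} → ✓ lt x y → x ≺ y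
  ✓lt = ✓≡

  lt✓ : ∀ {x y} → x ≺ y → ✓ lt x y
  lt✓ = ≡✓

  abstract
    ≺PR : {f g : Vec ℕ n → ℕ} → PR K f → PR K g → PRB K (λ xs → lt (f xs) (g xs))
    ≺PR pf pg = eqPR (compV (termPR (PunctualLO.ordT A)) (consV pf (consV pg nilV))) (const 1)

  Adj : ℕ → ℕ → Set
  Adj x y = x ≺ y × (∀ b → ¬ (x ≺ b × b ≺ y))

  -- In a linear order this expresses the absence of an immediate predecessor; the positive ∀∃ form
  -- is the one a Π⁰₂ test can check.
  NoPred : ℕ → Set
  NoPred h = ∀ b → b ≺ h → ∃[ c ] b ≺ c × c ≺ h

  NoSucc : ℕ → Set
  NoSucc l = ∀ b → l ≺ b → ∃[ c ] l ≺ c × c ≺ b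

  Chain : ℕ → List ℕ → Set
  Chain h []      = NoSucc h
  Chain h (y ∷ t) = Adj h y × Chain y t

  Block : List ℕ → Set
  Block []      = ⊥
  Block (h ∷ t) = NoPred h × Chain h t

  chain-unique : ∀ {h} t t' → Chain h t → Chain h t' → t ≡ t'
  chain-unique [] [] _ _ = refl
  chain-unique [] (y ∷ t') ns ((h<y , no-b) , _) = let c , p = ns y h<y in ⊥-elim (no-b c p)
  chain-unique (y ∷ t) [] ((h<y , no-b) , _) ns = let c , p = ns y h<y in ⊥-elim (no-b c p)
  chain-unique (y ∷ t) (y' ∷ t') ((h<y , nb) , ch) ((h<y' , nb') , ch') with ≺-cmp y y'
  ... | tri< lt _ _ = ⊥-elim (nb' y (h<y , lt))
  ... | tri> _ _ gt = ⊥-elim (nb y' (h<y' , gt))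
  ... | tri≈ _ refl _ = cong (y ∷_) (chain-unique t t' ch ch')

  chain-tail : ∀ {h x} t → Chain h t → x ∈ t → h ≺ x
  chain-tail (y ∷ t) ((h<y , _) , ch) (here refl) = h<y
  chain-tail (y ∷ t) ((h<y , _) , ch) (there m) = ≺-trans h<y (chain-tail t ch m)

  chain-pred : ∀ {h x} t → Chain h t → x ∈ t → ∃[ y ] Adj y x
  chain-pred {h} (y ∷ t) (a , ch) (here refl) = h , a
  chain-pred (y ∷ t) (a , ch) (there m) = chain-pred t ch m

  NoPred⇒¬Adj : ∀ {x y} → NoPred x → ¬ Adj y x
  NoPred⇒¬Adj {x} {y} np (y<x , nb) = let c , p = np y y<x in nb c p

  -- A step to an immediate successor cannot jump over `h'`, and it cannot land on `h'`, which has
  -- no immediate predecessor. Two blocks thus never interleave.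
  chain-before : ∀ {h h' y} t → Chain h t → y ∈ h ∷ t → NoPred h' → h ≺ h' → y ≺ h'
  chain-before t ch (here refl) np h<h' = h<h'
  chain-before {h' = h'} (y ∷ t) (a@(h<y , nb) , ch) (there m) np h<h' with ≺-cmp y h'
  ... | tri< lt _ _   = chain-before t ch m np lt
  ... | tri≈ _ refl _ = ⊥-elim (NoPred⇒¬Adj np a)
  ... | tri> _ _ gt   = ⊥-elim (nb h' (h<h' , gt))

  chain-≤ : ∀ {h y} t → Chain h t → y ∈ h ∷ t → ¬ y ≺ h
  chain-≤ t ch (here refl) p = ≺-irrefl p
  chain-≤ t ch (there m) p = ≺-asym (chain-tail t ch m) p

  head-unique : ∀ {h h' t t' x} → Block (h ∷ t) → Block (h' ∷ t') → x ∈ h ∷ t → x ∈ h' ∷ t' → h ≡ h'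
  head-unique {h} {h'} {t} {t'} (np , ch) (np' , ch') m m' with ≺-cmp h h'
  ... | tri< lt _ _ = ⊥-elim (chain-≤ t' ch' m' (chain-before t ch m np' lt))
  ... | tri≈ _ e _  = e
  ... | tri> _ _ gt = ⊥-elim (chain-≤ t ch m (chain-before t' ch' m' np gt))

  block-unique : ∀ l l' {x} → Block l → Block l' → x ∈ l → x ∈ l' → l ≡ l'
  block-unique (h ∷ t) (h' ∷ t') b b' m m' with head-unique b b' m m'
  ... | refl = cong (h ∷_) (chain-unique t t' (proj₂ b) (proj₂ b'))

  NoPred⇒head : ∀ {h x} t → Block (h ∷ t) → NoPred x → x ∈ h ∷ t → x ≡ h
  NoPred⇒head t b np (here e) = e
  NoPred⇒head t (_ , ch) np (there m) = ⊥-elim (NoPred⇒¬Adj np (proj₂ (chain-pred t ch m)))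

-- Shuffles through their blocks, and presentations by labelled points

-- The first-order content of being the shuffle of the finite orders with sizes in F; a block is
-- represented by its first element.
record Shuffled (F : ℕ → Set) (A : PunctualLO) : Set where
  open Order A
  field
    blockOf : ∀ x → ∃₂ λ h t → Block (h ∷ t) × x ∈ h ∷ t × F (suc (length t))
    -- `NoPred y` rules out that `x` and `y` lie in one block, where no further block would fit
    -- between them.
    between : ∀ {x y s} → x ≺ y → NoPred y → F s →
              ∃₂ λ h t → Block (h ∷ t) × suc (length t) ≡ s × x ≺ h × h ≺ y
    below   : ∀ x {s} → F s → ∃₂ λ h t → Block (h ∷ t) × suc (length t) ≡ s × h ≺ x
    above   : ∀ x {s} → F s → ∃₂ λ h t → Block (h ∷ t) × suc (length t) ≡ s × x ≺ h

-- Common form of two situations: the rationals with their labels for the given shuffle, and the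
-- nodes carrying a block for the copies built below. `Point` singles out the members of `P` in use.
record Presentation (F : ℕ → Set) (A : PunctualLO) : Set₁ where
  open Order A
  infix 4 _<P_
  field
    P        : Set
    _<P_     : P → P → Set
    <P-irrefl : ∀ {p} → ¬ p <P p
    <P-trans : ∀ {p q r} → p <P q → q <P r → p <P r
    Point    : P → Set
    size     : P → ℕ
    point    : ℕ → P
    index    : ℕ → ℕ
    point-ok : ∀ x → Point (point x)
    index-ok : ∀ x → index x < size (point x)
    size-F   : ∀ {p} → Point p → F (size p)
    element  : ∀ {p i} → Point p → i < size p → ∃[ x ] point x ≡ p × index x ≡ i
    ordered  : ∀ {x y} → x ≺ y → point x <P point y ⊎ (point x ≡ point y × index x < index y)
    dense    : ∀ {p q s} → Point p → Point q → p <P q → F s → ∃[ r ] Point r × size r ≡ s × p <P r × r <P q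
    lower    : ∀ {p s} → Point p → F s → ∃[ r ] Point r × size r ≡ s × r <P p
    upper    : ∀ {p s} → Point p → F s → ∃[ r ] Point r × size r ≡ s × p <P r

module FromPresentation {F : ℕ → Set} (F-pos : ∀ {s} → F s → 1 ≤ s) {A : PunctualLO} (pres : Presentation F A) where
  open Order A
  open Presentation pres

  -- The field `ordered` leads from elements to points; the way back uses that the order of elements
  -- is total and that of the points irreflexive and transitive.
  point-≺ : ∀ {x y} → point x <P point y → x ≺ y
  point-≺ {x} {y} p with ≺-cmp x y
  ... | tri< lt _ _ = lt
  ... | tri≈ _ refl _ = ⊥-elim (<P-irrefl p)
  ... | tri> _ _ gt with ordered gt
  ... | inj₁ q = ⊥-elim (<P-irrefl (<P-trans p q))
  ... | inj₂ (e , _) = ⊥-elim (<P-irrefl (subst (point x <P_) e p))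

  index-≺ : ∀ {x y} → point x ≡ point y → index x < index y → x ≺ y
  index-≺ {x} {y} e i with ≺-cmp x y
  ... | tri< lt _ _ = lt
  ... | tri≈ _ refl _ = ⊥-elim (<-irrefl refl i)
  ... | tri> _ _ gt with ordered gt
  ... | inj₁ q = ⊥-elim (<P-irrefl (subst (_<P point x) (sym e) q))
  ... | inj₂ (_ , j) = ⊥-elim (<-asym i j)

  located : ∀ {x y} → point x ≡ point y → index x ≡ index y → x ≡ y
  located {x} {y} e i with ≺-cmp x y
  ... | tri≈ _ eq _ = eq
  ... | tri< lt _ _ = ⊥-elim (go (ordered lt))
    where
    go : ¬ (point x <P point y ⊎ (point x ≡ point y × index x < index y))
    go (inj₁ q) = <P-irrefl (subst (point x <P_) (sym e) q)
    go (inj₂ (_ , j)) = <-irrefl i j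
  ... | tri> _ _ gt = ⊥-elim (go (ordered gt))
    where
    go : ¬ (point y <P point x ⊎ (point y ≡ point x × index y < index x))
    go (inj₁ q) = <P-irrefl (subst (_<P point x) (sym e) q)
    go (inj₂ (_ , j)) = <-irrefl (sym i) j

  first : ∀ {p} → Point p → ∃[ x ] point x ≡ p × index x ≡ 0
  first ok = element ok (F-pos (size-F ok))

  some-between : ∀ {x y} → point x <P point y → ∃[ c ] x ≺ c × c ≺ y
  some-between {x} {y} lt with dense (point-ok x) (point-ok y) lt (size-F (point-ok x))
  ... | r , rok , _ , x<r , r<y with first rok
  ... | c , refl , _ = c , point-≺ x<r , point-≺ r<y

  index0⇒NoPred : ∀ {x} → index x ≡ 0 → NoPred x
  index0⇒NoPred {x} i0 b b<x with ordered b<x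
  ... | inj₁ lt = some-between lt
  ... | inj₂ (_ , j) with subst (index b <_) i0 j
  ... | ()

  last⇒NoSucc : ∀ {x} → suc (index x) ≡ size (point x) → NoSucc x
  last⇒NoSucc {x} e b x<b with ordered x<b
  ... | inj₁ lt = some-between lt
  ... | inj₂ (pe , j) = ⊥-elim (<-irrefl refl (<-≤-trans (index-ok b) (subst (λ z → z ≤ index b) (trans e (cong size pe)) j)))

  index-suc⇒Adj : ∀ {x y} → point x ≡ point y → index y ≡ suc (index x) → Adj x y
  index-suc⇒Adj {x} {y} pe ie = index-≺ pe (≤-reflexive (sym ie)) , λ b (x<b , b<y) → go b (ordered x<b) (ordered b<y)
    where
    go : ∀ b → point x <P point b ⊎ (point x ≡ point b × index x < index b) →
         point b <P point y ⊎ (point b ≡ point y × index b < index y) → ⊥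
    go b (inj₁ p) (inj₁ q) = <P-irrefl (subst (point x <P_) (sym pe) (<P-trans p q))
    go b (inj₁ p) (inj₂ (e , _)) = <P-irrefl (subst (point x <P_) (trans e (sym pe)) p)
    go b (inj₂ (e , _)) (inj₁ q) = <P-irrefl (subst (point b <P_) (trans (sym pe) e) q)
    go b (inj₂ (_ , i)) (inj₂ (_ , j)) = <-irrefl refl (<-≤-trans j (≤-trans (≤-reflexive ie) i))

  NoPred⇒index0 : ∀ {x} → NoPred x → index x ≡ 0
  NoPred⇒index0 {x} np with index x in ie | index-ok x
  ... | zero  | _ = refl
  ... | suc j | j< with element (point-ok x) (<-trans (n<1+n j) j<)
  ... | y , pe , refl = ⊥-elim (NoPred⇒¬Adj np (index-suc⇒Adj pe ie))

  -- Induction on the number `d` of elements of the block after `x`. The last component, that none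
  -- of them is missed, later places every element of a point in the block of that point.
  chainFrom : ∀ d x → suc (index x + d) ≡ size (point x) →
              ∃[ t ] Chain x t × length t ≡ d × (∀ {y} → point y ≡ point x → index x ≤ index y → y ∈ x ∷ t)
  chainFrom zero x e = [] , last⇒NoSucc (trans (cong suc (sym (+-identityʳ _))) e) , refl , λ {y} pe le →
    here (located pe (≤-antisym (≤-pred (subst (index y <_) (trans (cong size pe) (trans (sym e) (cong suc (+-identityʳ _)))) (index-ok y))) le))
  chainFrom (suc d) x e with element {i = suc (index x)} (point-ok x)
      (subst (suc (index x) <_) e (s≤s (subst (index x <_) (sym (+-suc (index x) d)) (s≤s (m≤m+n (index x) d)))))
  ... | x' , pe , ie with chainFrom d x' (trans (cong (λ z → suc (z + d)) ie) (trans (cong suc (sym (+-suc (index x) d))) (trans e (cong size (sym pe)))))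
  ... | t , ch , le , all = x' ∷ t , (index-suc⇒Adj (sym pe) ie , ch) , cong suc le , go
    where
    go : ∀ {y} → point y ≡ point x → index x ≤ index y → y ∈ x ∷ x' ∷ t
    go {y} pe' le' with m≤n⇒m<n∨m≡n le'
    ... | inj₁ lt = there (all (trans pe' (sym pe)) (subst (_≤ index y) (sym ie) lt))
    ... | inj₂ eq = here (located pe' (sym eq))

  pointBlock : ∀ {p} → Point p → ∃₂ λ h t → Block (h ∷ t) × suc (length t) ≡ size p × point h ≡ p ×
                                 (∀ {y} → point y ≡ p → y ∈ h ∷ t)
  pointBlock {p} ok with first ok
  ... | h , refl , i0 with size (point h) in se | F-pos (size-F ok)
  ... | suc d | _ with chainFrom d h (trans (cong (λ z → suc (z + d)) i0) (sym se))
  ... | t , ch , le , all = h , t , (index0⇒NoPred i0 , ch) , cong suc le , refl ,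
        λ {y} pe → all pe (subst (_≤ index y) (sym i0) z≤n)

  -- Blocks are determined by the order alone, so this ties `size`, a datum of the presentation, to
  -- the order.
  block-size : ∀ {x l} → Block l → x ∈ l → length l ≡ size (point x)
  block-size {x} {l} b m with pointBlock (point-ok x)
  ... | h , t , b' , le , _ , all = trans (cong length (block-unique l (h ∷ t) b b' m (all refl))) le

  shuffled : Shuffled F A
  shuffled = record { blockOf = blockOf ; between = between ; below = below ; above = above }
    where
    blockOf : ∀ x → ∃₂ λ h t → Block (h ∷ t) × x ∈ h ∷ t × F (suc (length t))
    blockOf x with pointBlock (point-ok x)
    ... | h , t , b , le , _ , all = h , t , b , all refl , subst F (sym le) (size-F (point-ok x))
    between : ∀ {x y s} → x ≺ y → NoPred y → F s → ∃₂ λ h t → Block (h ∷ t) × suc (length t) ≡ s × x ≺ h × h ≺ y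
    between {x} {y} x<y np fs with ordered x<y
    ... | inj₂ (_ , j) with subst (index x <_) (NoPred⇒index0 np) j
    ... | ()
    between {x} {y} x<y np fs | inj₁ lt with dense (point-ok x) (point-ok y) lt fs
    ... | r , rok , se , x<r , r<y with pointBlock rok
    ... | h , t , b , le , refl , _ = h , t , b , trans le se , point-≺ x<r , point-≺ r<y
    below : ∀ x {s} → F s → ∃₂ λ h t → Block (h ∷ t) × suc (length t) ≡ s × h ≺ x
    below x fs with lower (point-ok x) fs
    ... | r , rok , se , r<x with pointBlock rok
    ... | h , t , b , le , refl , _ = h , t , b , trans le se , point-≺ r<x
    above : ∀ x {s} → F s → ∃₂ λ h t → Block (h ∷ t) × suc (length t) ≡ s × x ≺ h
    above x fs with upper (point-ok x) fs
    ... | r , rok , se , x<r with pointBlock rok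
    ... | h , t , b , le , refl , _ = h , t , b , trans le se , point-≺ x<r

transport : ∀ {F A B} → LOIso A B → Presentation F A → Presentation F B
transport {F} {A} {B} f pres = record
  { P = P ; _<P_ = _<P_ ; <P-irrefl = <P-irrefl ; <P-trans = <P-trans ; Point = Point ; size = size
  ; point = λ x → point (from x) ; index = λ x → index (from x)
  ; point-ok = λ x → point-ok (from x) ; index-ok = λ x → index-ok (from x) ; size-F = size-F
  ; element = λ ok i< → let x , pe , ie = element ok i< in
      to x , trans (cong point (strictlyInverseʳ x)) pe , trans (cong index (strictlyInverseʳ x)) ie
  ; ordered = λ {x} {y} x<y → ordered (Equivalence.from (preserves (from x) (from y))
      (subst₂ (_<ₒ_ B) (sym (strictlyInverseˡ x)) (sym (strictlyInverseˡ y)) x<y))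
  ; dense = dense ; lower = lower ; upper = upper }
  where
  open Presentation pres
  open LOIso f
  open Inverse bij using (strictlyInverseˡ; strictlyInverseʳ)

shufflePresentation : ∀ sizes L → IsShuffle sizes L → Presentation (λ s → ∃[ i ] sizes i ≡ s) L
shufflePresentation sizes L (c , lab , h , ord) = record
  { P = ℚ.ℚ ; _<P_ = ℚ._<_ ; <P-irrefl = ℚₚ.<-irrefl refl ; <P-trans = ℚₚ.<-trans ; Point = λ _ → ⊤
  ; size = λ p → sizes (c p)
  ; point = λ x → proj₁ (to x) ; index = λ x → toℕ (proj₂ (to x))
  ; point-ok = λ _ → tt ; index-ok = λ x → toℕ<n (proj₂ (to x)) ; size-F = λ {p} _ → c p , refl
  ; element = λ {p} {i} _ i< → from (p , fromℕ< i<) , cong proj₁ (strictlyInverseˡ (p , fromℕ< i<)) ,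
      trans (cong (λ z → toℕ (proj₂ z)) (strictlyInverseˡ (p , fromℕ< i<))) (toℕ-fromℕ< i<)
  ; ordered = λ {x} {y} x<y → go (Equivalence.to (ord x y) x<y)
  ; dense = λ { {p} {q} _ _ p<q (i , refl) → let r , p<r , r<q , e = lab i p q p<q in r , tt , e , p<r , r<q }
  ; lower = λ { {p} _ (i , refl) → let r , _ , r<q , e = lab i (p ℚ.- ℚ.1ℚ) p (down p) in r , tt , e , r<q }
  ; upper = λ { {p} _ (i , refl) → let r , p<r , _ , e = lab i p (p ℚ.+ ℚ.1ℚ) (up p) in r , tt , e , p<r } }
  where
  open Inverse h
  go : ∀ {x y} → _<Sh_ {sizes} {c} (to x) (to y) →
       proj₁ (to x) ℚ.< proj₁ (to y) ⊎ (proj₁ (to x) ≡ proj₁ (to y) × toℕ (proj₂ (to x)) < toℕ (proj₂ (to y)))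
  go p = p
  down : ∀ p → p ℚ.- ℚ.1ℚ ℚ.< p
  down p = subst (p ℚ.- ℚ.1ℚ ℚ.<_) (ℚₚ.+-identityʳ p) (ℚₚ.+-monoʳ-< p (toWitness {a? = ℚ.- ℚ.1ℚ ℚₚ.<? ℚ.0ℚ} tt))
  up : ∀ p → p ℚ.< p ℚ.+ ℚ.1ℚ
  up p = subst (ℚ._< p ℚ.+ ℚ.1ℚ) (ℚₚ.+-identityʳ p) (ℚₚ.+-monoʳ-< p (toWitness {a? = ℚ.0ℚ ℚₚ.<? ℚ.1ℚ} tt))

-- A Π⁰₂ test for blocks

-- Simulation principle: the fold on codes is the primitive recursive one, the fold on structured
-- states is the one reasoned about.
foldl-code : {S : Set} {code : S → ℕ} {f : ℕ → ℕ → ℕ} {g : S → ℕ → S} →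
             (∀ s e → f (code s) e ≡ code (g s e)) → ∀ s xs → foldl f (code s) xs ≡ code (foldl g s xs)
foldl-code h s [] = refl
foldl-code {f = f} {g} h s (x ∷ xs) = trans (cong (λ a → foldl f a xs) (h s x)) (foldl-code h (g s x) xs)

module BlockTest (A : PunctualLO) where
  open Order A

  headTest : ℕ → ℕ → ℕ → Bool
  headTest b c h = not (lt b h) ∨ (lt b c ∧ lt c h)

  lastTest : ℕ → ℕ → ℕ → Bool
  lastTest b c l = not (lt l b) ∨ (lt l c ∧ lt c b)

  adjTest : ℕ → ℕ → ℕ → Bool
  adjTest b x y = lt x y ∧ not (lt x b ∧ lt b y)

  chainTest : ℕ → ℕ → ℕ → List ℕ → Bool
  chainTest b c h []      = lastTest b c h
  chainTest b c h (y ∷ t) = adjTest b h y ∧ chainTest b c y t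

  walk : ℕ → ℕ → ℕ → ℕ
  walk b a y = pair (b2n (not (fst a ≡ᵇ 0) ∧ adjTest b (snd a) y)) y

  walked : ℕ → ℕ → ℕ
  walked l b = foldl (walk b) (pair 1 (hd l)) (dec (tl l))

  -- The matrix of the Π⁰₂ statement that `l` codes a block: `b` is the universal variable, and `c`
  -- pairs a witness between `b` and the first element with one between the last element and `b`.
  -- The walk along the list keeps a success flag and the previous element.
  blockTest : ℕ → ℕ → ℕ → Bool
  blockTest l b c = not (l ≡ᵇ 0) ∧ headTest b (fst c) (hd l) ∧
                    not (fst (walked l b) ≡ᵇ 0) ∧ lastTest b (snd c) (snd (walked l b))

  walked-chain : ∀ b c ok h t → let r = foldl (walk b) (pair (b2n ok) h) t in
                 not (fst r ≡ᵇ 0) ∧ lastTest b c (snd r) ≡ ok ∧ chainTest b c h t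
  walked-chain b c ok h [] rewrite fst-pair (b2n ok) h | snd-pair (b2n ok) h with ok
  ... | true = refl
  ... | false = refl
  walked-chain b c ok h (y ∷ t) rewrite fst-pair (b2n ok) h | snd-pair (b2n ok) h with ok
  ... | true  = walked-chain b c (adjTest b h y) y t
  ... | false = walked-chain b c false y t

  blockTest-spec : ∀ {l h t} → dec l ≡ h ∷ t → ∀ b c →
                   blockTest l b c ≡ headTest b (fst c) h ∧ chainTest b (snd c) h t
  blockTest-spec {zero}  ()
  blockTest-spec {suc l} e b c with dec-hd-tl {suc l} e
  ... | refl , refl = cong (headTest b (fst c) _ ∧_) (walked-chain b (snd c) true (hd (suc l)) (dec (tl (suc l))))

  abstract
    blockTestPR : {l b c : Vec ℕ n → ℕ} → PR K l → PR K b → PR K c → PRB K (λ xs → blockTest (l xs) (b xs) (c xs))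
    blockTestPR pl pb pc =
      compV {f = λ ys → b2n (blockTest (lookup ys zero) (lookup ys (suc zero)) (lookup ys (suc (suc zero))))}
        (andPR (notPR (zeroB v0)) (andPR (headP v1 (app₁ fstPR v2) (app₁ hdPR v0))
          (andPR (notPR (zeroB (app₁ fstPR walkedP))) (lastP v1 (app₁ sndPR v2) (app₁ sndPR walkedP)))))
        (consV pl (consV pb (consV pc nilV)))
      where
      headP : {b c h : Vec ℕ m → ℕ} → PR K b → PR K c → PR K h → PRB K (λ xs → headTest (b xs) (c xs) (h xs))
      headP pb pc ph = orPR (notPR (≺PR pb ph)) (andPR (≺PR pb pc) (≺PR pc ph))
      lastP : {b c h : Vec ℕ m → ℕ} → PR K b → PR K c → PR K h → PRB K (λ xs → lastTest (b xs) (c xs) (h xs))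
      lastP pb pc ph = orPR (notPR (≺PR ph pb)) (andPR (≺PR ph pc) (≺PR pc pb))
      adjP : {b x y : Vec ℕ m → ℕ} → PR K b → PR K x → PR K y → PRB K (λ xs → adjTest (b xs) (x xs) (y xs))
      adjP pb px py = andPR (≺PR px py) (notPR (andPR (≺PR px pb) (≺PR pb py)))
      walkedP : PR K {3} (λ xs → walked (lookup xs zero) (lookup xs (suc zero)))
      walkedP = foldPR (app₂ pairPR (andPR (notPR (zeroB (app₁ fstPR v0))) (adjP v3 (app₁ sndPR v0) v1)) v1)
                       (app₂ pairPR (const 1) (app₁ hdPR v0)) (app₁ tlPR v0)

  chainTest-sound : ∀ h t → (∀ b → ∃[ c ] (✓ chainTest b c h t)) → Chain h t
  chainTest-sound h [] H b h<b with H b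
  ... | c , q with ✓∨ {not (lt h b)} q
  ... | inj₁ nq = ⊥-elim (✓not nq (lt✓ h<b))
  ... | inj₂ q' = c , ✓lt (proj₁ (✓∧ q')) , ✓lt (proj₂ (✓∧ {lt h c} q'))
  chainTest-sound h (y ∷ t) H = (✓lt (proj₁ (✓∧ (adj 0))) , λ b (p , q) → ✓not (proj₂ (✓∧ {lt h y} (adj b))) (∧✓ (lt✓ p) (lt✓ q))) ,
    chainTest-sound y t λ b → proj₁ (H b) , proj₂ (✓∧ {adjTest b h y} (proj₂ (H b)))
    where
    adj : ∀ b → ✓ adjTest b h y
    adj b = proj₁ (✓∧ (proj₂ (H b)))

  chainTest-complete : ∀ h t → Chain h t → ∀ b → ∃[ c ] (✓ chainTest b c h t)
  chainTest-complete h [] ns b with ✓? (lt h b)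
  ... | inj₂ f = 0 , ∨✓₁ (not✓ (false✗ f))
  ... | inj₁ q with ns b (✓lt q)
  ... | c , p , p' = c , ∨✓₂ {not (lt h b)} (∧✓ (lt✓ p) (lt✓ p'))
  chainTest-complete h (y ∷ t) ((h<y , nb) , ch) b with chainTest-complete y t ch b
  ... | c , q = c , ∧✓ (∧✓ (lt✓ h<y) (not✓ λ r → nb b (✓lt (proj₁ (✓∧ r)) , ✓lt (proj₂ (✓∧ {lt h b} r))))) q

  blockTest-sound : ∀ {l} → (∀ b → ∃[ c ] (✓ blockTest l b c)) → Block (dec l)
  blockTest-sound {l} H = go (dec l) refl
    where
    go : ∀ xs → dec l ≡ xs → Block xs
    go [] e with trans (sym (enc-dec l)) (cong enc e) | proj₂ (H 0)
    ... | refl | ()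
    go (h ∷ t) e = np , chainTest-sound h t λ b → snd (proj₁ (H b)) , proj₂ (tests b)
      where
      tests : ∀ b → ✓ headTest b (fst (proj₁ (H b))) h × ✓ chainTest b (snd (proj₁ (H b))) h t
      tests b = ✓∧ (subst ✓_ (blockTest-spec {l} e b (proj₁ (H b))) (proj₂ (H b)))
      np : NoPred h
      np b b<h with ✓∨ {not (lt b h)} (proj₁ (tests b))
      ... | inj₁ nq = ⊥-elim (✓not nq (lt✓ b<h))
      ... | inj₂ q = fst (proj₁ (H b)) , ✓lt (proj₁ (✓∧ q)) , ✓lt (proj₂ (✓∧ {lt b _} q))

  blockTest-complete : ∀ {l} → Block (dec l) → ∀ b → ∃[ c ] (✓ blockTest l b c)
  blockTest-complete {l} bl b with dec l in e
  blockTest-complete {l} (np , ch) b | h ∷ t = pair c₁ c₂ , subst ✓_ (sym (blockTest-spec {l} e b (pair c₁ c₂)))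
      (∧✓ (subst (λ c → ✓ headTest b c h) (sym (fst-pair c₁ c₂)) (proj₂ hT)) (subst (λ c → ✓ chainTest b c h t) (sym (snd-pair c₁ c₂)) (proj₂ cT)))
    where
    hT : ∃[ c ] (✓ headTest b c h)
    hT with ✓? (lt b h)
    ... | inj₂ f = 0 , ∨✓₁ (not✓ (false✗ f))
    ... | inj₁ q = let c , p , p' = np b (✓lt q) in c , ∨✓₂ {not (lt b h)} (∧✓ (lt✓ p) (lt✓ p'))
    cT : ∃[ c ] (✓ chainTest b c h t)
    cT = chainTest-complete h t ch b
    c₁ c₂ : ℕ
    c₁ = proj₁ hT
    c₂ = proj₁ cT

-- Δ⁰₃ choice of blocks and of partners for blocks

BlockFinder : PunctualLO → (ℕ → ℕ) → Set
BlockFinder A T = ∀ x → Block (dec (T x)) × x ∈ dec (T x)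
  where open Order A

-- Bounds are coded with 0 for "no bound" and suc v for the element v.
GapFiller : PunctualLO → PunctualLO → (ℕ → ℕ) → Set
GapFiller A B ψ = ∀ x y₁ y₂ → (∀ {v} → y₂ ≡ suc v → OB.NoPred v) → (∀ {v w} → y₁ ≡ suc v → y₂ ≡ suc w → v OB.≺ w) →
  let l = fst (ψ (pair x (pair y₁ y₂))) ; l' = snd (ψ (pair x (pair y₁ y₂))) in
  OA.Block (dec l) × x ∈ dec l × OB.Block (dec l') × length (dec l) ≡ length (dec l') ×
  (∀ {v} → y₁ ≡ suc v → v OB.≺ hd l') × (∀ {v} → y₂ ≡ suc v → hd l' OB.≺ v)
  where
  module OA = Order A
  module OB = Order B

module Choices (em : ExcludedMiddle 0ℓ) {F : ℕ → Set} where
  open Classical em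

  module _ (A : PunctualLO) (sA : Shuffled F A) where
    open Order A
    open BlockTest A
    open Shuffled sA

    private
      R : ℕ → ℕ → ℕ → ℕ → Bool
      R x l b c = blockTest l b c ∧ memb x l

      pR : PRB₄ plain R
      pR = andPR (blockTestPR v1 v2 v3) (membPR v0 v1)

      total : ∀ x → ∃[ l ] ∀ b → ∃[ c ] (✓ R x l b c)
      total x with blockOf x
      ... | h , t , bl , m , _ = enc (h ∷ t) , λ b →
        let c , q = blockTest-complete {enc (h ∷ t)} (subst Block (sym (dec-enc (h ∷ t))) bl) b in
        c , ∧✓ q (memb✓ {l = enc (h ∷ t)} (subst (x ∈_) (sym (dec-enc (h ∷ t))) m))

      open Uniformize R pR total

    blockCode : Σ (ℕ → ℕ) λ T → Δ⁰₃Fun T × BlockFinder A T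
    blockCode = choice , choice-Δ⁰₃ , λ x →
      blockTest-sound (λ b → proj₁ (choice-ok x b) , proj₁ (✓∧ (proj₂ (choice-ok x b)))) ,
      ✓memb {l = choice x} (proj₂ (✓∧ {blockTest (choice x) 0 (proj₁ (choice-ok x 0))} (proj₂ (choice-ok x 0))))

  module _ (A B : PunctualLO) (sA : Shuffled F A) (sB : Shuffled F B) where
    private
      module OA = Order A
      module OB = Order B
      module TA = BlockTest A
      module TB = BlockTest B
      module SA = Shuffled sA
      module SB = Shuffled sB

      fits : ℕ → ℕ → ℕ → ℕ → Bool
      fits y₁ y₂ l l' = (len l ≡ᵇ len l') ∧ ((y₁ ≡ᵇ 0) ∨ OB.lt (pred y₁) (hd l')) ∧ ((y₂ ≡ᵇ 0) ∨ OB.lt (hd l') (pred y₂))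

      -- l' shows that y₂ is not the first element of its block
      inner : ℕ → ℕ → Bool
      inner y₂ l' = not (y₂ ≡ᵇ 0) ∧ memb (pred y₂) l' ∧ not (hd l' ≡ᵇ pred y₂)

      unordered : ℕ → ℕ → Bool
      unordered y₁ y₂ = not (y₁ ≡ᵇ 0) ∧ not (y₂ ≡ᵇ 0) ∧ not (OB.lt (pred y₁) (pred y₂))

      -- The last two disjuncts make the relation solvable for senseless bounds. That `y₂` is not
      -- the first element of its block is no Π⁰₂ condition by itself; it becomes one when the
      -- answer has to exhibit the block of `y₂`. With sensible bounds both disjuncts are impossible
      -- and `fits` must hold.
      R : ℕ → ℕ → ℕ → ℕ → Bool
      R z w b c = TA.blockTest (fst w) b (fst c) ∧ memb (fst z) (fst w) ∧ TB.blockTest (snd w) b (snd c) ∧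
                  (fits (fst (snd z)) (snd (snd z)) (fst w) (snd w) ∨ inner (snd (snd z)) (snd w) ∨ unordered (fst (snd z)) (snd (snd z)))

      pR : PRB₄ plain R
      pR = andPR (TA.blockTestPR w₁ v2 (app₁ fstPR v3)) (andPR (membPR (app₁ fstPR v0) w₁)
             (andPR (TB.blockTestPR w₂ v2 (app₁ sndPR v3))
               (orPR (andPR (eqPR (app₁ lenPR w₁) (app₁ lenPR w₂))
                       (andPR (orPR (zeroB y₁) (OB.≺PR (app₁ predPR y₁) (app₁ hdPR w₂)))
                              (orPR (zeroB y₂) (OB.≺PR (app₁ hdPR w₂) (app₁ predPR y₂)))))
                 (orPR (andPR (notPR (zeroB y₂)) (andPR (membPR (app₁ predPR y₂) w₂) (notPR (eqPR (app₁ hdPR w₂) (app₁ predPR y₂)))))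
                       (andPR (notPR (zeroB y₁)) (andPR (notPR (zeroB y₂)) (notPR (OB.≺PR (app₁ predPR y₁) (app₁ predPR y₂)))))))))
        where
        w₁ = app₁ fstPR (v1 {plain} {2})
        w₂ = app₁ sndPR (v1 {plain} {2})
        y₁ = app₁ fstPR (app₁ sndPR (v0 {plain} {3}))
        y₂ = app₁ sndPR (app₁ sndPR (v0 {plain} {3}))

      hd-enc : ∀ h t → hd (enc (h ∷ t)) ≡ h
      hd-enc h t = fst-pair h (enc t)

      search : ∀ {s} y₁ y₂ → F s → ∃₂ λ h t → OB.Block (h ∷ t) ×
               ((suc (length t) ≡ s × ✓ ((y₁ ≡ᵇ 0) ∨ OB.lt (pred y₁) h) × ✓ ((y₂ ≡ᵇ 0) ∨ OB.lt h (pred y₂)))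
                ⊎ (✓ not (y₂ ≡ᵇ 0) × pred y₂ ∈ h ∷ t × h ≢ pred y₂) ⊎ ✓ unordered y₁ y₂)
      -- Without bounds any block of the right size will do; element 0 is an arbitrary point to
      -- start from.
      search zero zero fs with SB.above 0 fs
      ... | h , t , b , le , _ = h , t , b , inj₁ (le , refl , refl)
      search (suc y₁) zero fs with SB.above y₁ fs
      ... | h , t , b , le , p = h , t , b , inj₁ (le , OB.lt✓ p , refl)
      search zero (suc y₂) fs with SB.below y₂ fs
      ... | h , t , b , le , p = h , t , b , inj₁ (le , refl , OB.lt✓ p)
      search (suc y₁) (suc y₂) fs with SB.blockOf y₂ | ✓? (OB.lt y₁ y₂)
      ... | h , t , b , m , _ | inj₂ f = h , t , b , inj₂ (inj₂ (not✓ (false✗ f)))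
      ... | h , t , b , m , _ | inj₁ q with h ≟ y₂
      ... | no ne = h , t , b , inj₂ (inj₁ (refl , m , ne))
      ... | yes refl with SB.between (OB.✓lt q) (proj₁ b) fs
      ... | h' , t' , b' , le , p , p' = h' , t' , b' , inj₁ (le , OB.lt✓ p , OB.lt✓ p')

      total : ∀ z → ∃[ w ] ∀ b → ∃[ c ] (✓ R z w b c)
      total z with SA.blockOf (fst z)
      ... | h , t , bA , m , fs with search (fst (snd z)) (snd (snd z)) fs
      ... | h' , t' , bB , alt = pair l l' , λ b →
              let cA , qA = TA.blockTest-complete {l} (subst OA.Block (sym (dec-enc (h ∷ t))) bA) b
                  cB , qB = TB.blockTest-complete {l'} (subst OB.Block (sym (dec-enc (h' ∷ t'))) bB) b in
              pair cA cB , subst₂ (λ u v → ✓ TA.blockTest u b (fst (pair cA cB)) ∧ memb (fst z) u ∧ TB.blockTest v b (snd (pair cA cB)) ∧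
                  (fits (fst (snd z)) (snd (snd z)) u v ∨ inner (snd (snd z)) v ∨ unordered (fst (snd z)) (snd (snd z))))
                (sym (fst-pair l l')) (sym (snd-pair l l'))
                (∧✓ (subst (λ c → ✓ TA.blockTest l b c) (sym (fst-pair cA cB)) qA)
                  (∧✓ (memb✓ {l = l} (subst (fst z ∈_) (sym (dec-enc (h ∷ t))) m))
                    (∧✓ (subst (λ c → ✓ TB.blockTest l' b c) (sym (snd-pair cA cB)) qB) (good alt))))
        where
        l l' : ℕ
        l = enc (h ∷ t)
        l' = enc (h' ∷ t')
        good : _ → ✓ fits (fst (snd z)) (snd (snd z)) l l' ∨ inner (snd (snd z)) l' ∨ unordered (fst (snd z)) (snd (snd z))
        good (inj₁ (le , q₁ , q₂)) = ∨✓₁ (∧✓ (≡✓ (trans (len-spec l) (trans (cong length (dec-enc (h ∷ t)))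
            (trans (sym le) (sym (trans (len-spec l') (cong length (dec-enc (h' ∷ t')))))))))
          (∧✓ (subst (λ v → ✓ (fst (snd z) ≡ᵇ 0) ∨ OB.lt (pred (fst (snd z))) v) (sym (hd-enc h' t')) q₁)
              (subst (λ v → ✓ (snd (snd z) ≡ᵇ 0) ∨ OB.lt v (pred (snd (snd z)))) (sym (hd-enc h' t')) q₂)))
        good (inj₂ (inj₁ (q , m , ne))) = ∨✓₂ {fits (fst (snd z)) (snd (snd z)) l l'} (∨✓₁ (∧✓ q (∧✓
          (memb✓ {l = l'} (subst (pred (snd (snd z)) ∈_) (sym (dec-enc (h' ∷ t'))) m))
          (not✓ λ e → ne (trans (sym (hd-enc h' t')) (✓≡ e))))))
        good (inj₂ (inj₂ q)) = ∨✓₂ {fits (fst (snd z)) (snd (snd z)) l l'} (∨✓₂ {inner (snd (snd z)) l'} q)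

      Filled : ℕ → ℕ → ℕ → ℕ → Set
      Filled x y₁ y₂ w = OA.Block (dec (fst w)) × x ∈ dec (fst w) × OB.Block (dec (snd w)) × length (dec (fst w)) ≡ length (dec (snd w)) ×
        (∀ {v} → y₁ ≡ suc v → v OB.≺ hd (snd w)) × (∀ {v} → y₂ ≡ suc v → hd (snd w) OB.≺ v)

      no-inner : ∀ y l → OB.Block (dec l) → (∀ {v} → y ≡ suc v → OB.NoPred v) → ¬ ✓ inner y l
      no-inner (suc v) l b np q = go (dec l) refl b (✓memb {l = l} (proj₁ (✓∧ q))) (✓not (proj₂ (✓∧ {memb v l} q)))
        where
        go : ∀ xs → dec l ≡ xs → OB.Block xs → v ∈ xs → ¬ (✓ (hd l ≡ᵇ v)) → ⊥
        go (h ∷ t) e b m ne = ne (≡✓ (trans (proj₁ (dec-hd-tl {l} e)) (sym (OB.NoPred⇒head t b (np refl) m))))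

      no-unordered : ∀ y y' → (∀ {v v'} → y ≡ suc v → y' ≡ suc v' → v OB.≺ v') → ¬ ✓ unordered y y'
      no-unordered (suc v) (suc v') ord q = ✓not q (OB.lt✓ (ord refl refl))

      filled : ∀ z w → (∀ {v} → snd (snd z) ≡ suc v → OB.NoPred v) →
               (∀ {v v'} → fst (snd z) ≡ suc v → snd (snd z) ≡ suc v' → v OB.≺ v') →
               (∀ b → ∃[ c ] (✓ R z w b c)) → Filled (fst z) (fst (snd z)) (snd (snd z)) w
      filled z w np ord C =
        TA.blockTest-sound (λ b → fst (proj₁ (C b)) , proj₁ (✓∧ (proj₂ (C b)))) ,
        ✓memb {l = fst w} (proj₁ (✓∧ (rest 0))) , bB ,
        trans (sym (len-spec (fst w))) (trans (✓≡ (proj₁ (✓∧ fit))) (len-spec (snd w))) , lo , hi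
        where
        y₁ y₂ : ℕ
        y₁ = fst (snd z)
        y₂ = snd (snd z)
        G : Bool
        G = fits y₁ y₂ (fst w) (snd w) ∨ inner y₂ (snd w) ∨ unordered y₁ y₂
        rest : ∀ b → ✓ memb (fst z) (fst w) ∧ TB.blockTest (snd w) b (snd (proj₁ (C b))) ∧ G
        rest b = proj₂ (✓∧ {TA.blockTest (fst w) b (fst (proj₁ (C b)))} (proj₂ (C b)))
        rest' : ∀ b → ✓ TB.blockTest (snd w) b (snd (proj₁ (C b))) × ✓ G
        rest' b = ✓∧ (proj₂ (✓∧ {memb (fst z) (fst w)} (rest b)))
        bB : OB.Block (dec (snd w))
        bB = TB.blockTest-sound (λ b → snd (proj₁ (C b)) , proj₁ (rest' b))
        fit : ✓ fits y₁ y₂ (fst w) (snd w)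
        fit with ✓∨ {fits y₁ y₂ (fst w) (snd w)} (proj₂ (rest' 0))
        ... | inj₁ q = q
        ... | inj₂ r with ✓∨ {inner y₂ (snd w)} r
        ... | inj₁ q = ⊥-elim (no-inner y₂ (snd w) bB np q)
        ... | inj₂ q = ⊥-elim (no-unordered y₁ y₂ ord q)
        bounds : ✓ ((y₁ ≡ᵇ 0) ∨ OB.lt (pred y₁) (hd (snd w))) × ✓ ((y₂ ≡ᵇ 0) ∨ OB.lt (hd (snd w)) (pred y₂))
        bounds = ✓∧ (proj₂ (✓∧ {len (fst w) ≡ᵇ len (snd w)} fit))
        lo : ∀ {v} → y₁ ≡ suc v → v OB.≺ hd (snd w)
        lo {v} e = OB.✓lt (subst (λ y → ✓ (y ≡ᵇ 0) ∨ OB.lt (pred y) (hd (snd w))) e (proj₁ bounds))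
        hi : ∀ {v} → y₂ ≡ suc v → hd (snd w) OB.≺ v
        hi {v} e = OB.✓lt (subst (λ y → ✓ (y ≡ᵇ 0) ∨ OB.lt (hd (snd w)) (pred y)) e (proj₂ bounds))

      filled' : ∀ {x y₁ y₂} z w → fst z ≡ x → fst (snd z) ≡ y₁ → snd (snd z) ≡ y₂ → (∀ {v} → y₂ ≡ suc v → OB.NoPred v) →
               (∀ {v v'} → y₁ ≡ suc v → y₂ ≡ suc v' → v OB.≺ v') → (∀ b → ∃[ c ] (✓ R z w b c)) → Filled x y₁ y₂ w
      filled' z w refl refl refl = filled z w

      open Uniformize R pR total

    gapFiller : Σ (ℕ → ℕ) λ ψ → Δ⁰₃Fun ψ × GapFiller A B ψ
    gapFiller = choice , choice-Δ⁰₃ , λ x y₁ y₂ np ord →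
      filled' (pair x (pair y₁ y₂)) (choice (pair x (pair y₁ y₂))) (fst-pair x _)
        (trans (cong fst (snd-pair x _)) (fst-pair y₁ y₂)) (trans (cong snd (snd-pair x _)) (snd-pair y₁ y₂)) np ord
        (choice-ok (pair x (pair y₁ y₂)))

-- Position-preserving maps between blocks of equal length

-- The entry of the second list opposite to `x` in the first, with default `r`. A later occurrence
-- of `x` overrides an earlier one; blocks are strictly increasing and contain `x` at most once.
corr : ℕ → ℕ → List ℕ → List ℕ → ℕ
corr r x []      u       = r
corr r x (h ∷ t) []      = r
corr r x (h ∷ t) (q ∷ u) = corr (if h ≡ᵇ x then q else r) x t u

matching : ℕ → ℕ → ℕ → ℕ
matching x l l' = snd (foldl (λ a e → pair (tl (fst a)) (if e ≡ᵇ x then hd (fst a) else snd a)) (pair l' 0) (dec l))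

abstract
  matchingPR : PR₃ K matching
  matchingPR = fun (app₁ sndPR (foldPR (app₂ pairPR (app₁ tlPR (app₁ fstPR v0))
                                (ifPR (eqPR v1 v2) (app₁ hdPR (app₁ fstPR v0)) (app₁ sndPR v0)))
                              (app₂ pairPR v2 (const 0)) v1))

matching-corr : ∀ x l l' → length (dec l) ≡ length (dec l') → matching x l l' ≡ corr 0 x (dec l) (dec l')
matching-corr x l l' e = go (dec l) l' (dec l') refl 0 e
  where
  f : ℕ → ℕ → ℕ
  f a e = pair (tl (fst a)) (if e ≡ᵇ x then hd (fst a) else snd a)
  go : ∀ xs rest ys → dec rest ≡ ys → ∀ r → length xs ≡ length ys → snd (foldl f (pair rest r) xs) ≡ corr r x xs ys
  go []       rest ys d r le = snd-pair rest r
  go (h ∷ xs) rest (q ∷ ys) d r le with dec-hd-tl {rest} d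
  ... | refl , d' = trans (cong (λ a → snd (foldl f a xs)) (cong₂ (λ a b → pair (tl a) (if h ≡ᵇ x then hd a else b)) (fst-pair rest r) (snd-pair rest r)))
                         (go xs (tl rest) ys d' _ (suc-injective le))

corr-cases : ∀ r x l l' → corr r x l l' ≡ r ⊎ corr r x l l' ∈ l'
corr-cases r x []      l'      = inj₁ refl
corr-cases r x (h ∷ t) []      = inj₁ refl
corr-cases r x (h ∷ t) (q ∷ u) with h ≡ᵇ x | corr-cases (if h ≡ᵇ x then q else r) x t u
... | true  | inj₁ e = inj₂ (here e)
... | false | inj₁ e = inj₁ e
... | true  | inj₂ m = inj₂ (there m)
... | false | inj₂ m = inj₂ (there m)

≡ᵇ-refl : ∀ x → (x ≡ᵇ x) ≡ true
≡ᵇ-refl x = ≡✓ {x} refl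

≢⇒false : ∀ {x y} → x ≢ y → (x ≡ᵇ y) ≡ false
≢⇒false ne = ✗false λ q → ne (✓≡ q)

corr-∈ : ∀ r x l l' → x ∈ l → length l ≡ length l' → corr r x l l' ∈ l'
corr-∈ r x (h ∷ t) (q ∷ u) (here refl) le rewrite ≡ᵇ-refl x with corr-cases q x t u
... | inj₁ e = here e
... | inj₂ m = there m
corr-∈ r x (h ∷ t) (q ∷ u) (there m) le = there (corr-∈ _ x t u m (suc-injective le))

corr-skip : ∀ r x l l' → (∀ {e} → e ∈ l → e ≢ x) → corr r x l l' ≡ r
corr-skip r x []      l'      ne = refl
corr-skip r x (h ∷ t) []      ne = refl
corr-skip r x (h ∷ t) (q ∷ u) ne rewrite ≢⇒false (ne (here refl)) = corr-skip r x t u (ne ∘ there)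

module Increasing (A : PunctualLO) where
  open Order A

  Inc : List ℕ → Set
  Inc []      = ⊤
  Inc (h ∷ t) = (∀ {x} → x ∈ t → h ≺ x) × Inc t

  chain-Inc : ∀ {h} t → Chain h t → Inc (h ∷ t)
  chain-Inc []      ch = (λ ()) , tt
  chain-Inc (y ∷ t) ch = chain-tail (y ∷ t) ch , chain-Inc t (proj₂ ch)

module _ (A B : PunctualLO) where
  private
    module A = Order A
    module B = Order B
  open Increasing

  corr-head : ∀ r x t q u → Inc A (x ∷ t) → corr r x (x ∷ t) (q ∷ u) ≡ q
  corr-head r x t q u (h< , _) rewrite ≡ᵇ-refl x = corr-skip q x t u λ m e → A.≺-irrefl (subst (x A.≺_) e (h< m))

  corr-inverse : ∀ r r' x l l' → Inc A l → Inc B l' → length l ≡ length l' → x ∈ l → corr r' (corr r x l l') l' l ≡ x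
  corr-inverse r r' x (h ∷ t) (q ∷ u) iA iB le (here refl)
    rewrite corr-head r x t q u iA | ≡ᵇ-refl q = corr-skip x q u t λ m e → B.≺-irrefl (subst (q B.≺_) e (proj₁ iB m))
  corr-inverse r r' x (h ∷ t) (q ∷ u) iA iB le (there m)
    rewrite ≢⇒false {h} {x} (λ e → A.≺-irrefl (subst (h A.≺_) (sym e) (proj₁ iA m)))
          | ≢⇒false {q} {corr r x t u} (λ e → B.≺-irrefl (subst (q B.≺_) (sym e) (proj₁ iB (corr-∈ r x t u m (suc-injective le)))))
    = corr-inverse r r' x t u (proj₂ iA) (proj₂ iB) (suc-injective le) m

  corr-mono : ∀ r x x' l l' → Inc A l → Inc B l' → length l ≡ length l' → x ∈ l → x' ∈ l → x A.≺ x' →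
              corr r x l l' B.≺ corr r x' l l'
  corr-mono r x x' (h ∷ t) (q ∷ u) iA iB le (here refl) (here refl) lt = ⊥-elim (A.≺-irrefl lt)
  corr-mono r x x' (h ∷ t) (q ∷ u) iA iB le (here refl) (there m') lt
    rewrite corr-head r x t q u iA = proj₁ iB (corr-∈ _ x' t u m' (suc-injective le))
  corr-mono r x x' (h ∷ t) (q ∷ u) iA iB le (there m) (here refl) lt = ⊥-elim (A.≺-asym lt (proj₁ iA m))
  corr-mono r x x' (h ∷ t) (q ∷ u) iA iB le (there m) (there m') lt
    rewrite ≢⇒false {h} {x} (λ e → A.≺-irrefl (subst (h A.≺_) (sym e) (proj₁ iA m)))
          | ≢⇒false {h} {x'} (λ e → A.≺-irrefl (subst (h A.≺_) (sym e) (proj₁ iA m')))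
    = corr-mono r x x' t u (proj₂ iA) (proj₂ iB) (suc-injective le) m m' lt

-- the result is coded like the bounds in GapFiller
best : (ℕ → Bool) → (ℕ → ℕ → Bool) → (ℕ → ℕ) → ℕ → List ℕ → ℕ
best sel worse val = foldl (λ a p → if sel p ∧ ((a ≡ᵇ 0) ∨ worse (pred a) (val p)) then suc (val p) else a)

module Best (sel : ℕ → Bool) (worse : ℕ → ℕ → Bool) (val : ℕ → ℕ)
  (worse-trans : ∀ {u v w} → ✓ worse u v → ✓ worse v w → ✓ worse u w)
  (worse-total : ∀ {v w} → ¬ ✓ worse v w → w ≡ v ⊎ ✓ worse w v) where

  private
    step : ℕ → ℕ → ℕ
    step a p = if sel p ∧ ((a ≡ᵇ 0) ∨ worse (pred a) (val p)) then suc (val p) else a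

  Dominated : ℕ → ℕ → Set
  Dominated w r = ∃[ v ] r ≡ suc v × (w ≡ v ⊎ ✓ worse w v)

  private
    dom-trans : ∀ {w v r} → w ≡ v ⊎ ✓ worse w v → Dominated v r → Dominated w r
    dom-trans (inj₁ refl) d = d
    dom-trans (inj₂ p) (v' , e , inj₁ refl) = v' , e , inj₂ p
    dom-trans (inj₂ p) (v' , e , inj₂ q) = v' , e , inj₂ (worse-trans p q)

    step-keeps : ∀ v p → Dominated v (step (suc v) p)
    step-keeps v p with sel p | worse v (val p) in e
    ... | true  | true  = val p , refl , inj₂ e
    ... | true  | false = v , refl , inj₁ refl
    ... | false | _     = v , refl , inj₁ refl

    step-takes : ∀ a p → ✓ sel p → Dominated (val p) (step a p)
    step-takes zero p s rewrite s = val p , refl , inj₁ refl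
    step-takes (suc v) p s rewrite s with worse v (val p) in e
    ... | true  = val p , refl , inj₁ refl
    ... | false with worse-total (false✗ e)
    ... | inj₁ q = v , refl , inj₁ q
    ... | inj₂ q = v , refl , inj₂ q

    from : ∀ {w} a xs → Dominated w a → Dominated w (best sel worse val a xs)
    from a []       d = d
    from a (p ∷ xs) (v , refl , d) = from (step (suc v) p) xs (dom-trans d (step-keeps v p))

  best-dominates : ∀ a {p} xs → p ∈ xs → ✓ sel p → Dominated (val p) (best sel worse val a xs)
  best-dominates a (p ∷ xs) (here refl) s = from (step a p) xs (step-takes a p s)
  best-dominates a (p ∷ xs) (there m) s = best-dominates (step a p) xs m s

  best-found : ∀ a xs → best sel worse val a xs ≡ a ⊎ ∃[ p ] p ∈ xs × ✓ sel p × best sel worse val a xs ≡ suc (val p)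
  best-found a [] = inj₁ refl
  best-found a (p ∷ xs) with best-found (step a p) xs
  ... | inj₂ (p' , m , s , e) = inj₂ (p' , there m , s , e)
  ... | inj₁ e with sel p in s | (a ≡ᵇ 0) ∨ worse (pred a) (val p)
  ... | true  | true  = inj₂ (p , here refl , s , e)
  ... | true  | false = inj₁ e
  ... | false | _     = inj₁ e

-- Back-and-forth on blocks

module Pairs (A B : PunctualLO) (π₁ π₂ : ℕ → ℕ) where
  private
    module A = Order A
    module B = Order B

  Paired : ℕ → ℕ → Set
  Paired h q = ∃₂ λ t u → A.Block (h ∷ t) × B.Block (q ∷ u) × length t ≡ length u

  -- A finite partial isomorphism at the level of blocks, each represented by its first element;
  -- `Paired` keeps the lengths equal, so it extends to the elements.
  record Matched (H : List ℕ) : Set where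
    field
      paired : ∀ {p} → p ∈ H → Paired (π₁ p) (π₂ p)
      forw   : ∀ {p p'} → p ∈ H → p' ∈ H → π₁ p A.≺ π₁ p' → π₂ p B.≺ π₂ p'
      back   : ∀ {p p'} → p ∈ H → p' ∈ H → π₂ p B.≺ π₂ p' → π₁ p A.≺ π₁ p'

    functional : ∀ {p p'} → p ∈ H → p' ∈ H → π₁ p ≡ π₁ p' → π₂ p ≡ π₂ p'
    functional {p} {p'} m m' e with B.≺-cmp (π₂ p) (π₂ p')
    ... | tri≈ _ e' _ = e'
    ... | tri< lt _ _ = ⊥-elim (A.≺-irrefl (subst (π₁ p A.≺_) (sym e) (back m m' lt)))
    ... | tri> _ _ gt = ⊥-elim (A.≺-irrefl (subst (A._≺ π₁ p) (sym e) (back m' m gt)))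

swap : ∀ {A B π₁ π₂ H} → Pairs.Matched A B π₁ π₂ H → Pairs.Matched B A π₂ π₁ H
swap M = record { paired = λ m → let t , u , a , b , e = paired m in u , t , b , a , sym e ; forw = back ; back = forw }
  where open Pairs.Matched M

-- Projections and pairing are parameters so that the back step is this same module with the two
-- orders exchanged.
module Half (A B : PunctualLO) (π₁ π₂ : ℕ → ℕ) (mk : ℕ → ℕ → ℕ)
  (mk₁ : ∀ h q → π₁ (mk h q) ≡ h) (mk₂ : ∀ h q → π₂ (mk h q) ≡ q)
  (T T' : ℕ → ℕ) (T-ok : BlockFinder A T) (T'-ok : BlockFinder B T') (ψ : ℕ → ℕ) (ψ-ok : GapFiller A B ψ) where
  private
    module A = Order A
    module B = Order B
  open Pairs A B π₁ π₂

  T-head : ∀ x → ∃[ t ] dec (T x) ≡ hd (T x) ∷ t × A.Block (hd (T x) ∷ t) × x ∈ hd (T x) ∷ t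
  T-head x with dec (T x) in e | T-ok x
  ... | h ∷ t | b , m with dec-hd-tl {T x} e
  ... | refl , _ = t , refl , b , m

  -- Of the blocks matched so far only the nearest images matter: the largest image of a head to the
  -- left of `h` and the smallest image of one to the right. Since the images are heads of blocks,
  -- the hypotheses of `GapFiller` on its bounds are met.
  lo hi : ℕ → ℕ → ℕ
  lo h H = best (λ p → A.lt (π₁ p) h) B.lt π₂ 0 (dec H)
  hi h H = best (λ p → A.lt h (π₁ p)) (λ v w → B.lt w v) π₂ 0 (dec H)

  image : ℕ → ℕ → ℕ → ℕ
  image x h H = hd (snd (ψ (pair x (pair (lo h H) (hi h H)))))

  abstract
    forth : ℕ → ℕ → ℕ
    forth H x = if anyL (λ p → π₁ p ≡ᵇ hd (T x)) (dec H) then H else cons (mk (hd (T x)) (image x (hd (T x)) H)) H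

    forth-def : ∀ H x → forth H x ≡ (if anyL (λ p → π₁ p ≡ᵇ hd (T x)) (dec H) then H else cons (mk (hd (T x)) (image x (hd (T x)) H)) H)
    forth-def H x = refl

  private
    ≺-total : ∀ {v w} → ¬ v B.≺ w → w ≡ v ⊎ w B.≺ v
    ≺-total {v} {w} n with B.≺-cmp v w
    ... | tri< lt _ _ = ⊥-elim (n lt)
    ... | tri≈ _ e _  = inj₁ (sym e)
    ... | tri> _ _ gt = inj₂ gt

    module Lo h = Best (λ p → A.lt (π₁ p) h) B.lt π₂ (λ p q → B.lt✓ (B.≺-trans (B.✓lt p) (B.✓lt q)))
      (λ n → map₂ B.lt✓ (≺-total (n ∘ B.lt✓)))
    module Hi h = Best (λ p → A.lt h (π₁ p)) (λ v w → B.lt w v) π₂ (λ p q → B.lt✓ (B.≺-trans (B.✓lt q) (B.✓lt p)))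
      (λ n → map₁ sym (map₂ B.lt✓ (≺-total (n ∘ B.lt✓))))

  module _ {H : ℕ} (M : Matched (dec H)) (x : ℕ) where
    open Matched M
    private
      h : ℕ
      h = hd (T x)
      q : ℕ
      q = image x h H
      w : ℕ
      w = ψ (pair x (pair (lo h H) (hi h H)))

      lo-found : ∀ {v} → lo h H ≡ suc v → ∃[ p ] p ∈ dec H × π₁ p A.≺ h × v ≡ π₂ p
      lo-found e with Lo.best-found h 0 (dec H)
      ... | inj₁ e' with trans (sym e) e'
      ... | ()
      lo-found e | inj₂ (p , m , s , e') = p , m , A.✓lt s , suc-injective (trans (sym e) e')

      hi-found : ∀ {v} → hi h H ≡ suc v → ∃[ p ] p ∈ dec H × h A.≺ π₁ p × v ≡ π₂ p
      hi-found e with Hi.best-found h 0 (dec H)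
      ... | inj₁ e' with trans (sym e) e'
      ... | ()
      hi-found e | inj₂ (p , m , s , e') = p , m , A.✓lt s , suc-injective (trans (sym e) e')

      spec : A.Block (dec (fst w)) × x ∈ dec (fst w) × B.Block (dec (snd w)) × length (dec (fst w)) ≡ length (dec (snd w)) ×
             (∀ {v} → lo h H ≡ suc v → v B.≺ q) × (∀ {v} → hi h H ≡ suc v → q B.≺ v)
      spec = ψ-ok x (lo h H) (hi h H) np ord
        where
        np : ∀ {v} → hi h H ≡ suc v → B.NoPred v
        np e with hi-found e
        ... | p , m , _ , refl = let _ , _ , _ , b , _ = paired m in proj₁ b
        ord : ∀ {v v'} → lo h H ≡ suc v → hi h H ≡ suc v' → v B.≺ v'
        ord e e' with lo-found e | hi-found e'
        ... | p , m , p<h , refl | p' , m' , h<p' , refl = forw m m' (A.≺-trans p<h h<p')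

      -- `ψ` answers with its own code of the block of `x`. Uniqueness of blocks identifies it with
      -- the one named by `T`, whose head is what the history records.
      new-paired : Paired h q
      new-paired with T-head x
      ... | t , e , b , m with dec (fst w) in e₁ | dec (snd w) in e₂ | spec
      ... | h' ∷ t' | q' ∷ u' | bA , m' , bB , le , _ with A.block-unique (h ∷ t) (h' ∷ t') b bA m m' | dec-hd-tl {snd w} e₂
      ... | refl | refl , _ = t' , u' , bA , bB , suc-injective le

      below : ∀ {p} → p ∈ dec H → π₁ p A.≺ h → π₂ p B.≺ q
      below {p} m lt with Lo.best-dominates h 0 (dec H) m (A.lt✓ lt)
      ... | v , e , inj₁ refl = proj₁ (proj₂ (proj₂ (proj₂ (proj₂ spec)))) e
      ... | v , e , inj₂ r = B.≺-trans (B.✓lt r) (proj₁ (proj₂ (proj₂ (proj₂ (proj₂ spec)))) e)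

      above : ∀ {p} → p ∈ dec H → h A.≺ π₁ p → q B.≺ π₂ p
      above {p} m lt with Hi.best-dominates h 0 (dec H) m (A.lt✓ lt)
      ... | v , e , inj₁ refl = proj₂ (proj₂ (proj₂ (proj₂ (proj₂ spec)))) e
      ... | v , e , inj₂ r = B.≺-trans (proj₂ (proj₂ (proj₂ (proj₂ (proj₂ spec)))) e) (B.✓lt r)

      extend : (∀ {p} → p ∈ dec H → π₁ p ≢ h) → Matched (mk h q ∷ dec H)
      extend new = record { paired = prd ; forw = fw ; back = bw }
        where
        prd : ∀ {p} → p ∈ mk h q ∷ dec H → Paired (π₁ p) (π₂ p)
        prd (here refl) = subst₂ Paired (sym (mk₁ h q)) (sym (mk₂ h q)) new-paired
        prd (there m) = paired m
        fw : ∀ {p p'} → p ∈ mk h q ∷ dec H → p' ∈ mk h q ∷ dec H → π₁ p A.≺ π₁ p' → π₂ p B.≺ π₂ p'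
        fw (here refl) (here refl) lt = ⊥-elim (A.≺-irrefl lt)
        fw (here refl) (there m') lt = subst (B._≺ _) (sym (mk₂ h q)) (above m' (subst (A._≺ _) (mk₁ h q) lt))
        fw (there m) (here refl) lt = subst (_ B.≺_) (sym (mk₂ h q)) (below m (subst (_ A.≺_) (mk₁ h q) lt))
        fw (there m) (there m') lt = forw m m' lt
        bw : ∀ {p p'} → p ∈ mk h q ∷ dec H → p' ∈ mk h q ∷ dec H → π₂ p B.≺ π₂ p' → π₁ p A.≺ π₁ p'
        bw (here refl) (here refl) lt = ⊥-elim (B.≺-irrefl lt)
        bw {p' = p'} (here refl) (there m') lt with A.≺-cmp h (π₁ p')
        ... | tri< l _ _ = subst (A._≺ _) (sym (mk₁ h q)) l
        ... | tri≈ _ e _ = ⊥-elim (new m' (sym e))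
        ... | tri> _ _ g = ⊥-elim (B.≺-asym (subst (B._≺ _) (mk₂ h q) lt) (below m' g))
        bw {p = p} (there m) (here refl) lt with A.≺-cmp (π₁ p) h
        ... | tri< l _ _ = subst (_ A.≺_) (sym (mk₁ h q)) l
        ... | tri≈ _ e _ = ⊥-elim (new m e)
        ... | tri> _ _ g = ⊥-elim (B.≺-asym (subst (_ B.≺_) (mk₂ h q) lt) (above m g))
        bw (there m) (there m') lt = back m m' lt

    forth-ok : Matched (dec (forth H x)) × (∀ {p} → p ∈ dec H → p ∈ dec (forth H x)) × ∃[ p ] p ∈ dec (forth H x) × π₁ p ≡ h
    forth-ok rewrite forth-def H x with anyL (λ p → π₁ p ≡ᵇ h) (dec H) in e
    ... | true = let p , m , r = ✓anyL (dec H) e in M , id , p , m , ✓≡ r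
    ... | false = subst Matched (sym (dec-cons (mk h q) H)) (extend λ m r → false✗ e (anyL✓ (dec H) m (≡✓ r))) ,
                  (λ {p} m → subst (p ∈_) (sym (dec-cons (mk h q) H)) (there m)) ,
                  mk h q , subst (mk h q ∈_) (sym (dec-cons (mk h q) H)) (here refl) , mk₁ h q

  find : ℕ → ℕ → ℕ
  find h H = foldl (λ a p → if π₁ p ≡ᵇ h then π₂ p else a) 0 (dec H)

  find-ok : ∀ {h H p} → p ∈ dec H → π₁ p ≡ h → ∃[ p' ] p' ∈ dec H × π₁ p' ≡ h × find h H ≡ π₂ p'
  find-ok {h} {H} m e = go 0 (dec H) m e
    where
    f : ℕ → ℕ → ℕ
    f = λ a p → if π₁ p ≡ᵇ h then π₂ p else a
    keep : ∀ a xs → foldl f a xs ≡ a ⊎ ∃[ p' ] p' ∈ xs × π₁ p' ≡ h × foldl f a xs ≡ π₂ p'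
    keep a [] = inj₁ refl
    keep a (p ∷ xs) with keep (f a p) xs
    ... | inj₂ (p' , m , e , e') = inj₂ (p' , there m , e , e')
    ... | inj₁ e with π₁ p ≡ᵇ h in q
    ... | true  = inj₂ (p , here refl , ✓≡ q , e)
    ... | false = inj₁ e
    go : ∀ a {p} xs → p ∈ xs → π₁ p ≡ h → ∃[ p' ] p' ∈ xs × π₁ p' ≡ h × foldl f a xs ≡ π₂ p'
    go a (p ∷ xs) (here refl) refl rewrite ≡ᵇ-refl (π₁ p) with keep (π₂ p) xs
    ... | inj₁ e = p , here refl , refl , e
    ... | inj₂ (p' , m , e , e') = p' , there m , e , e'
    go a (p ∷ xs) (there m) e with go (f a p) xs m e
    ... | p' , m' , r = p' , there m' , r

  abstract
    send : ℕ → ℕ → ℕ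
    send H x = matching x (T x) (T' (find (hd (T x)) H))

    send-def : ∀ H x → send H x ≡ matching x (T x) (T' (find (hd (T x)) H))
    send-def H x = refl

  send-ok : ∀ {H x} → Matched (dec H) → (∃[ p ] p ∈ dec H × π₁ p ≡ hd (T x)) →
            ∃[ p ] p ∈ dec H × ∃₂ λ t u → A.Block (π₁ p ∷ t) × B.Block (π₂ p ∷ u) × length t ≡ length u ×
            x ∈ π₁ p ∷ t × send H x ≡ corr 0 x (π₁ p ∷ t) (π₂ p ∷ u)
  send-ok {H} {x} M (p₀ , m₀ , e₀) with find-ok {hd (T x)} {H} m₀ e₀
  ... | p , m , e , f with Matched.paired M m | T-head x
  ... | t , u , bA , bB , le | t' , eT , bT , mT with T'-ok (find (hd (T x)) H)
  ... | bF , mF with subst A.Block (cong (_∷ t) e) bA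
  ... | bA' with A.chain-unique t t' (proj₂ bA') (proj₂ bT) | B.block-unique _ (π₂ p ∷ u) bF bB mF (here f)
  ... | refl | eF = p , m , t , u , bA , bB , le , subst (λ z → x ∈ z ∷ t) (sym e) mT ,
        trans (send-def H x) (trans (matching-corr x (T x) (T' (find (hd (T x)) H)) (trans (cong length eT) (trans (cong suc le) (sym (cong length eF)))))
              (cong₂ (corr 0 x) (trans eT (cong (_∷ t) (sym e))) eF))

  module _ {K : Class} (p₁ : PR₁ K π₁) (p₂ : PR₁ K π₂) (pm : PR₂ K mk) (pT : PR₁ K T) (pT' : PR₁ K T') (pψ : PR₁ K ψ) where
    abstract
      loPR : PR₂ K lo
      loPR = fun (foldPR (ifPR (andPR (A.≺PR (app₁ p₁ v1) v2) (orPR (zeroB v0) (B.≺PR (app₁ predPR v0) (app₁ p₂ v1))))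
                          (sucPR (app₁ p₂ v1)) v0) (const 0) v1)
      hiPR : PR₂ K hi
      hiPR = fun (foldPR (ifPR (andPR (A.≺PR v2 (app₁ p₁ v1)) (orPR (zeroB v0) (B.≺PR (app₁ p₂ v1) (app₁ predPR v0))))
                          (sucPR (app₁ p₂ v1)) v0) (const 0) v1)

      forthPR : PR₂ K forth
      forthPR = fun (ext (λ xs → sym (forth-def (lookup xs zero) (lookup xs (suc zero)))) (ifPR (anyLPR (eqPR (app₁ p₁ v0) (app₁ hdPR (app₁ pT v2))) v0) v0
        (app₂ consPR (app₂ pm h (app₁ hdPR (app₁ sndPR (app₁ pψ (app₂ pairPR v1 (app₂ pairPR (app₂ loPR h v0) (app₂ hiPR h v0))))))) v0)))
        where
        h : PR K {2} (λ xs → hd (T (lookup xs (suc zero))))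
        h = app₁ hdPR (app₁ pT v1)

      sendPR : PR₂ K send
      sendPR = fun (ext (λ xs → sym (send-def (lookup xs zero) (lookup xs (suc zero)))) (app₃ matchingPR v1 (app₁ pT v1) (app₁ pT'
        (foldPR (ifPR (eqPR (app₁ p₁ v1) (app₁ hdPR (app₁ pT v3))) (app₁ p₂ v1) v0) (const 0) v0))))

module BackAndForth (A B : PunctualLO) (S T : ℕ → ℕ) (S-ok : BlockFinder A S) (T-ok : BlockFinder B T)
  (φ ψ : ℕ → ℕ) (φ-ok : GapFiller A B φ) (ψ-ok : GapFiller B A ψ) where
  private
    module A = Order A
    module B = Order B
    module F = Half A B fst snd pair fst-pair snd-pair S T S-ok T-ok φ φ-ok
    module G = Half B A snd fst (λ q h → pair h q) (λ q h → snd-pair h q) (λ q h → fst-pair h q) T S T-ok S-ok ψ ψ-ok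
    open Pairs A B fst snd
    open Increasing

    abstract
      history : ℕ → ℕ
      -- Stage `s` treats the block of `s` in A and then the block of `s` in B, so the history at
      -- `suc x` already settles both `to x` and `from x`.
      history = nrec 0 (λ s H → G.forth (F.forth H s) s)

      history-def : ∀ s → history s ≡ nrec 0 (λ s H → G.forth (F.forth H s) s) s
      history-def s = refl

      matched : ∀ s → Matched (dec (history s))
      matched zero    = record { paired = λ () ; forw = λ () ; back = λ () }
      matched (suc s) = swap (proj₁ (G.forth-ok (swap (proj₁ (F.forth-ok (matched s) s))) s))

      grows₁ : ∀ s {p} → p ∈ dec (history s) → p ∈ dec (history (suc s))
      grows₁ s m = proj₁ (proj₂ (G.forth-ok (swap (proj₁ (F.forth-ok (matched s) s))) s))
                     (proj₁ (proj₂ (F.forth-ok (matched s) s)) m)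

      treats : ∀ x → ∃[ p ] p ∈ dec (history (suc x)) × fst p ≡ hd (S x)
      treats x with F.forth-ok (matched x) x
      ... | M , _ , p , m , e = p , proj₁ (proj₂ (G.forth-ok (swap M) x)) m , e

      treats' : ∀ y → ∃[ p ] p ∈ dec (history (suc y)) × snd p ≡ hd (T y)
      treats' y = proj₂ (proj₂ (G.forth-ok (swap (proj₁ (F.forth-ok (matched y) y))) y))

    grows : ∀ s d {p} → p ∈ dec (history s) → p ∈ dec (history (d + s))
    grows s zero    m = m
    grows s (suc d) m = grows₁ (d + s) (grows s d m)

    grows-⊔ˡ : ∀ s s' {p} → p ∈ dec (history s) → p ∈ dec (history (s ⊔ s'))
    grows-⊔ˡ s s' {p} m = subst (λ z → p ∈ dec (history z)) (m∸n+n≡m (m≤m⊔n s s')) (grows s (s ⊔ s' ∸ s) m)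

    grows-⊔ʳ : ∀ s s' {p} → p ∈ dec (history s') → p ∈ dec (history (s ⊔ s'))
    grows-⊔ʳ s s' {p} m = subst (λ z → p ∈ dec (history z)) (m∸n+n≡m (m≤n⊔m s s')) (grows s' (s ⊔ s' ∸ s') m)

    to : ℕ → ℕ
    to x = F.send (history (suc x)) x

    from : ℕ → ℕ
    from y = G.send (history (suc y)) y

    to-ok : ∀ x → ∃[ p ] p ∈ dec (history (suc x)) × ∃₂ λ t u → A.Block (fst p ∷ t) × B.Block (snd p ∷ u) × length t ≡ length u ×
            x ∈ fst p ∷ t × to x ≡ corr 0 x (fst p ∷ t) (snd p ∷ u)
    to-ok x = F.send-ok (matched (suc x)) (treats x)

    from-ok : ∀ y → ∃[ p ] p ∈ dec (history (suc y)) × ∃₂ λ u t → B.Block (snd p ∷ u) × A.Block (fst p ∷ t) × length u ≡ length t ×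
            y ∈ snd p ∷ u × from y ≡ corr 0 y (snd p ∷ u) (fst p ∷ t)
    from-ok y = G.send-ok (swap (matched (suc y))) (treats' y)

    -- The value does not depend on the stage at which it is read: two histories are contained in a
    -- common later one, where the matching is functional.
    to-unique : ∀ {s x p t u} → p ∈ dec (history s) → A.Block (fst p ∷ t) → B.Block (snd p ∷ u) → x ∈ fst p ∷ t →
                to x ≡ corr 0 x (fst p ∷ t) (snd p ∷ u)
    to-unique {s} {x} {p} {t} {u} m bA bB mx with to-ok x
    ... | p' , m' , t' , u' , bA' , bB' , le , mx' , e with A.head-unique bA' bA mx' mx
    ... | e₁ with Matched.functional (matched (suc x ⊔ s)) (grows-⊔ˡ (suc x) s m') (grows-⊔ʳ (suc x) s m) e₁
    ... | e₂ = trans e (cong₂ (corr 0 x) (A.block-unique _ _ bA' bA mx' mx)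
                                        (B.block-unique _ _ bB' bB (here refl) (here e₂)))

    to-from : ∀ y → to (from y) ≡ y
    to-from y with from-ok y
    ... | p , m , u , t , bB , bA , le , my , e = trans (cong to e)
          (trans (to-unique {suc y} m bA bB (corr-∈ 0 y (snd p ∷ u) (fst p ∷ t) my (cong suc le)))
                 (corr-inverse B A 0 0 y (snd p ∷ u) (fst p ∷ t) (chain-Inc B u (proj₂ bB)) (chain-Inc A t (proj₂ bA)) (cong suc le) my))

    to-mono : ∀ {x x'} → x A.≺ x' → to x B.≺ to x'
    to-mono {x} {x'} lt with to-ok x | to-ok x'
    ... | p , m , t , u , bA , bB , le , mx , e | p' , m' , t' , u' , bA' , bB' , le' , mx' , e' with A.≺-cmp (fst p) (fst p')
    ... | tri> _ _ gt = ⊥-elim (A.≺-asym lt (not-before gt))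
      where
      not-before : fst p' A.≺ fst p → x' A.≺ x
      not-before gt with A.≺-cmp x' (fst p)
      ... | tri< l _ _ = ⊥-elim (A.chain-≤ t (proj₂ bA) mx (A.≺-trans lt l))
      ... | tri≈ _ r _ = ⊥-elim (A.chain-≤ t (proj₂ bA) mx (subst (x A.≺_) r lt))
      ... | tri> _ _ g = ⊥-elim (A.≺-asym g (A.chain-before t' (proj₂ bA') mx' (proj₁ bA) gt))
    ... | tri≈ _ r _ = subst₂ B._≺_ (sym e) (sym (to-unique {suc x} m bA bB mx''))
          (corr-mono A B 0 x x' (fst p ∷ t) (snd p ∷ u) (chain-Inc A t (proj₂ bA)) (chain-Inc B u (proj₂ bB)) (cong suc le) mx mx'' lt)
      where
      mx'' : x' ∈ fst p ∷ t
      mx'' = subst (x' ∈_) (A.block-unique _ _ bA' bA (here refl) (here (sym r))) mx'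
    ... | tri< l _ _ with corr-∈ 0 x (fst p ∷ t) (snd p ∷ u) mx (cong suc le) | corr-∈ 0 x' (fst p' ∷ t') (snd p' ∷ u') mx' (cong suc le')
    ... | c | c' with B.chain-before u (proj₂ bB) c (proj₁ bB')
                        (Matched.forw (matched (suc x ⊔ suc x')) (grows-⊔ˡ (suc x) (suc x') m) (grows-⊔ʳ (suc x) (suc x') m') l)
    ... | l' = subst₂ B._≺_ (sym e) (sym e') (go c')
      where
      go : ∀ {z} → z ∈ snd p' ∷ u' → corr 0 x (fst p ∷ t) (snd p ∷ u) B.≺ z
      go (here refl) = l'
      go (there m) = B.≺-trans l' (B.chain-tail u' (proj₂ bB') m)

    to-reflects : ∀ {x x'} → to x B.≺ to x' → x A.≺ x'
    to-reflects {x} {x'} lt with A.≺-cmp x x'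
    ... | tri< l _ _    = l
    ... | tri≈ _ refl _ = ⊥-elim (B.≺-irrefl lt)
    ... | tri> _ _ gt   = ⊥-elim (B.≺-asym lt (to-mono gt))

    from-to : ∀ x → from (to x) ≡ x
    from-to x with A.≺-cmp (from (to x)) x
    ... | tri< l _ _ = ⊥-elim (B.≺-irrefl (subst (B._≺ to x) (to-from (to x)) (to-mono l)))
    ... | tri≈ _ e _ = e
    ... | tri> _ _ g = ⊥-elim (B.≺-irrefl (subst (to x B.≺_) (to-from (to x)) (to-mono g)))

  iso : LOIso A B
  iso = record { bij = mk↔ₛ′ to from to-from from-to ; preserves = λ x y → mk⇔ to-mono to-reflects }

  module _ {K : Class} (pS : PR₁ K S) (pT : PR₁ K T) (pφ : PR₁ K φ) (pψ : PR₁ K ψ) where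
    private
      pairPR' : PR₂ K (λ q h → pair h q)
      pairPR' = fun (app₂ pairPR v1 v0)

      historyPR : PR₁ K history
      historyPR = fun (ext (λ xs → sym (history-def (lookup xs zero))) (nrecPR (const 0) (app₂ (G.forthPR sndPR fstPR pairPR' pT pS pψ)
                    (app₂ (F.forthPR fstPR sndPR pairPR pS pT pφ) v1 v0) v0) v0))

    toPR : PR₁ K (LOIso.to iso)
    toPR = fun (app₂ (F.sendPR fstPR sndPR pairPR pS pT pφ) (app₁ historyPR (sucPR v0)) v0)

    fromPR : PR₁ K (LOIso.from iso)
    fromPR = fun (app₂ (G.sendPR sndPR fstPR pairPR' pT pS pψ) (app₁ historyPR (sucPR v0)) v0)

-- Enumeration without unbounded search

lift : {f : Vec ℕ n → ℕ} → PR plain f → PR K f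
lift (t by p) = ext p (termPR t)

-- Increasing enumeration of a primitive recursive set V whose gaps are bounded by u.
module Enumerate (V : ℕ → Bool) (u : ℕ → ℕ) (u≥ : ∀ z → z ≤ u z) (uV : ∀ z → ✓ V (u z)) where

  private
    -- Search upwards from `z` with a budget of steps, halting at the first member of `V`. The
    -- budget `u z` suffices because `u z` is itself a member and is within reach.
    climb : ℕ → ℕ → ℕ
    climb z = nrec z (λ i r → if V r then r else suc r)

    climb-spec : ∀ z k → z ≤ climb z k × (∀ {v} → z ≤ v → v < climb z k → ¬ ✓ V v) × (✓ V (climb z k) ⊎ climb z k ≡ k + z)
    climb-spec z zero = ≤-refl , (λ p q → ⊥-elim (<-irrefl refl (<-≤-trans q p))) , inj₂ refl
    climb-spec z (suc k) with climb-spec z k | V (climb z k) in e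
    ... | ge , none , _ | true = ge , none , inj₁ e
    ... | ge , none , inj₁ v | false = ⊥-elim (false✗ e v)
    ... | ge , none , inj₂ r | false = m≤n⇒m≤1+n ge , none' , inj₂ (cong suc r)
      where
      none' : ∀ {v} → z ≤ v → v < suc (climb z k) → ¬ ✓ V v
      none' p q with m≤n⇒m<n∨m≡n (≤-pred q)
      ... | inj₁ lt   = none p lt
      ... | inj₂ refl = false✗ e

  abstract
    next : ℕ → ℕ
    next z = climb z (u z)

    next≥ : ∀ z → z ≤ next z
    next≥ z = proj₁ (climb-spec z (u z))

    next-none : ∀ z {v} → z ≤ v → v < next z → ¬ ✓ V v
    next-none z = proj₁ (proj₂ (climb-spec z (u z)))

    next-V : ∀ z → ✓ V (next z)
    next-V z with proj₂ (proj₂ (climb-spec z (u z)))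
    ... | inj₁ v = v
    ... | inj₂ e with m≤n⇒m<n∨m≡n (≤-trans (m≤m+n (u z) z) (≤-reflexive (sym e)))
    ... | inj₁ lt = ⊥-elim (next-none z (u≥ z) lt (uV z))
    ... | inj₂ e' = subst (λ v → ✓ V v) e' (uV z)

  next-fix : ∀ {z} → ✓ V z → next z ≡ z
  next-fix {z} v with m≤n⇒m<n∨m≡n (next≥ z)
  ... | inj₁ lt = ⊥-elim (next-none z ≤-refl lt v)
  ... | inj₂ e = sym e

  next-skip : ∀ {z} → ¬ ✓ V z → next (suc z) ≡ next z
  next-skip {z} nv with <-cmp (next (suc z)) (next z)
  ... | tri≈ _ e _ = e
  ... | tri< lt _ _ = ⊥-elim (next-none z (≤-trans (n≤1+n z) (next≥ (suc z))) lt (next-V (suc z)))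
  ... | tri> _ _ gt with m≤n⇒m<n∨m≡n (next≥ z)
  ... | inj₁ lt = ⊥-elim (next-none (suc z) lt gt (next-V z))
  ... | inj₂ e = ⊥-elim (nv (subst (λ v → ✓ V v) (sym e) (next-V z)))

  abstract
    nth : ℕ → ℕ
    nth = nrec (next 0) (λ i r → next (suc r))

    index : ℕ → ℕ
    index = nrec 0 (λ i r → if V i then suc r else r)

    nth-V : ∀ i → ✓ V (nth i)
    nth-V zero    = next-V 0
    nth-V (suc i) = next-V (suc (nth i))

    nth-step : ∀ i → nth i < nth (suc i)
    nth-step i = next≥ (suc (nth i))

    private
      nth-index-next : ∀ z → nth (index z) ≡ next z
      nth-index-next zero = refl
      nth-index-next (suc z) with V z in e
      ... | true  = cong (next ∘ suc) (trans (nth-index-next z) (next-fix e))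
      ... | false = trans (nth-index-next z) (sym (next-skip (false✗ e)))

    nth-index : ∀ {z} → ✓ V z → nth (index z) ≡ z
    nth-index {z} v = trans (nth-index-next z) (next-fix v)

  nth-mono : ∀ {i j} → i < j → nth i < nth j
  nth-mono {i} {suc j} (s≤s p) with m≤n⇒m<n∨m≡n p
  ... | inj₁ lt   = <-trans (nth-mono lt) (nth-step j)
  ... | inj₂ refl = nth-step j

  nth-injective : ∀ {i j} → nth i ≡ nth j → i ≡ j
  nth-injective {i} {j} e with <-cmp i j
  ... | tri< lt _ _ = ⊥-elim (<-irrefl e (nth-mono lt))
  ... | tri≈ _ r _  = r
  ... | tri> _ _ gt = ⊥-elim (<-irrefl (sym e) (nth-mono gt))

  module _ (pV : PR₁ plain (λ z → b2n (V z))) (pu : PR₁ plain u) where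
    abstract
      nextPR : PR₁ plain next
      nextPR = fun (nrecPR v0 (ifPR (app₁ pV v1) v1 (sucPR v1)) (app₁ pu v0))

      nthPR : PR₁ K nth
      nthPR = fun (lift (nrecPR (app₁ nextPR (const 0)) (app₁ nextPR (sucPR v1)) v0))

      indexPR : PR₁ K index
      indexPR = fun (lift (nrecPR (const 0) (ifPR (app₁ pV v0) (sucPR v1) v1) v0))

-- The order of the nodes

infix 4 _◁_
-- the lexicographic order in which a prefix comes first and larger entries come earlier
data _◁_ : List ℕ → List ℕ → Set where
  prefix : ∀ {k τ} → [] ◁ k ∷ τ
  differ : ∀ {k k' σ τ} → k' < k → k ∷ σ ◁ k' ∷ τ
  same   : ∀ {k σ τ} → σ ◁ τ → k ∷ σ ◁ k ∷ τ

◁-irrefl : ∀ {σ} → ¬ σ ◁ σ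
◁-irrefl (differ p) = <-irrefl refl p
◁-irrefl (same p)   = ◁-irrefl p

◁-trans : ∀ {σ τ υ} → σ ◁ τ → τ ◁ υ → σ ◁ υ
◁-trans prefix     (differ q) = prefix
◁-trans prefix     (same q)   = prefix
◁-trans (differ p) (differ q) = differ (<-trans q p)
◁-trans (differ p) (same q)   = differ p
◁-trans (same p)   (differ q) = differ q
◁-trans (same p)   (same q)   = same (◁-trans p q)

◁-cmp : ∀ σ τ → σ ◁ τ ⊎ σ ≡ τ ⊎ τ ◁ σ
◁-cmp [] [] = inj₂ (inj₁ refl)
◁-cmp [] (k ∷ τ) = inj₁ prefix
◁-cmp (k ∷ σ) [] = inj₂ (inj₂ prefix)
◁-cmp (k ∷ σ) (k' ∷ τ) with <-cmp k k'
... | tri< lt _ _ = inj₂ (inj₂ (differ lt))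
... | tri> _ _ gt = inj₁ (differ gt)
... | tri≈ _ refl _ with ◁-cmp σ τ
... | inj₁ p = inj₁ (same p)
... | inj₂ (inj₁ e) = inj₂ (inj₁ (cong (k ∷_) e))
... | inj₂ (inj₂ p) = inj₂ (inj₂ (same p))

◁-++ : ∀ σ k ρ → σ ◁ σ ++ k ∷ ρ
◁-++ []      k ρ = prefix
◁-++ (x ∷ σ) k ρ = same (◁-++ σ k ρ)

-- σ ++ k ∷ ρ comes just after σ when k is large
◁-close : ∀ {σ τ N} → σ ◁ τ → (∀ {x} → x ∈ τ → x < N) → ∀ {k} ρ → N ≤ k → σ ++ k ∷ ρ ◁ τ
◁-close prefix     b ρ N≤k = differ (<-≤-trans (b (here refl)) N≤k)
◁-close (differ p) b ρ N≤k = differ p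
◁-close (same p)   b ρ N≤k = same (◁-close p (b ∘ there) ρ N≤k)

ltL : List ℕ → List ℕ → Bool
ltL []      []       = false
ltL []      (_ ∷ _)  = true
ltL (_ ∷ _) []       = false
ltL (k ∷ σ) (k' ∷ τ) = if k' <ᵇ k then true else if k <ᵇ k' then false else ltL σ τ

ltL-sound : ∀ σ τ → ✓ ltL σ τ → σ ◁ τ
ltL-sound [] (k ∷ τ) _ = prefix
ltL-sound (k ∷ σ) (k' ∷ τ) q with k' <ᵇ k in e | k <ᵇ k' in e'
... | true  | _     = differ (✓< e)
... | false | false with <-cmp k k'
... | tri< lt _ _   = ⊥-elim (false✗ e' (<✓ lt))
... | tri> _ _ gt   = ⊥-elim (false✗ e (<✓ gt))
... | tri≈ _ refl _ = same (ltL-sound σ τ q)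

ltL-complete : ∀ {σ τ} → σ ◁ τ → ✓ ltL σ τ
ltL-complete prefix = refl
ltL-complete (differ p) rewrite <✓ p = refl
ltL-complete {k ∷ σ} (same p) rewrite ✗false {k <ᵇ k} (λ q → <-irrefl refl (✓< {k} q)) = ltL-complete p

private
  -- An automaton reading σ while consuming τ: status 0 is undecided, 1 is less, 2 is not less. If
  -- it ends undecided with a rest of τ, then σ is a proper prefix.
  scan : ℕ × List ℕ → ℕ → ℕ × List ℕ
  scan (zero  , [])     k = 2 , []
  scan (zero  , k' ∷ τ) k = if k' <ᵇ k then (1 , []) else if k <ᵇ k' then (2 , []) else (0 , τ)
  scan (suc s , τ)      k = suc s , τ

  scanCode : ℕ × List ℕ → ℕ
  scanCode (s , τ) = pair s (enc τ)

  scanN : ℕ → ℕ → ℕ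
  scanN a k = if fst a ≡ᵇ 0
    then (if snd a ≡ᵇ 0 then pair 2 0
          else if hd (snd a) <ᵇ k then pair 1 0 else if k <ᵇ hd (snd a) then pair 2 0 else pair 0 (tl (snd a)))
    else a

  scan-code : ∀ s k → scanN (scanCode s) k ≡ scanCode (scan s k)
  scan-code (zero , []) k rewrite fst-pair 0 0 | snd-pair 0 0 = refl
  scan-code (zero , k' ∷ τ) k rewrite fst-pair 0 (enc (k' ∷ τ)) | snd-pair 0 (enc (k' ∷ τ)) | fst-pair k' (enc τ) | snd-pair k' (enc τ)
    with k' <ᵇ k | k <ᵇ k'
  ... | true  | _     = refl
  ... | false | true  = refl
  ... | false | false = refl
  scan-code (suc s , τ) k rewrite fst-pair (suc s) (enc τ) = refl

  scanLess : ℕ → Bool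
  scanLess a = (fst a ≡ᵇ 1) ∨ ((fst a ≡ᵇ 0) ∧ not (snd a ≡ᵇ 0))

  scan-stuck : ∀ s τ σ → foldl scan (suc s , τ) σ ≡ (suc s , τ)
  scan-stuck s τ []      = refl
  scan-stuck s τ (_ ∷ σ) = scan-stuck s τ σ

  scanLess-ltL : ∀ σ τ → scanLess (scanCode (foldl scan (0 , τ) σ)) ≡ ltL σ τ
  scanLess-ltL [] [] rewrite fst-pair 0 0 | snd-pair 0 0 = refl
  scanLess-ltL [] (k ∷ τ) rewrite fst-pair 0 (enc (k ∷ τ)) | snd-pair 0 (enc (k ∷ τ)) = refl
  scanLess-ltL (k ∷ σ) [] rewrite scan-stuck 1 [] σ | fst-pair 2 0 = refl
  scanLess-ltL (k ∷ σ) (k' ∷ τ) with k' <ᵇ k | k <ᵇ k'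
  ... | true  | _ rewrite scan-stuck 0 [] σ | fst-pair 1 0 = refl
  ... | false | true rewrite scan-stuck 1 [] σ | fst-pair 2 0 = refl
  ... | false | false = scanLess-ltL σ τ

abstract
  ltLPR : {s t : Vec ℕ n → ℕ} → PR K s → PR K t → PRB K (λ xs → ltL (dec (s xs)) (dec (t xs)))
  ltLPR {K = K} {s = s} {t} ps pt = compV {f = λ ys → b2n (ltL (dec (lookup ys zero)) (dec (lookup ys (suc zero))))}
      (ext (λ ys → cong b2n (go (lookup ys zero) (lookup ys (suc zero)))) body) (consV ps (consV pt nilV))
    where
    scanNPR : PR₂ K scanN
    scanNPR = fun (ifPR (zeroB (app₁ fstPR v0)) (ifPR (zeroB (app₁ sndPR v0)) (app₂ pairPR (const 2) (const 0))
      (ifPR (ltPR (app₁ hdPR (app₁ sndPR v0)) v1) (app₂ pairPR (const 1) (const 0))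
        (ifPR (ltPR v1 (app₁ hdPR (app₁ sndPR v0))) (app₂ pairPR (const 2) (const 0)) (app₂ pairPR (const 0) (app₁ tlPR (app₁ sndPR v0)))))) v0)
    final : PR K {2} (λ ys → foldl scanN (pair 0 (lookup ys (suc zero))) (dec (lookup ys zero)))
    final = foldPR (app₂ scanNPR v0 v1) (app₂ pairPR (const 0) v1) v0
    body : PRB K {2} (λ ys → scanLess (foldl scanN (pair 0 (lookup ys (suc zero))) (dec (lookup ys zero))))
    body = orPR (eqPR (app₁ fstPR final) (const 1)) (andPR (zeroB (app₁ fstPR final)) (notPR (zeroB (app₁ sndPR final))))
    go : ∀ a b → scanLess (foldl scanN (pair 0 b) (dec a)) ≡ ltL (dec a) (dec b)
    go a b = trans (cong scanLess (trans (cong (λ z → foldl scanN (pair 0 z) (dec a)) (sym (enc-dec b)))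
               (foldl-code {code = scanCode} scan-code (0 , dec b) (dec a)))) (scanLess-ltL (dec a) (dec b))

-- Π⁰₂ conditions as infinitely many confirmations

-- Turns the Π⁰₂ condition ∀ b ∃ c R into "infinitely many t fire": a counter b is advanced at stage t
-- when some c < t witnesses R for its current value.  Stage 0 fires by convention.
module Firing (R : ℕ → ℕ → ℕ → ℕ → Bool) where

  hit : ℕ → ℕ → ℕ → ℕ → Bool
  hit x w t r = anyB (λ c → R x w r c) t

  counter : ℕ → ℕ → ℕ → ℕ
  counter x w = nrec 0 (λ t r → if hit x w t r then suc r else r)

  Fires : ℕ → ℕ → ℕ → Bool
  Fires x w t = (t ≡ᵇ 0) ∨ hit x w t (counter x w t)

  True Infinite : ℕ → ℕ → Set
  True x w = ∀ b → ∃[ c ] (✓ R x w b c)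
  Infinite x w = ∀ N → ∃[ t ] N ≤ t × ✓ Fires x w t

  firesPR : PRB₄ plain R → PR₃ plain (λ x w t → b2n (Fires x w t))
  firesPR pR = fun (orPR (zeroB v2) (hitP v0 v1 v2 (nrecPR (const 0) (ifPR (hitP v2 v3 v0 v1) (sucPR v1) v1) v2)))
    where
    hitP : {x w t r : Vec ℕ m → ℕ} → PR plain x → PR plain w → PR plain t → PR plain r →
           PRB plain (λ xs → hit (x xs) (w xs) (t xs) (r xs))
    hitP px pw pt pr = compV {f = λ ys → b2n (hit (lookup ys zero) (lookup ys (suc zero)) (lookup ys (suc (suc zero))) (lookup ys (suc (suc (suc zero)))))}
      (anyPR (compV pR (consV v1 (consV v2 (consV v4 (consV v0 nilV))))) v2)
      (consV px (consV pw (consV pt (consV pr nilV))))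

  module _ (x w : ℕ) where
    private
      counter-hit : ∀ t → ✓ hit x w t (counter x w t) → counter x w (suc t) ≡ suc (counter x w t)
      counter-hit t h rewrite h = refl

      counter-step : ∀ t → counter x w t ≤ counter x w (suc t)
      counter-step t with hit x w t (counter x w t)
      ... | true  = n≤1+n _
      ... | false = ≤-refl

      counter-mono : ∀ d t → counter x w t ≤ counter x w (d + t)
      counter-mono zero    t = ≤-refl
      counter-mono (suc d) t = ≤-trans (counter-mono d t) (counter-step (d + t))

      counter-sound : ∀ t {b} → b < counter x w t → ∃[ c ] (✓ R x w b c)
      counter-sound (suc t) {b} lt with hit x w t (counter x w t) in e
      ... | false = counter-sound t lt
      ... | true with m≤n⇒m<n∨m≡n (≤-pred lt)
      ... | inj₁ lt' = counter-sound t lt'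
      ... | inj₂ refl with ✓any t e
      ... | c , _ , q = c , q

      hit-or-wait : ∀ N d → (∃[ t ] N ≤ t × ✓ hit x w t (counter x w t)) ⊎ counter x w (d + N) ≡ counter x w N
      hit-or-wait N zero = inj₂ refl
      hit-or-wait N (suc d) with hit-or-wait N d
      ... | inj₁ h = inj₁ h
      ... | inj₂ e with hit x w (d + N) (counter x w (d + N)) in q
      ... | true  = inj₁ (d + N , m≤n+m N d , q)
      ... | false = inj₂ e

    True⇒Infinite : True x w → Infinite x w
    True⇒Infinite good N with good (counter x w N)
    ... | c , q with hit-or-wait N (suc c)
    ... | inj₁ (t , N≤t , h) = t , N≤t , ∨✓₂ {t ≡ᵇ 0} h
    -- Without a hit the counter still has its value from stage `N`, and stage `suc c + N` is late
    -- enough for the search to reach `c`.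
    ... | inj₂ e = suc c + N , m≤n+m N (suc c) , ∨✓₂ {suc c + N ≡ᵇ 0}
                     (any✓ (suc c + N) {c} (s≤s (m≤m+n c N)) (subst (λ r → ✓ R x w r c) (sym e) q))

    Infinite⇒True : Infinite x w → True x w
    Infinite⇒True inf b = let t , b<c = unbounded (suc b) in counter-sound t b<c
      where
      unbounded : ∀ b → ∃[ t ] b ≤ counter x w t
      unbounded zero = 0 , z≤n
      unbounded (suc b) with unbounded b
      -- Asking for a stage from `suc t` on excludes stage 0, whose firing is conventional and does
      -- not advance the counter.
      ... | t , b≤ with inf (suc t)
      ... | suc t' , s≤s t≤t' , f = suc (suc t') , subst (suc b ≤_) (sym (counter-hit (suc t') f))
              (s≤s (≤-trans b≤ (subst (λ z → counter x w t ≤ counter x w z) (m∸n+n≡m (m≤n⇒m≤1+n t≤t')) (counter-mono (suc t' ∸ t) t))))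

-- The punctual copy attached to a Π⁰₂ condition

-- Nodes are nonempty lists.  An entry under an open node creates either a block of size e ≢ small or
-- a guess w that R x w is true, x being the first entry of the node.  The guess owns `small` elements;
-- its child at a firing stage k owns `large ∸ small` elements just after them, completed to a block of
-- size `large` once a later stage fires.  So the block of a guess has size `small` if it fires
-- infinitely often; otherwise it absorbs the child at the last firing stage and has size `large`.
data State : Set where
  root bad : State
  block    : (x size : ℕ) → State
  guess    : (x w : ℕ) → State
  extra    : (x w k : ℕ) → State

module Construction (em : ExcludedMiddle 0ℓ) {F : ℕ → Set} (F-pos : ∀ {s} → F s → 1 ≤ s)
  (small large : ℕ) (small<large : small < large) (F-small : F small) (F-large : F large)
  (E : ℕ → ℕ) (pE : PR₁ plain E) (E-F : ∀ e → F (E e)) (E≢ : ∀ e → E e ≢ small)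
  (E-onto : ∀ {s} → F s → s ≢ small → ∃[ e ] E e ≡ s)
  (R : ℕ → ℕ → ℕ → ℕ → Bool) (pR : PRB₄ plain R)
  (total : ∀ x → ∃[ w ] ∀ b → ∃[ c ] (✓ R x w b c)) where
  open Classical em
  open Firing R

  -- An entry has the shape ⟨⟨tag, value⟩, padding⟩: tag 0 asks for a block, any other tag for a
  -- guess. Varying the padding gives children of the same kind arbitrarily close to their parent.
  child : ℕ → ℕ → State
  child x k = if fst (fst k) ≡ᵇ 0 then block x (E (snd (fst k))) else guess x (snd (fst k))

  step : State → ℕ → State
  step root          k = block k large
  step bad           k = bad
  step (block x s)   k = child x k
  step (guess x w)   k = if Fires x w k then extra x w k else bad
  step (extra x w j) k = child x k

  run : List ℕ → State
  run = foldl step root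

  run-∷ʳ : ∀ σ k → run (σ ∷ʳ k) ≡ step (run σ) k
  run-∷ʳ σ k = foldl-∷ʳ step root k σ

  -- Presence of place `j`, witnessed by stage `t`. The second part of an `extra` node only appears
  -- once a stage after `k` fires; presence is thus Σ⁰₁, with a decidable witness.
  owned : State → ℕ → ℕ → Bool
  owned root          j t = false
  owned bad           j t = false
  owned (block x s)   j t = j <ᵇ s
  owned (guess x w)   j t = j <ᵇ small
  owned (extra x w k) j t = (j <ᵇ large ∸ small) ∨ ((j <ᵇ large) ∧ (k <ᵇ t) ∧ Fires x w t)

  stateCode : State → ℕ
  stateCode root          = pair 0 0
  stateCode bad           = pair 4 0
  stateCode (block x s)   = pair 1 (pair x (pair s 0))
  stateCode (guess x w)   = pair 2 (pair x (pair w 0))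
  stateCode (extra x w k) = pair 3 (pair x (pair w k))

  stepN : ℕ → ℕ → ℕ
  stepN c k = if fst c ≡ᵇ 0 then pair 1 (pair k (pair large 0))
    else if fst c ≡ᵇ 4 then c
    else if fst c ≡ᵇ 2 then (if Fires (fst (snd c)) (fst (snd (snd c))) k then pair 3 (pair (fst (snd c)) (pair (fst (snd (snd c))) k)) else pair 4 0)
    else if fst (fst k) ≡ᵇ 0 then pair 1 (pair (fst (snd c)) (pair (E (snd (fst k))) 0))
    else pair 2 (pair (fst (snd c)) (pair (snd (fst k)) 0))

  ownedN : ℕ → ℕ → ℕ → Bool
  ownedN c j t = if fst c ≡ᵇ 1 then j <ᵇ fst (snd (snd c))
    else if fst c ≡ᵇ 2 then j <ᵇ small
    else if fst c ≡ᵇ 3 then (j <ᵇ large ∸ small) ∨ ((j <ᵇ large) ∧ (snd (snd (snd c)) <ᵇ t) ∧ Fires (fst (snd c)) (fst (snd (snd c))) t)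
    else false

  step-code : ∀ s k → stepN (stateCode s) k ≡ stateCode (step s k)
  step-code root k rewrite fst-pair 0 0 = refl
  step-code bad k rewrite fst-pair 4 0 = refl
  step-code (block x s) k
    rewrite fst-pair 1 (pair x (pair s 0)) | snd-pair 1 (pair x (pair s 0)) | fst-pair x (pair s 0)
    with fst (fst k) ≡ᵇ 0
  ... | true  = refl
  ... | false = refl
  step-code (extra x w j) k
    rewrite fst-pair 3 (pair x (pair w j)) | snd-pair 3 (pair x (pair w j)) | fst-pair x (pair w j)
    with fst (fst k) ≡ᵇ 0
  ... | true  = refl
  ... | false = refl
  step-code (guess x w) k
    rewrite fst-pair 2 (pair x (pair w 0)) | snd-pair 2 (pair x (pair w 0)) | fst-pair x (pair w 0) | snd-pair x (pair w 0) | fst-pair w 0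
    with Fires x w k
  ... | true  = refl
  ... | false = refl

  owned-code : ∀ s j t → ownedN (stateCode s) j t ≡ owned s j t
  owned-code root j t rewrite fst-pair 0 0 = refl
  owned-code bad j t rewrite fst-pair 4 0 = refl
  owned-code (block x s) j t
    rewrite fst-pair 1 (pair x (pair s 0)) | snd-pair 1 (pair x (pair s 0)) | snd-pair x (pair s 0) | fst-pair s 0 = refl
  owned-code (guess x w) j t rewrite fst-pair 2 (pair x (pair w 0)) = refl
  owned-code (extra x w k) j t
    rewrite fst-pair 3 (pair x (pair w k)) | snd-pair 3 (pair x (pair w k)) | fst-pair x (pair w k) | snd-pair x (pair w k) | fst-pair w k | snd-pair w k = refl

  runN : ℕ → ℕ
  runN σ = foldl stepN (pair 0 0) (dec σ)

  runN-code : ∀ σ → runN σ ≡ stateCode (run (dec σ))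
  runN-code σ = foldl-code {code = stateCode} step-code root (dec σ)

  node place stamp : ℕ → ℕ
  node z  = fst (fst z)
  place z = snd (fst z)
  stamp z = snd z

  state : ℕ → State
  state z = run (dec (node z))

  -- z codes the element `place z` of `node z`, and `stamp z` is the first stage at which it is present
  isElement : ℕ → Bool
  isElement z = ownedN (runN (node z)) (place z) (stamp z) ∧ not (anyB (λ t → ownedN (runN (node z)) (place z) t) (stamp z))

  element : ℕ → ℕ → ℕ → ℕ
  element σ j t = pair (pair σ j) t

  node-element : ∀ σ j t → node (element σ j t) ≡ σ
  node-element σ j t = trans (cong fst (fst-pair (pair σ j) t)) (fst-pair σ j)

  place-element : ∀ σ j t → place (element σ j t) ≡ j
  place-element σ j t = trans (cong snd (fst-pair (pair σ j) t)) (snd-pair σ j)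

  isElement-owned : ∀ {z} → ✓ isElement z → ✓ owned (state z) (place z) (stamp z)
  isElement-owned {z} q = subst ✓_ (trans (cong (λ c → ownedN c (place z) (stamp z)) (runN-code (node z))) (owned-code (state z) (place z) (stamp z))) (proj₁ (✓∧ q))

  isElement-least : ∀ {z t} → ✓ isElement z → t < stamp z → ¬ ✓ owned (state z) (place z) t
  isElement-least {z} {t} q lt o = ✓not (proj₂ (✓∧ {ownedN (runN (node z)) (place z) (stamp z)} q))
    (any✓ (stamp z) lt (subst ✓_ (sym (trans (cong (λ c → ownedN c (place z) t) (runN-code (node z))) (owned-code (state z) (place z) t))) o))

  owned-element : ∀ σ j t → ✓ owned (run (dec σ)) j t → (∀ {t'} → t' < t → ¬ ✓ owned (run (dec σ)) j t') → ✓ isElement (element σ j t)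
  owned-element σ j t o none
    rewrite node-element σ j t | place-element σ j t | snd-pair (pair σ j) t | runN-code σ | owned-code (run (dec σ)) j t =
    ∧✓ o (not✓ λ q → let t' , lt , o' = ✓any t q in none lt (subst ✓_ (owned-code (run (dec σ)) j t') o'))

  -- The first element of the node with single entry `z`: a code above `z` that is an element from
  -- the outset, which bounds the gaps for the enumeration.
  anchor : ℕ → ℕ
  anchor z = element (cons z 0) 0 0

  anchor-state : ∀ z → run (dec (cons z 0)) ≡ block z large
  anchor-state z = cong run (dec-cons z 0)

  anchor-ok : ∀ z → ✓ isElement (anchor z)
  anchor-ok z = owned-element (cons z 0) 0 0 (subst (λ s → ✓ owned s 0 0) (sym (anchor-state z)) (<✓ (F-pos F-large))) λ ()

  anchor≥ : ∀ z → z ≤ anchor z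
  anchor≥ z = ≤-trans (pair≥₁ z 0) (≤-trans (n≤1+n _) (≤-trans (pair≥₁ (cons z 0) 0) (pair≥₁ _ 0)))

  open Enumerate isElement anchor anchor≥ anchor-ok public

  before : ℕ → ℕ → Bool
  before z z' = ltL (dec (node z)) (dec (node z')) ∨ ((node z ≡ᵇ node z') ∧ (place z <ᵇ place z'))

  abstract
    firesP : PR₃ plain (λ x w t → b2n (Fires x w t))
    firesP = firesPR pR

    runNPR : PR₁ plain runN
    runNPR = fun (foldPR (app₂ stepNPR v0 v1) (app₂ pairPR (const 0) (const 0)) v0)
      where
      stepNPR : PR₂ plain stepN
      stepNPR = fun (ifPR (zeroB (app₁ fstPR v0)) (app₂ pairPR (const 1) (app₂ pairPR v1 (app₂ pairPR (const large) (const 0))))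
        (ifPR (eqPR (app₁ fstPR v0) (const 4)) v0
        (ifPR (eqPR (app₁ fstPR v0) (const 2))
          (ifPR (app₃ firesP x w v1) (app₂ pairPR (const 3) (app₂ pairPR x (app₂ pairPR w v1))) (app₂ pairPR (const 4) (const 0)))
        (ifPR (zeroB (app₁ fstPR (app₁ fstPR v1))) (app₂ pairPR (const 1) (app₂ pairPR x (app₂ pairPR (app₁ pE (app₁ sndPR (app₁ fstPR v1))) (const 0))))
          (app₂ pairPR (const 2) (app₂ pairPR x (app₂ pairPR (app₁ sndPR (app₁ fstPR v1)) (const 0))))))))
        where
        x : PR plain {2} (λ xs → fst (snd (lookup xs zero)))
        x = app₁ fstPR (app₁ sndPR v0)
        w : PR plain {2} (λ xs → fst (snd (snd (lookup xs zero))))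
        w = app₁ fstPR (app₁ sndPR (app₁ sndPR v0))

    isElementPR : PR₁ plain (λ z → b2n (isElement z))
    isElementPR = fun (andPR (ownedP (app₁ runNPR (nodeP v0)) (placeP v0) (app₁ sndPR v0))
                            (notPR (anyPR (ownedP (app₁ runNPR (nodeP v1)) (placeP v1) v0) (app₁ sndPR v0))))
      where
      nodeP : {f : Vec ℕ m → ℕ} → PR plain f → PR plain (λ xs → node (f xs))
      nodeP p = app₁ fstPR (app₁ fstPR p)
      placeP : {f : Vec ℕ m → ℕ} → PR plain f → PR plain (λ xs → place (f xs))
      placeP p = app₁ sndPR (app₁ fstPR p)
      ownedNPR : PR₃ plain (λ c j t → b2n (ownedN c j t))
      ownedNPR = fun (ext (λ ys → sym (b2n-if (lookup ys zero) (lookup ys (suc zero)) (lookup ys (suc (suc zero)))))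
        (ifPR (eqPR (app₁ fstPR v0) (const 1)) (ltPR v1 (app₁ fstPR (app₁ sndPR (app₁ sndPR v0))))
        (ifPR (eqPR (app₁ fstPR v0) (const 2)) (ltPR v1 (const small))
        (ifPR (eqPR (app₁ fstPR v0) (const 3))
          (orPR (ltPR v1 (const (large ∸ small))) (andPR (ltPR v1 (const large)) (andPR (ltPR (app₁ sndPR (app₁ sndPR (app₁ sndPR v0))) v2)
             (app₃ firesP (app₁ fstPR (app₁ sndPR v0)) (app₁ fstPR (app₁ sndPR (app₁ sndPR v0))) v2)))) (const 0)))))
        where
        b2n-if : ∀ c j t → b2n (ownedN c j t) ≡ (if fst c ≡ᵇ 1 then b2n (j <ᵇ fst (snd (snd c)))
          else if fst c ≡ᵇ 2 then b2n (j <ᵇ small)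
          else if fst c ≡ᵇ 3 then b2n ((j <ᵇ large ∸ small) ∨ ((j <ᵇ large) ∧ (snd (snd (snd c)) <ᵇ t) ∧ Fires (fst (snd c)) (fst (snd (snd c))) t))
          else 0)
        b2n-if c j t with fst c ≡ᵇ 1 | fst c ≡ᵇ 2 | fst c ≡ᵇ 3
        ... | true  | _     | _     = refl
        ... | false | true  | _     = refl
        ... | false | false | true  = refl
        ... | false | false | false = refl
      ownedP : {c j t : Vec ℕ m → ℕ} → PR plain c → PR plain j → PR plain t → PRB plain (λ xs → ownedN (c xs) (j xs) (t xs))
      ownedP = app₃ ownedNPR

    anchorPR : PR₁ plain anchor
    anchorPR = fun (app₂ pairPR (app₂ pairPR (app₂ consPR v0 (const 0)) (const 0)) (const 0))

    elementPR : PR₃ K element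
    elementPR = fun (app₂ pairPR (app₂ pairPR v0 v1) v2)

    nthP : PR₁ K nth
    nthP = nthPR isElementPR anchorPR

    indexP : PR₁ K index
    indexP = indexPR isElementPR anchorPR

    orderP : PRB plain {2} (λ xs → before (nth (lookup xs zero)) (nth (lookup xs (suc zero))))
    orderP = compV {f = λ ys → b2n (before (lookup ys zero) (lookup ys (suc zero)))}
      (orPR (ltLPR (app₁ fstPR (app₁ fstPR v0)) (app₁ fstPR (app₁ fstPR v1)))
        (andPR (eqPR (app₁ fstPR (app₁ fstPR v0)) (app₁ fstPR (app₁ fstPR v1))) (ltPR (app₁ sndPR (app₁ fstPR v0)) (app₁ sndPR (app₁ fstPR v1)))))
      (consV (app₁ nthP v0) (consV (app₁ nthP v1) nilV))

  data Before (z z' : ℕ) : Set where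
    byNode  : dec (node z) ◁ dec (node z') → Before z z'
    byPlace : node z ≡ node z' → place z < place z' → Before z z'

  before-sound : ∀ {z z'} → ✓ before z z' → Before z z'
  before-sound {z} {z'} q with ✓∨ {ltL (dec (node z)) (dec (node z'))} q
  ... | inj₁ l = byNode (ltL-sound _ _ l)
  ... | inj₂ r = byPlace (✓≡ (proj₁ (✓∧ r))) (✓< (proj₂ (✓∧ {node z ≡ᵇ node z'} r)))

  before-complete : ∀ {z z'} → Before z z' → ✓ before z z'
  before-complete (byNode p) = ∨✓₁ (ltL-complete p)
  before-complete {z} {z'} (byPlace e p) = ∨✓₂ {ltL (dec (node z)) (dec (node z'))} (∧✓ (≡✓ e) (<✓ p))

  private
    Before-irrefl : ∀ {z} → ¬ Before z z
    Before-irrefl (byNode p) = ◁-irrefl p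
    Before-irrefl (byPlace _ p) = <-irrefl refl p

    Before-trans : ∀ {x y z} → Before x y → Before y z → Before x z
    Before-trans (byNode p) (byNode q) = byNode (◁-trans p q)
    Before-trans {x} (byNode p) (byPlace e _) = byNode (subst (λ v → dec (node x) ◁ dec v) e p)
    Before-trans {z = z} (byPlace e _) (byNode q) = byNode (subst (λ v → dec v ◁ dec (node z)) (sym e) q)
    Before-trans (byPlace e p) (byPlace e' q) = byPlace (trans e e') (<-trans p q)

    element-unique : ∀ {z z'} → ✓ isElement z → ✓ isElement z' → node z ≡ node z' → place z ≡ place z' → z ≡ z'
    element-unique {z} {z'} v v' e p = trans (sym (pair-eta z)) (trans (cong₂ pair fst-eq stamp-eq) (pair-eta z'))
      where
      fst-eq : fst z ≡ fst z'
      fst-eq = trans (sym (pair-eta (fst z))) (trans (cong₂ pair e p) (pair-eta (fst z')))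
      stamp-eq : stamp z ≡ stamp z'
      stamp-eq with <-cmp (stamp z) (stamp z')
      ... | tri≈ _ r _ = r
      ... | tri< lt _ _ = ⊥-elim (isElement-least {z'} v' lt (subst₂ (λ a b → ✓ owned (run (dec a)) b (stamp z)) e p (isElement-owned {z} v)))
      ... | tri> _ _ gt = ⊥-elim (isElement-least {z} v gt (subst₂ (λ a b → ✓ owned (run (dec a)) b (stamp z')) (sym e) (sym p) (isElement-owned {z'} v')))

    Before-total : ∀ {z z'} → ✓ isElement z → ✓ isElement z' → Before z z' ⊎ z ≡ z' ⊎ Before z' z
    Before-total {z} {z'} v v' with ◁-cmp (dec (node z)) (dec (node z'))
    ... | inj₁ p = inj₁ (byNode p)
    ... | inj₂ (inj₂ p) = inj₂ (inj₂ (byNode p))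
    ... | inj₂ (inj₁ e) with dec-inj {node z} {node z'} e | <-cmp (place z) (place z')
    ... | e' | tri< lt _ _ = inj₁ (byPlace e' lt)
    ... | e' | tri≈ _ r _  = inj₂ (inj₁ (element-unique v v' e' r))
    ... | e' | tri> _ _ gt = inj₂ (inj₂ (byPlace (sym e') gt))

  B : PunctualLO
  B = record { ordT = PR.term orderP ; isLinOrd = isStrictTotalOrderᶜ (record { isEquivalence = isEquivalence ; trans = tr ; compare = cmp }) }
    where
    _≺_ : ℕ → ℕ → Set
    i ≺ j = HoldsPR (PR.term orderP) (i ∷ j ∷ [])
    out : ∀ {i j} → i ≺ j → Before (nth i) (nth j)
    out q = before-sound (b2n-✓ (trans (sym (PR.computes orderP _)) q))
    into : ∀ {i j} → Before (nth i) (nth j) → i ≺ j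
    into b = trans (PR.computes orderP _) (✓-b2n (before-complete b))
    tr : ∀ {i j k} → i ≺ j → j ≺ k → i ≺ k
    tr p q = into (Before-trans (out p) (out q))
    cmp : ∀ i j → Tri (i ≺ j) (i ≡ j) (j ≺ i)
    cmp i j with Before-total (nth-V i) (nth-V j)
    ... | inj₁ b = tri< (into b) (λ { refl → Before-irrefl b }) (λ q → Before-irrefl (Before-trans b (out q)))
    ... | inj₂ (inj₁ e) = tri≈ (λ q → Before-irrefl (subst (λ v → Before (nth i) v) (sym e) (out q))) (nth-injective e)
                               (λ q → Before-irrefl (subst (λ v → Before v (nth i)) (sym e) (out q)))
    ... | inj₂ (inj₂ b) = tri> (λ q → Before-irrefl (Before-trans b (out q))) (λ { refl → Before-irrefl b }) (into b)

  ≺⇒Before : ∀ {i j} → _<ₒ_ B i j → Before (nth i) (nth j)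
  ≺⇒Before q = before-sound (b2n-✓ (trans (sym (PR.computes orderP _)) q))

  Before⇒≺ : ∀ {i j} → Before (nth i) (nth j) → _<ₒ_ B i j
  Before⇒≺ b = trans (PR.computes orderP _) (✓-b2n (before-complete b))

  -- The blocks reached in the limit

  -- The states that carry a block of their own in the limit. An `extra` node does so exactly when
  -- its missing elements are eventually supplied.
  Alive : State → Set
  Alive root          = ⊥
  Alive bad           = ⊥
  Alive (block x s)   = ⊤
  Alive (guess x w)   = ⊤
  Alive (extra x w k) = ∃[ t ] k < t × ✓ Fires x w t

  Last : ℕ → ℕ → ℕ → Set
  Last x w k = ✓ Fires x w k × (∀ {t} → k < t → ¬ ✓ Fires x w t)

  run-bad : ∀ σ → foldl step bad σ ≡ bad
  run-bad []      = refl
  run-bad (_ ∷ σ) = run-bad σ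

  alive≢bad : ∀ {s} → Alive s → s ≢ bad
  alive≢bad () refl

  guess-step : ∀ {x w k} → ✓ Fires x w k → step (guess x w) k ≡ extra x w k
  guess-step f rewrite f = refl

  guess-stop : ∀ {x w k} → ¬ ✓ Fires x w k → step (guess x w) k ≡ bad
  guess-stop nf rewrite ✗false nf = refl

  run-child : ∀ {ρ k x w} → run ρ ≡ guess x w → ✓ Fires x w k → run (ρ ∷ʳ k) ≡ extra x w k
  run-child {ρ} {k} e f = trans (run-∷ʳ ρ k) (trans (cong (λ s → step s k) e) (guess-step f))

  child≢extra : ∀ {x k x' w k'} → child x k ≢ extra x' w k'
  child≢extra {x} {k} e with fst (fst k) ≡ᵇ 0
  child≢extra {x} {k} () | true
  child≢extra {x} {k} () | false

  run-extra : ∀ σ {x w k} → run σ ≡ extra x w k → ∃[ ρ ] σ ≡ ρ ∷ʳ k × run ρ ≡ guess x w × ✓ Fires x w k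
  run-extra σ e with initLast σ
  run-extra .[] () | []
  run-extra .(ρ ∷ʳ k') {x} {w} {k} e | ρ ∷ʳ′ k' with run ρ in eρ | trans (sym (run-∷ʳ ρ k')) e
  ... | block _ _   | e' = ⊥-elim (child≢extra e')
  ... | extra _ _ _ | e' = ⊥-elim (child≢extra e')
  ... | guess x' w' | e' with Fires x' w' k' in f
  run-extra .(ρ ∷ʳ k') e | ρ ∷ʳ′ k' | guess x' w' | refl | true = ρ , refl , eρ , f

  -- The final position of place `j` of node σ. Elements of an uncompleted last child belong to the
  -- guess ρ above it and come after its own `small` elements, hence the shift.
  data Locates (σ : List ℕ) (j : ℕ) : List ℕ → ℕ → Set where
    own  : Alive (run σ) → Locates σ j σ j
    left : ∀ {ρ k x w} → σ ≡ ρ ∷ʳ k → run ρ ≡ guess x w → Last x w k → Locates σ j ρ (small + j)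

  locate : ∀ σ j t → ✓ owned (run σ) j t → ∃₂ (Locates σ j)
  locate σ j t o with run σ in e
  locate σ j t () | root
  locate σ j t () | bad
  ... | block _ _ = σ , j , own (subst Alive (sym e) tt)
  ... | guess _ _ = σ , j , own (subst Alive (sym e) tt)
  ... | extra x w k with em {∃[ t ] k < t × ✓ Fires x w t} | run-extra σ e
  ... | yes a | _ = σ , j , own (subst Alive (sym e) a)
  ... | no na | ρ , σe , ρe , f = ρ , small + j , left σe ρe (f , λ lt f' → na (_ , lt , f'))

  last-not-alive : ∀ {ρ k x w} → run ρ ≡ guess x w → Last x w k → ¬ Alive (run (ρ ∷ʳ k))
  last-not-alive {ρ} {k} {x} {w} e (f , none) a with subst Alive (run-child {ρ} e f) a
  ... | t , lt , f' = none lt f'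

  Locates-unique : ∀ {σ j p i p' i'} → Locates σ j p i → Locates σ j p' i' → p ≡ p' × i ≡ i'
  Locates-unique (own _) (own _) = refl , refl
  Locates-unique (own a) (left {ρ} refl e l) = ⊥-elim (last-not-alive {ρ} e l a)
  Locates-unique (left {ρ} refl e l) (own a) = ⊥-elim (last-not-alive {ρ} e l a)
  Locates-unique (left {ρ} refl _ _) (left {ρ'} e _ _) = proj₁ (∷ʳ-injective ρ ρ' e) , refl

  path : ℕ → List ℕ
  path i = dec (node (nth i))

  offset : ℕ → ℕ
  offset i = place (nth i)

  private
    owns : ∀ i → ✓ owned (run (path i)) (offset i) (stamp (nth i))
    owns i = isElement-owned (nth-V i)

  abstract
    point : ℕ → List ℕ
    point i = proj₁ (locate (path i) (offset i) (stamp (nth i)) (owns i))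

    pos : ℕ → ℕ
    pos i = proj₁ (proj₂ (locate (path i) (offset i) (stamp (nth i)) (owns i)))

    located : ∀ i → Locates (path i) (offset i) (point i) (pos i)
    located i = proj₂ (proj₂ (locate (path i) (offset i) (stamp (nth i)) (owns i)))

  guessSize : ∀ {x w} → Dec (Infinite x w) → ℕ
  guessSize (yes _) = small
  guessSize (no _)  = large

  sizeOf : State → ℕ
  sizeOf root          = 0
  sizeOf bad           = 0
  sizeOf (block x s)   = s
  sizeOf (guess x w)   = guessSize {x} {w} em
  sizeOf (extra x w k) = large

  finite-large : ∀ {x w} → ¬ Infinite x w → sizeOf (guess x w) ≡ large
  finite-large {x} {w} ninf with em {Infinite x w}
  ... | yes i = ⊥-elim (ninf i)
  ... | no _  = refl

  infinite-small : ∀ {x w} → Infinite x w → sizeOf (guess x w) ≡ small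
  infinite-small {x} {w} inf with em {Infinite x w}
  ... | yes _ = refl
  ... | no ni = ⊥-elim (ni inf)

  Last⇒¬Infinite : ∀ {x w k} → Last x w k → ¬ Infinite x w
  Last⇒¬Infinite {k = k} (_ , none) inf with inf (suc k)
  ... | t , lt , f = none lt f

  lastFiring : ∀ {x w} → ¬ Infinite x w → ∃[ k ] Last x w k
  lastFiring {x} {w} ninf with ¬∀⇒∃¬ ninf
  -- Stage 0 fires by convention, so there is a firing stage to begin with and every finite guess
  -- has a last child.
  ... | N , h = greatest (λ t → ✓ Fires x w t) (0 , refl) N λ le f → h (_ , le , f)

  -- a position before the last child of a finite guess is at or before the guess itself
  squeeze : ∀ s σ ρ {x w k} → foldl step s ρ ≡ guess x w → (∀ {t} → k < t → ¬ ✓ Fires x w t) → foldl step s σ ≢ bad →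
            σ ◁ ρ ∷ʳ k → σ ≡ ρ ⊎ σ ◁ ρ
  squeeze s [] [] e none nb prefix = inj₁ refl
  squeeze .(guess _ _) (k' ∷ σ) [] refl none nb (differ lt) =
    ⊥-elim (nb (trans (cong (λ s → foldl step s σ) (guess-stop (none lt))) (run-bad σ)))
  squeeze s (k' ∷ σ) [] e none nb (same ())
  squeeze s σ (r ∷ ρ) e none nb prefix = inj₂ prefix
  squeeze s σ (r ∷ ρ) e none nb (differ lt) = inj₂ (differ lt)
  squeeze s (_ ∷ σ) (r ∷ ρ) e none nb (same p) with squeeze (step s r) σ ρ e none nb p
  ... | inj₁ refl = inj₁ refl
  ... | inj₂ q = inj₂ (same q)

  -- A node strictly between a guess and its child at the last firing stage `k` passes through an
  -- entry larger than `k`; that stage does not fire, so the node is `bad`. The start state `s` is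
  -- general for the sake of the induction.
  jump : ∀ s σ τ {x w k} → foldl step s σ ≡ guess x w → (∀ {t} → k < t → ¬ ✓ Fires x w t) → foldl step s τ ≢ bad →
         σ ◁ τ → σ ∷ʳ k ≡ τ ⊎ σ ∷ʳ k ◁ τ
  jump .(guess _ _) [] (k' ∷ τ) {k = k} refl none nb prefix with <-cmp k k'
  ... | tri< lt _ _ = ⊥-elim (nb (trans (cong (λ s → foldl step s τ) (guess-stop (none lt))) (run-bad τ)))
  ... | tri> _ _ gt = inj₂ (differ gt)
  jump .(guess _ _) [] (k' ∷ [])    refl none nb prefix | tri≈ _ refl _ = inj₁ refl
  jump .(guess _ _) [] (k' ∷ _ ∷ _) refl none nb prefix | tri≈ _ refl _ = inj₂ (same prefix)
  jump s σ τ e none nb (differ lt) = inj₂ (differ lt)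
  jump s (r ∷ σ) (_ ∷ τ) e none nb (same p) with jump (step s r) σ τ e none nb p
  ... | inj₁ refl = inj₁ refl
  ... | inj₂ q = inj₂ (same q)

  Proper : State → Set
  Proper (block x s) = F s × s ≢ small
  Proper _           = ⊤

  large≢small : large ≢ small
  large≢small e = <-irrefl (sym e) small<large

  child-proper : ∀ x k → Proper (child x k)
  child-proper x k with fst (fst k) ≡ᵇ 0
  ... | true  = E-F (snd (fst k)) , E≢ (snd (fst k))
  ... | false = tt

  proper : ∀ s σ → Proper s → Proper (foldl step s σ)
  proper s [] p = p
  proper s (k ∷ σ) p = proper (step s k) σ (go s)
    where
    go : ∀ s → Proper (step s k)
    go root          = F-large , large≢small
    go bad           = tt
    go (block x s)   = child-proper x k
    go (extra x w j) = child-proper x k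
    go (guess x w) with Fires x w k
    ... | true  = tt
    ... | false = tt

  InRegion : ℕ → State → Set
  InRegion x root           = ⊥
  InRegion x bad            = ⊤
  InRegion x (block x' s)   = x' ≡ x
  InRegion x (guess x' w)   = x' ≡ x
  InRegion x (extra x' w k) = x' ≡ x

  child-region : ∀ x k → InRegion x (child x k)
  child-region x k with fst (fst k) ≡ᵇ 0
  ... | true  = refl
  ... | false = refl

  region : ∀ {x} s σ → InRegion x s → InRegion x (foldl step s σ)
  region s [] p = p
  region {x} s (k ∷ σ) p = region (step s k) σ (go s p)
    where
    go : ∀ s → InRegion x s → InRegion x (step s k)
    go bad           p = tt
    go (block x s)   refl = child-region x k
    go (extra x w j) refl = child-region x k
    go (guess x w) refl with Fires x w k
    ... | true  = refl
    ... | false = tt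

  alive-size : ∀ {s} → Proper s → Alive s → F (sizeOf s)
  alive-size {block x s} p a = proj₁ p
  alive-size {extra x w k} p a = F-large
  alive-size {guess x w} p a with em {Infinite x w}
  ... | yes _ = F-small
  ... | no _  = F-large

  blockEntry guessEntry : ℕ → ℕ → ℕ
  blockEntry e N = pair (pair 0 e) N
  guessEntry w N = pair (pair 1 w) N

  child-block : ∀ x e N → child x (blockEntry e N) ≡ block x (E e)
  child-block x e N rewrite fst-pair (pair 0 e) N | fst-pair 0 e | snd-pair 0 e = refl

  child-guess : ∀ x w N → child x (guessEntry w N) ≡ guess x w
  child-guess x w N rewrite fst-pair (pair 1 w) N | fst-pair 1 w | snd-pair 1 w = refl

  -- Size `small` is obtained only through a guess that is true, which totality provides; all other
  -- sizes come from `E`. The padding `N` makes the entry large.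
  childOfSize : ∀ x N {s} → F s → ∃[ k ] N ≤ k × Alive (child x k) × sizeOf (child x k) ≡ s
  childOfSize x N {s} fs with s ≟ small
  ... | no ne = let e , Ee = E-onto fs ne in
    blockEntry e N , pair≥₂ _ N , subst Alive (sym (child-block x e N)) tt , trans (cong sizeOf (child-block x e N)) Ee
  ... | yes refl = let w , t = total x in
    guessEntry w N , pair≥₂ _ N , subst Alive (sym (child-guess x w N)) tt ,
    trans (cong sizeOf (child-guess x w N)) (infinite-small (True⇒Infinite x w t))

  Open : ℕ → State → Set
  Open x s = ∀ k → step s k ≡ child x k

  -- an open node whose late children lie immediately to the right of the block at σ
  landing : ∀ σ N → Alive (run σ) → ∃₂ λ ρ x → Open x (run ρ) × (∀ k → σ ◁ ρ ∷ʳ k) ×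
            (∀ {τ k} → Alive (run τ) → σ ◁ τ → (∀ {e} → e ∈ τ → e < N) → N ≤ k → ρ ∷ʳ k ◁ τ)
  landing σ N a with run σ in e
  ... | block x s = σ , x , (λ k → cong (λ s → step s k) e) , (λ k → ◁-++ σ k []) , λ _ lt b le → ◁-close lt b [] le
  ... | extra x w j = σ , x , (λ k → cong (λ s → step s k) e) , (λ k → ◁-++ σ k []) , λ _ lt b le → ◁-close lt b [] le
  ... | guess x w with em {Infinite x w}
  -- A firing child beyond `N` is so close to the guess that everything below it still precedes τ,
  -- and as an `extra` node it is open.
  ... | yes inf = let j , N≤j , f = inf N in
        σ ∷ʳ j , x , (λ k → cong (λ s → step s k) (run-child {σ} e f)) ,
        (λ k → subst (σ ◁_) (sym (++-assoc σ (j ∷ []) (k ∷ []))) (◁-++ σ j (k ∷ []))) ,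
        λ {τ} {k} _ lt b le → subst (_◁ τ) (sym (++-assoc σ (j ∷ []) (k ∷ []))) (◁-close lt b (k ∷ []) N≤j)
  -- The block ends with the elements of the last child. That child is open although it is not
  -- alive, so new blocks can follow it directly.
  ... | no ninf with lastFiring ninf
  ... | j , last@(f , none) =
        σ ∷ʳ j , x , (λ k → cong (λ s → step s k) (run-child {σ} e f)) ,
        (λ k → subst (σ ◁_) (sym (++-assoc σ (j ∷ []) (k ∷ []))) (◁-++ σ j (k ∷ []))) , close
    where
    close : ∀ {τ k} → Alive (run τ) → σ ◁ τ → (∀ {e} → e ∈ τ → e < N) → N ≤ k → (σ ∷ʳ j) ∷ʳ k ◁ τ
    close {τ} aτ lt b le with jump root σ τ e none (alive≢bad aτ) lt
    ... | inj₁ refl = ⊥-elim (last-not-alive {σ} e last aτ)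
    ... | inj₂ q = ◁-close q b [] le

  private
    beside : ∀ σ N {s} → Alive (run σ) → F s → ∃[ r ] Alive (run r) × sizeOf (run r) ≡ s × σ ◁ r ×
             (∀ {τ} → Alive (run τ) → σ ◁ τ → (∀ {e} → e ∈ τ → e < N) → r ◁ τ)
    beside σ N a fs with landing σ N a
    ... | ρ , x , open' , after , close with childOfSize x N fs
    ... | k , N≤k , ac , sc = ρ ∷ʳ k , subst Alive (sym rk) ac , trans (cong sizeOf rk) sc , after k ,
          λ aτ lt b → close aτ lt b N≤k
      where
      rk : run (ρ ∷ʳ k) ≡ child x k
      rk = trans (run-∷ʳ ρ k) (open' k)

    lower : ∀ σ {s} → Alive (run σ) → F s → ∃[ r ] Alive (run r) × sizeOf (run r) ≡ s × r ◁ σ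
    lower (x ∷ σ) a fs with childOfSize (suc x) 0 fs
    -- A larger first entry comes earlier, so the next region lies to the left.
    ... | k , _ , ac , sc = suc x ∷ k ∷ [] , ac , sc , differ (n<1+n x)

    present : ∀ σ j t → ✓ owned (run σ) j t → ∃[ i ] path i ≡ σ × offset i ≡ j
    present σ j t o with least (λ t → ✓ owned (run σ) j t) (t , o)
    ... | t₀ , o₀ , none = index z , trans (cong (dec ∘ node) zi) (trans (cong dec (node-element (enc σ) j t₀)) (dec-enc σ)) ,
                           trans (cong place zi) (place-element (enc σ) j t₀)
      where
      z : ℕ
      z = element (enc σ) j t₀
      de : ∀ t → owned (run (dec (enc σ))) j t ≡ owned (run σ) j t
      de t = cong (λ τ → owned (run τ) j t) (dec-enc σ)
      zi : nth (index z) ≡ z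
      zi = nth-index (owned-element (enc σ) j t₀ (subst ✓_ (sym (de t₀)) o₀) λ lt o → none lt (subst ✓_ (de _) o))

    place-at : ∀ {σ j p i} t → ✓ owned (run σ) j t → Locates σ j p i → ∃[ n ] point n ≡ p × pos n ≡ i
    place-at {σ} {j} {p} {i} t o l with present σ j t o
    ... | n , refl , refl = n , Locates-unique (located n) l

    elementAt : ∀ {σ i} s → run σ ≡ s → Alive s → i < sizeOf s → ∃[ n ] point n ≡ σ × pos n ≡ i
    elementAt (block x s) e a lt = place-at 0 (subst (λ s → ✓ owned s _ 0) (sym e) (<✓ lt)) (own (subst Alive (sym e) a))
    elementAt {σ} {i} (extra x w k) e a@(t , k<t , f) lt = place-at t
      (subst (λ s → ✓ owned s i t) (sym e) (∨✓₂ {i <ᵇ large ∸ small} (∧✓ (<✓ lt) (∧✓ (<✓ k<t) f)))) (own (subst Alive (sym e) a))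
    elementAt {σ} {i} (guess x w) e a lt with i <? small
    ... | yes i<s = place-at 0 (subst (λ s → ✓ owned s i 0) (sym e) (<✓ i<s)) (own (subst Alive (sym e) a))
    ... | no i≮s with em {Infinite x w}
    ... | yes _ = ⊥-elim (i≮s lt)
    ... | no ninf with lastFiring ninf
    -- The places from `small` on of a finite guess are held by its last child, renumbered from 0.
    ... | k , last@(f , _) with place-at {σ ∷ʳ k} {i ∸ small} 0
            (subst (λ s → ✓ owned s (i ∸ small) 0) (sym (run-child {σ} e f)) (∨✓₁ (<✓ (∸-monoˡ-< lt (≮⇒≥ i≮s))))) (left refl e last)
    ... | n , pe , ie = n , pe , trans ie (m+[n∸m]≡n (≮⇒≥ i≮s))

    point-alive : ∀ i → Alive (run (point i))
    point-alive i = go (located i)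
      where
      go : ∀ {p k} → Locates (path i) (offset i) p k → Alive (run p)
      go (own a) = a
      go (left _ e _) = subst Alive (sym e) tt

    pos-ok : ∀ i → pos i < sizeOf (run (point i))
    pos-ok i = go (located i) (owns i)
      where
      go : ∀ {σ j p k t} → Locates σ j p k → ✓ owned (run σ) j t → k < sizeOf (run p)
      go {σ} {j} {t = t} (own a) o with run σ
      ... | block x s = ✓< o
      ... | guess x w with em {Infinite x w}
      ... | yes _ = ✓< o
      ... | no _  = <-trans (✓< o) small<large
      go {σ} {j} {t = t} (own a) o | extra x w k with ✓∨ {j <ᵇ large ∸ small} o
      ... | inj₁ q = <-≤-trans (✓< q) (m∸n≤m large small)
      ... | inj₂ q = ✓< (proj₁ (✓∧ q))
      go {j = j} {t = t} (left {ρ} {k} {x} {w} refl e last@(f , none)) o =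
        subst (small + j <_) (trans (sym (finite-large (Last⇒¬Infinite last))) (cong sizeOf (sym e)))
          (subst (small + j <_) (m+[n∸m]≡n (<⇒≤ small<large)) (+-monoʳ-< small j<))
        where
        j< : j < large ∸ small
        j< with ✓∨ {j <ᵇ large ∸ small} (subst (λ s → ✓ owned s j t) (run-child {ρ} e f) o)
        ... | inj₁ q = ✓< q
        ... | inj₂ q with ✓∧ {k <ᵇ t} (proj₂ (✓∧ {j <ᵇ large} q))
        ... | k<t , f' = ⊥-elim (none (✓< {k} {t} k<t) f')

    guess-offset : ∀ {σ j t x w} → run σ ≡ guess x w → ✓ owned (run σ) j t → j < small
    guess-offset {j = j} {t} e o = ✓< (subst (λ s → ✓ owned s j t) e o)

    -- Relocating the elements of a last child to its guess moves them to the left; by `squeeze`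
    -- only `bad` nodes are passed on the way, so no other element is overtaken. If σ is the guess
    -- itself, its own places are below `small` and remain in front.
    ordered-path : ∀ {σ τ j j' p q k k' t} → Locates σ j p k → Locates τ j' q k' → ✓ owned (run σ) j t → σ ◁ τ →
                   p ◁ q ⊎ (p ≡ q × k < k')
    ordered-path (own _) (own _) o lt = inj₁ lt
    ordered-path {σ} (left {ρ} {k} refl _ _) (own _) o lt = inj₁ (◁-trans (◁-++ ρ k []) lt)
    ordered-path {σ} {j' = j'} {t = t} (own a) (left {ρ} refl e (_ , none)) o lt with squeeze root σ ρ e none (alive≢bad a) lt
    ... | inj₂ q = inj₁ q
    ... | inj₁ refl = inj₂ (refl , <-≤-trans (guess-offset {ρ} {t = t} e o) (m≤m+n small j'))
    ordered-path {σ} (left {ρ} {k} refl e (f , _)) (left {ρ'} refl e' (_ , none)) o lt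
      with squeeze root (ρ ∷ʳ k) ρ' e' none (λ b → extra≢bad (trans (sym (run-child {ρ} e f)) b)) lt
      where
      extra≢bad : ∀ {x w k} → extra x w k ≢ bad
      extra≢bad ()
    ... | inj₂ q = inj₁ (◁-trans (◁-++ ρ k []) q)
    ... | inj₁ refl with trans (sym (run-child {ρ} e f)) e'
    ... | ()

    ordered-place : ∀ {σ j j' p q k k'} → Locates σ j p k → Locates σ j' q k' → j < j' → p ≡ q × k < k'
    ordered-place (own _) (own _) lt = refl , lt
    ordered-place (own a) (left {ρ} refl e l) lt = ⊥-elim (last-not-alive {ρ} e l a)
    ordered-place (left {ρ} refl e l) (own a) lt = ⊥-elim (last-not-alive {ρ} e l a)
    ordered-place (left {ρ} refl _ _) (left {ρ'} e _ _) lt = proj₁ (∷ʳ-injective ρ ρ' e) , +-monoʳ-< small lt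

    ordered : ∀ {i j} → _<ₒ_ B i j → point i ◁ point j ⊎ (point i ≡ point j × pos i < pos j)
    ordered {i} {j} q with ≺⇒Before {i} {j} q
    ... | byNode lt = ordered-path {t = stamp (nth i)} (located i) (located j) (owns i) lt
    ... | byPlace e lt = inj₂ (ordered-place (subst (λ σ → Locates (dec σ) (offset i) (point i) (pos i)) e (located i)) (located j) lt)

  presentation : Presentation F B
  presentation = record
    { P = List ℕ ; _<P_ = _◁_ ; <P-irrefl = ◁-irrefl ; <P-trans = ◁-trans
    ; Point = λ σ → Alive (run σ) ; size = λ σ → sizeOf (run σ) ; point = point ; index = pos
    ; point-ok = point-alive ; index-ok = pos-ok
    ; size-F = λ {σ} a → alive-size (proper root σ tt) a
    ; element = λ a lt → elementAt _ refl a lt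
    ; ordered = ordered
    ; dense = λ {p} {q} ap aq lt fs → let r , ar , sr , p<r , close = beside p (enc q) ap fs in r , ar , sr , p<r , close aq lt ∈≤enc
    ; lower = λ {p} ap fs → lower p ap fs
    ; upper = λ {p} ap fs → let r , ar , sr , p<r , _ = beside p 0 ap fs in r , ar , sr , p<r }

  -- Blocks avoid size `small` by the choice of `E`, completed `extra` nodes have size `large`, and
  -- so do guesses that fire only finitely often. What is left is a guess confirmed infinitely
  -- often.
  small⇒true : ∀ i → sizeOf (run (point i)) ≡ small → ∃₂ λ x w → run (path i) ≡ guess x w × True x w
  small⇒true i = go (located i) (owns i)
    where
    go : ∀ {σ j p k t} → Locates σ j p k → ✓ owned (run σ) j t → sizeOf (run p) ≡ small → ∃₂ λ x w → run σ ≡ guess x w × True x w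
    go {σ} (own a) o e with run σ in eσ
    ... | block x s = ⊥-elim (proj₂ (subst Proper eσ (proper root σ tt)) e)
    ... | extra x w k = ⊥-elim (large≢small e)
    ... | guess x w with em {Infinite x w}
    ... | yes inf = x , w , refl , Infinite⇒True x w inf
    ... | no _ = ⊥-elim (large≢small e)
    go (left refl eρ last) o e = ⊥-elim (large≢small (trans (sym (finite-large (Last⇒¬Infinite last))) (trans (cong sizeOf (sym eρ)) e)))

  -- Markers of regions and reading off a guess

  initial : ∀ σ → ✓ owned (run (dec σ)) 0 0 → nth (index (element σ 0 0)) ≡ element σ 0 0
  initial σ o = nth-index (owned-element σ 0 0 o λ ())

  -- Two markers inside region `x`: the first elements of the node with single entry `x` and of one
  -- of its children. Any node between a node and its child extends the former, so its first entry
  -- is `x`.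
  low high : ℕ → ℕ
  low x  = index (element (cons x 0) 0 0)
  high x = index (element (cons x (cons (blockEntry 0 0) 0)) 0 0)

  private
    high-state : ∀ x → run (dec (cons x (cons (blockEntry 0 0) 0))) ≡ block x (E 0)
    high-state x = trans (cong run (dec-enc (x ∷ blockEntry 0 0 ∷ []))) (child-block x 0 0)

    low-code : ∀ x → nth (low x) ≡ element (cons x 0) 0 0
    low-code x = initial (cons x 0) (subst (λ s → ✓ owned s 0 0) (sym (anchor-state x)) (<✓ (F-pos F-large)))

    high-code : ∀ x → nth (high x) ≡ element (cons x (cons (blockEntry 0 0) 0)) 0 0
    high-code x = initial _ (subst (λ s → ✓ owned s 0 0) (sym (high-state x)) (<✓ (F-pos (E-F 0))))

    low-path : ∀ x → path (low x) ≡ x ∷ []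
    low-path x = trans (cong (dec ∘ node) (low-code x)) (trans (cong dec (node-element _ 0 0)) (dec-enc (x ∷ [])))

    high-path : ∀ x → path (high x) ≡ x ∷ blockEntry 0 0 ∷ []
    high-path x = trans (cong (dec ∘ node) (high-code x)) (trans (cong dec (node-element _ 0 0)) (dec-enc (x ∷ blockEntry 0 0 ∷ [])))

  low≺high : ∀ x → _<ₒ_ B (low x) (high x)
  low≺high x = Before⇒≺ {low x} {high x} (byNode (subst₂ _◁_ (sym (low-path x)) (sym (high-path x)) (same prefix)))

  high-pos : ∀ x → pos (high x) ≡ 0
  high-pos x = trans (proj₂ (Locates-unique (located (high x)) (own (subst Alive (sym st) tt)))) off
    where
    st : run (path (high x)) ≡ block x (E 0)
    st = trans (cong run (high-path x)) (child-block x 0 0)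
    off : offset (high x) ≡ 0
    off = trans (cong place (high-code x)) (place-element _ 0 0)

  between-region : ∀ {x z} → _<ₒ_ B (low x) z → _<ₒ_ B z (high x) → InRegion x (run (path z))
  between-region {x} {z} p q = go (path z) (lower-bound (≺⇒Before {low x} {z} p)) (upper-bound (≺⇒Before {z} {high x} q))
    where
    lower-bound : Before (nth (low x)) (nth z) → x ∷ [] ◁ path z ⊎ x ∷ [] ≡ path z
    lower-bound (byNode lt) = inj₁ (subst (_◁ path z) (low-path x) lt)
    lower-bound (byPlace e _) = inj₂ (trans (sym (low-path x)) (cong dec e))
    upper-bound : Before (nth z) (nth (high x)) → path z ◁ x ∷ blockEntry 0 0 ∷ [] ⊎ path z ≡ x ∷ blockEntry 0 0 ∷ []
    upper-bound (byNode lt) = inj₁ (subst (path z ◁_) (high-path x) lt)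
    upper-bound (byPlace e _) = inj₂ (trans (cong dec e) (high-path x))
    go : ∀ σ → x ∷ [] ◁ σ ⊎ x ∷ [] ≡ σ → σ ◁ x ∷ blockEntry 0 0 ∷ [] ⊎ σ ≡ x ∷ blockEntry 0 0 ∷ [] → InRegion x (run σ)
    go (_ ∷ σ) (inj₂ refl) _ = region (block x large) σ refl
    go (_ ∷ σ) (inj₁ (same _)) _ = region (block x large) σ refl
    go (_ ∷ σ) (inj₁ (differ lt)) (inj₁ (differ gt)) = ⊥-elim (<-asym lt gt)
    go (_ ∷ σ) (inj₁ (differ lt)) (inj₁ (same _)) = ⊥-elim (<-irrefl refl lt)
    go (_ ∷ σ) (inj₁ (differ lt)) (inj₂ refl) = ⊥-elim (<-irrefl refl lt)

  -- On an element of a guess node this projects the guess out of the state code; the node is read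
  -- off the element without search.
  guessOf : ℕ → ℕ
  guessOf z = fst (snd (snd (runN (node (nth z)))))

  guessOf-guess : ∀ {z x w} → run (path z) ≡ guess x w → guessOf z ≡ w
  guessOf-guess {z} {x} {w} e = trans (cong (λ c → fst (snd (snd c))) (trans (runN-code (node (nth z))) (cong stateCode e)))
    (trans (cong (λ c → fst (snd c)) (snd-pair 2 (pair x (pair w 0)))) (trans (cong fst (snd-pair x (pair w 0))) (fst-pair w 0)))

  guessOf-true : ∀ {x z} → _<ₒ_ B (low x) z → _<ₒ_ B z (high x) → sizeOf (run (point z)) ≡ small → True x (guessOf z)
  guessOf-true {x} {z} p q e with small⇒true z e
  ... | x' , w , eq , t with subst (InRegion x) eq (between-region {x} {z} p q)
  ... | refl = subst (True x) (sym (guessOf-guess {z} eq)) t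

  -- Two entries are appended because the node of `u` may itself be a guess: then the first one is
  -- taken as a firing stage, otherwise it creates a block. Either way an open node results, in
  -- which the second entry creates a guess. The padding `node (nth v)` exceeds all entries of the
  -- node of `v` and keeps the result to its left.
  middle : ℕ → ℕ → ℕ
  middle u v = index (element (snoc (snoc (node (nth u)) (blockEntry 0 (node (nth v)))) (guessEntry 0 (node (nth v)))) 0 0)

  -- When every guess is true, the block of a guess always has size small, so no search is needed.
  module AllTrue (R-true : ∀ x w b c → ✓ R x w b c) where

    private
      fires : ∀ x w t → ✓ Fires x w t
      fires x w zero    = refl
      fires x w (suc t) = ∨✓₁ (R-true x w _ t)

      infinite : ∀ {x w} → Infinite x w
      infinite {x} {w} N = N , ≤-refl , fires x w N

      pos-offset : ∀ i → pos i ≡ offset i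
      pos-offset i = go (located i)
        where
        go : ∀ {σ j p k} → Locates σ j p k → k ≡ j
        go (own _) = refl
        go (left {k = k} {x} {w} _ _ (_ , none)) = ⊥-elim (none (n<1+n k) (fires x w (suc k)))

    middle-ok : ∀ {u v} → _<ₒ_ B u v → pos v ≡ 0 →
                _<ₒ_ B u (middle u v) × _<ₒ_ B (middle u v) v × sizeOf (run (point (middle u v))) ≡ small
    middle-ok {u} {v} u≺v v0 =
      Before⇒≺ {u} {c} (byNode (subst (path u ◁_) (sym c-path) (subst (path u ◁_) (sym (++-assoc (path u) _ _)) (◁-++ (path u) k₁ (k₂ ∷ []))))) ,
      Before⇒≺ {c} {v} (byNode (subst (_◁ path v) (sym c-path) (subst (_◁ path v) (sym (++-assoc (path u) _ _)) (◁-close u◁v bound (k₂ ∷ []) (pair≥₂ _ N))))) ,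
      trans (cong (sizeOf ∘ run) c-point) (trans (cong sizeOf (proj₂ c-state)) (infinite-small infinite))
      where
      N k₁ k₂ c : ℕ
      N = node (nth v)
      k₁ = blockEntry 0 N
      k₂ = guessEntry 0 N
      c = middle u v
      c-node : dec (snoc (snoc (node (nth u)) k₁) k₂) ≡ (path u ∷ʳ k₁) ∷ʳ k₂
      c-node = trans (dec-snoc _ k₂) (cong (_∷ʳ k₂) (dec-snoc (node (nth u)) k₁))
      guess-below : ∀ s {j t} → ✓ owned s j t → ∃[ x ] step (step s k₁) k₂ ≡ guess x 0
      guess-below (block x s) o = x , trans (cong (λ s → step s k₂) (child-block x 0 N)) (child-guess x 0 N)
      guess-below (extra x w k) o = x , trans (cong (λ s → step s k₂) (child-block x 0 N)) (child-guess x 0 N)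
      guess-below (guess x w) o = x , trans (cong (λ s → step s k₂) (guess-step {x} {w} {k₁} (fires x w k₁))) (child-guess x 0 N)
      state-below : ∃[ x ] run ((path u ∷ʳ k₁) ∷ʳ k₂) ≡ guess x 0
      state-below with guess-below (run (path u)) (owns u)
      ... | x , e = x , trans (run-∷ʳ (path u ∷ʳ k₁) k₂) (trans (cong (λ s → step s k₂) (run-∷ʳ (path u) k₁)) e)
      c-code : nth c ≡ element (snoc (snoc (node (nth u)) k₁) k₂) 0 0
      c-code = initial _ (subst (λ s → ✓ owned s 0 0) (sym (trans (cong run c-node) (proj₂ state-below))) (<✓ (F-pos F-small)))
      c-path : path c ≡ (path u ∷ʳ k₁) ∷ʳ k₂
      c-path = trans (cong (dec ∘ node) c-code) (trans (cong dec (node-element _ 0 0)) c-node)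
      c-state : ∃[ x ] run (path c) ≡ guess x 0
      c-state = proj₁ state-below , trans (cong run c-path) (proj₂ state-below)
      c-point : point c ≡ path c
      c-point = proj₁ (Locates-unique (located c) (own (subst Alive (sym (proj₂ c-state)) tt)))
      u◁v : path u ◁ path v
      u◁v with ≺⇒Before {u} {v} u≺v
      ... | byNode lt = lt
      -- When all stages fire no element is relocated, so `v` has offset 0 and no smaller element
      -- shares its node.
      ... | byPlace _ lt with subst (offset u <_) (trans (sym (pos-offset v)) v0) lt
      ... | ()
      bound : ∀ {x} → x ∈ path v → x < N
      bound {x} m = subst (x <_) (enc-dec N) (∈≤enc m)

  module _ {K : Class} where
    abstract
      private
        nodeAt : {f : Vec ℕ m → ℕ} → PR K f → PR K (λ xs → node (nth (f xs)))
        nodeAt p = app₁ fstPR (app₁ fstPR (app₁ nthP p))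

      guessOfPR : PR₁ K guessOf
      guessOfPR = fun (app₁ fstPR (app₁ sndPR (app₁ sndPR (app₁ runNPR' (nodeAt v0)))))
        where
        runNPR' : PR₁ K runN
        runNPR' = fun (lift (PR₁.body runNPR))

      lowPR : PR₁ K low
      lowPR = fun (app₁ indexP (app₃ elementPR (app₂ consPR v0 (const 0)) (const 0) (const 0)))

      highPR : PR₁ K high
      highPR = fun (app₁ indexP (app₃ elementPR (app₂ consPR v0 (const (cons (blockEntry 0 0) 0))) (const 0) (const 0)))

      middlePR : PR₂ K middle
      middlePR = fun (app₁ indexP (app₃ elementPR
        (app₂ snocPR (app₂ snocPR (nodeAt v0) (app₂ pairPR (const (pair 0 0)) (nodeAt v1))) (app₂ pairPR (const (pair 1 0)) (nodeAt v1)))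
        (const 0) (const 0)))

-- The two inclusions

≤PR⇒PR₁ : ∀ {f g} → f ≤PR g → PR₁ (relativeTo g) f
≤PR⇒PR₁ (t , e) = fun (t by λ { (x ∷ []) → e x })

PR₁⇒≤PR : ∀ {f g} → PR₁ (relativeTo g) f → f ≤PR g
PR₁⇒≤PR (fun (t by e)) = t , λ x → e (x ∷ [])

inverse : ∀ {A B} → LOIso A B → LOIso B A
inverse {A} {B} f = record
  { bij = mk↔ₛ′ from to strictlyInverseʳ strictlyInverseˡ
  ; preserves = λ x y → mk⇔
      (λ p → Equivalence.from (preserves (from x) (from y)) (subst₂ (_<ₒ_ B) (sym (strictlyInverseˡ x)) (sym (strictlyInverseˡ y)) p))
      (λ p → subst₂ (_<ₒ_ B) (strictlyInverseˡ x) (strictlyInverseˡ y) (Equivalence.to (preserves (from x) (from y)) p)) }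
  where
  open LOIso f
  open Inverse bij using (strictlyInverseˡ; strictlyInverseʳ)

-- Allows a block size known in one copy to be used in another, after its presentation has been
-- transported along an isomorphism.
size-unique : ∀ {F A} → (∀ {s} → F s → 1 ≤ s) → (p q : Presentation F A) → ∀ x →
              Presentation.size p (Presentation.point p x) ≡ Presentation.size q (Presentation.point q x)
size-unique F-pos p q x with Shuffled.blockOf (FromPresentation.shuffled F-pos p) x
... | h , t , b , m , _ = trans (sym (FromPresentation.block-size F-pos p b m)) (FromPresentation.block-size F-pos q b m)

module Isomorphism (em : ExcludedMiddle 0ℓ) {F : ℕ → Set} {A B : PunctualLO} (sA : Shuffled F A) (sB : Shuffled F B) where
  open Choices em

  private
    S = blockCode A sA
    T = blockCode B sB
    φ = gapFiller A B sA sB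
    ψ = gapFiller B A sB sA
    module BF = BackAndForth A B (proj₁ S) (proj₁ T) (proj₂ (proj₂ S)) (proj₂ (proj₂ T))
                             (proj₁ φ) (proj₁ ψ) (proj₂ (proj₂ φ)) (proj₂ (proj₂ ψ))

  -- Used twice: with `iso-below` for the isomorphisms demanded of the cone, and on its own, with no
  -- bound on complexity, to see that the constructed orders are copies of L.
  iso : LOIso A B
  iso = BF.iso

  iso-below : ∀ {g} → InConeΔ⁰₃ g → LOIso.to iso ≤PR g × LOIso.from iso ≤PR g
  iso-below {g} cone = PR₁⇒≤PR (BF.toPR (c S) (c T) (c φ) (c ψ)) , PR₁⇒≤PR (BF.fromPR (c S) (c T) (c φ) (c ψ))
    where
    c : {Q : (ℕ → ℕ) → Set} (C : Σ (ℕ → ℕ) λ f → Δ⁰₃Fun f × Q f) → PR₁ (relativeTo g) (proj₁ C)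
    c (f , Δ , _) = ≤PR⇒PR₁ (cone f Δ)

module Shuffle (em : ExcludedMiddle 0ℓ) (sizes : ℕ → ℕ) (sizes-computable : Computable sizes) (sizes-pos : ∀ i → 1 ≤ sizes i)
  (L : PunctualLO) (isShuffle : IsShuffle sizes L) where

  F : ℕ → Set
  F s = ∃[ i ] sizes i ≡ s

  F-pos : ∀ {s} → F s → 1 ≤ s
  F-pos (i , refl) = sizes-pos i

  presL : Presentation F L
  presL = shufflePresentation sizes L isShuffle

  shuffledL : Shuffled F L
  shuffledL = FromPresentation.shuffled F-pos presL

  -- The given isomorphism θ may be arbitrarily complex; it only certifies that B is a shuffle of
  -- the same family, and a new isomorphism is built from the oracle.
  cone⇒cat : ∀ {g} → InConeΔ⁰₃ g → InPrCat L g
  cone⇒cat cone B θ = iso , iso-below cone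
    where open Isomorphism em shuffledL (FromPresentation.shuffled F-pos (transport θ presL))

  module _ (small large : ℕ) (small<large : small < large) (F-small : F small) (F-large : F large) where

    private
      T : Term false 3
      T = proj₁ sizes-computable

      T-spec : ∀ i s → sizes i ≡ s ⇔ (∃[ a ] HoldsPR T (i ∷ s ∷ a ∷ []))
      T-spec = proj₂ sizes-computable

      accepts : ℕ → Bool
      accepts e = (evalPR T (fst e ∷ fst (snd e) ∷ snd (snd e) ∷ []) ≡ᵇ 1) ∧ not (fst (snd e) ≡ᵇ small)

      -- enumerates F ∖ {small}
      E : ℕ → ℕ
      E e = if accepts e then fst (snd e) else large

      pE : PR₁ plain E
      pE = fun (ifPR (andPR (eqPR (compV (termPR T) (consV (app₁ fstPR v0) (consV (app₁ fstPR (app₁ sndPR v0)) (consV (app₁ sndPR (app₁ sndPR v0)) nilV)))) (const 1))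
                            (notPR (eqPR (app₁ fstPR (app₁ sndPR v0)) (const small))))
                     (app₁ fstPR (app₁ sndPR v0)) (const large))

      E-F : ∀ e → F (E e)
      E-F e with accepts e in q
      ... | true  = fst e , Equivalence.from (T-spec _ _) (snd (snd e) , ✓≡ (proj₁ (✓∧ q)))
      ... | false = F-large

      E≢ : ∀ e → E e ≢ small
      E≢ e eq with accepts e in q
      ... | true  = ✓not (proj₂ (✓∧ {evalPR T (fst e ∷ fst (snd e) ∷ snd (snd e) ∷ []) ≡ᵇ 1} q)) (≡✓ eq)
      ... | false = <-irrefl (sym eq) small<large

      E-code : ∀ e {i s a} → fst e ≡ i → fst (snd e) ≡ s → snd (snd e) ≡ a → HoldsPR T (i ∷ s ∷ a ∷ []) → s ≢ small → E e ≡ s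
      E-code e refl refl refl h ne rewrite ∧✓ (≡✓ h) (not✓ (ne ∘ ✓≡)) = refl

      E-onto : ∀ {s} → F s → s ≢ small → ∃[ e ] E e ≡ s
      E-onto {s} (i , eq) ne with Equivalence.to (T-spec i s) eq
      ... | a , h = pair i (pair s a) , E-code (pair i (pair s a)) (fst-pair i _) (trans (cong fst (snd-pair i _)) (fst-pair s a))
                                         (trans (cong snd (snd-pair i _)) (snd-pair s a)) h ne

    -- An isomorphism B₁ → B₂ through L, computed by g, sends the element middle between the two markers
    -- of region x, which has a block of size small, to an element of region x of B₂ carrying a true guess.
    module Decode {g : ℕ → ℕ} (cat : InPrCat L g) (f : ℕ → ℕ) (f-Σ : Σ⁰₃ (Graph f)) where

      private
        D : Term false 5
        D = proj₁ f-Σ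

        D-spec : ∀ x y → f x ≡ y ⇔ (∃[ a ] ∀ b → ∃[ c ] HoldsPR D (x ∷ y ∷ a ∷ b ∷ c ∷ []))
        D-spec = proj₂ f-Σ

        R : ℕ → ℕ → ℕ → ℕ → Bool
        R x w b c = evalPR D (x ∷ fst w ∷ snd w ∷ b ∷ c ∷ []) ≡ᵇ 1

        pR : PRB₄ plain R
        pR = eqPR (compV (termPR D) (consV v0 (consV (app₁ fstPR v1) (consV (app₁ sndPR v1) (consV v2 (consV v3 nilV)))))) (const 1)

        R-sound : ∀ {x w} → (∀ b → ∃[ c ] (✓ R x w b c)) → f x ≡ fst w
        R-sound {x} {w} h = Equivalence.from (D-spec x (fst w)) (snd w , λ b → proj₁ (h b) , ✓≡ (proj₂ (h b)))

        total : ∀ x → ∃[ w ] ∀ b → ∃[ c ] (✓ R x w b c)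
        total x with Equivalence.to (D-spec x (f x)) refl
        ... | a , h = pair (f x) a , λ b → proj₁ (h b) ,
              subst₂ (λ u v → ✓ (evalPR D (x ∷ u ∷ v ∷ b ∷ proj₁ (h b) ∷ []) ≡ᵇ 1)) (sym (fst-pair (f x) a)) (sym (snd-pair (f x) a)) (≡✓ (proj₂ (h b)))

        module C₁ = Construction em F-pos small large small<large F-small F-large E pE E-F E≢ E-onto
                      (λ _ _ _ _ → true) (const 1) (λ _ → 0 , λ _ → 0 , refl)
        module C₂ = Construction em F-pos small large small<large F-small F-large E pE E-F E≢ E-onto R pR total
        module A₁ = C₁.AllTrue (λ _ _ _ _ → refl)

        abstract
          C₁-cat : Σ (LOIso L C₁.B) λ α → LOIso.to α ≤PR g × LOIso.from α ≤PR g
          C₁-cat = cat C₁.B (Isomorphism.iso em shuffledL (FromPresentation.shuffled F-pos C₁.presentation))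

          C₂-cat : Σ (LOIso L C₂.B) λ β → LOIso.to β ≤PR g × LOIso.from β ≤PR g
          C₂-cat = cat C₂.B (Isomorphism.iso em shuffledL (FromPresentation.shuffled F-pos C₂.presentation))

        α : LOIso L C₁.B
        α = proj₁ C₁-cat

        β : LOIso L C₂.B
        β = proj₁ C₂-cat

        module α = LOIso α
        module β = LOIso β
        module P₂ = FromPresentation F-pos C₂.presentation
        -- The presentation of the first copy, carried to the second one so that both live on the
        -- same order and can be compared there.
        pres₁ : Presentation F C₂.B
        pres₁ = transport β (transport (inverse α) C₁.presentation)
        module P₁ = FromPresentation F-pos pres₁

        over back : ℕ → ℕ
        over y = α.to (β.from y)
        back x = β.to (α.from x)

        over-back : ∀ x → over (back x) ≡ x
        over-back x = trans (cong α.to (Inverse.strictlyInverseʳ β.bij (α.from x))) (Inverse.strictlyInverseˡ α.bij x)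

        over-mono : ∀ {y y'} → _<ₒ_ C₂.B y y' → _<ₒ_ C₁.B (over y) (over y')
        over-mono {y} {y'} p = Equivalence.to (α.preserves (β.from y) (β.from y')) (Equivalence.from (β.preserves (β.from y) (β.from y'))
          (subst₂ (_<ₒ_ C₂.B) (sym (Inverse.strictlyInverseˡ β.bij y)) (sym (Inverse.strictlyInverseˡ β.bij y')) p))

        back-mono : ∀ {x x'} → _<ₒ_ C₁.B x x' → _<ₒ_ C₂.B (back x) (back x')
        back-mono {x} {x'} p = Equivalence.to (β.preserves (α.from x) (α.from x')) (Equivalence.from (α.preserves (α.from x) (α.from x'))
          (subst₂ (_<ₒ_ C₁.B) (sym (Inverse.strictlyInverseˡ α.bij x)) (sym (Inverse.strictlyInverseˡ α.bij x')) p))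

        back-over : ∀ y → back (over y) ≡ y
        back-over y = trans (cong β.to (Inverse.strictlyInverseʳ α.bij (β.from y))) (Inverse.strictlyInverseˡ β.bij y)

        mid probe : ℕ → ℕ
        mid x   = C₁.middle (over (C₂.low x)) (over (C₂.high x))
        probe x = back (mid x)

        -- Being first in a block is a property of the order, namely `NoPred`, and hence passes from
        -- one presentation to the other.
        high-first : ∀ x → C₁.pos (over (C₂.high x)) ≡ 0
        high-first x = P₁.NoPred⇒index0 {C₂.high x} (P₂.index0⇒NoPred (C₂.high-pos x))

        mid-ok : ∀ x → _<ₒ_ C₁.B (over (C₂.low x)) (mid x) × _<ₒ_ C₁.B (mid x) (over (C₂.high x)) ×
                       C₁.sizeOf (C₁.run (C₁.point (mid x))) ≡ small
        mid-ok x = A₁.middle-ok {over (C₂.low x)} {over (C₂.high x)} (over-mono (C₂.low≺high x)) (high-first x)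

        probe-small : ∀ x → C₂.sizeOf (C₂.run (C₂.point (probe x))) ≡ small
        probe-small x = trans (size-unique F-pos C₂.presentation pres₁ (probe x)) (over-small (over-back (mid x)))
          where
          over-small : ∀ {y} → y ≡ mid x → C₁.sizeOf (C₁.run (C₁.point y)) ≡ small
          over-small refl = proj₂ (proj₂ (mid-ok x))

        low≺probe : ∀ x → _<ₒ_ C₂.B (C₂.low x) (probe x)
        low≺probe x = subst (λ y → _<ₒ_ C₂.B y (probe x)) (back-over (C₂.low x)) (back-mono (proj₁ (mid-ok x)))

        probe≺high : ∀ x → _<ₒ_ C₂.B (probe x) (C₂.high x)
        probe≺high x = subst (λ y → _<ₒ_ C₂.B (probe x) y) (back-over (C₂.high x)) (back-mono (proj₁ (proj₂ (mid-ok x))))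

        value : ∀ x → fst (C₂.guessOf (probe x)) ≡ f x
        value x = sym (R-sound {x} {C₂.guessOf (probe x)} (C₂.guessOf-true {x} {probe x} (low≺probe x) (probe≺high x) (probe-small x)))

        overPR : PR₁ (relativeTo g) over
        overPR = fun (app₁ (≤PR⇒PR₁ {α.to} (proj₁ (proj₂ C₁-cat))) (app₁ (≤PR⇒PR₁ {β.from} (proj₂ (proj₂ C₂-cat))) v0))

        backPR : PR₁ (relativeTo g) back
        backPR = fun (app₁ (≤PR⇒PR₁ {β.to} (proj₁ (proj₂ C₂-cat))) (app₁ (≤PR⇒PR₁ {α.from} (proj₂ (proj₂ C₁-cat))) v0))

        probePR : PR₁ (relativeTo g) probe
        probePR = fun (app₁ backPR (app₂ C₁.middlePR (app₁ overPR (app₁ C₂.lowPR v0)) (app₁ overPR (app₁ C₂.highPR v0))))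

      decoded : f ≤PR g
      decoded = PR₁⇒≤PR (fun (ext (λ xs → value (lookup xs zero))
        (app₁ fstPR (app₁ C₂.guessOfPR (app₁ probePR v0)))))

    cat⇒cone : ∀ {g} → InPrCat L g → InConeΔ⁰₃ g
    cat⇒cone cat f (f-Σ , _) = Decode.decoded cat f f-Σ

theorem3p7 : ExcludedMiddle 0ℓ →
    (sizes : ℕ → ℕ) → Computable sizes → (∀ i → 1 ≤ sizes i) →
    (∃₂ λ i j → sizes i ≢ sizes j) →
    (L : PunctualLO) → IsShuffle sizes L →
    (g : ℕ → ℕ) → (InPrCat L g ⇔ InConeΔ⁰₃ g)
theorem3p7 em sizes computable positive (i , j , i≢j) L isShuffle g = mk⇔ (forward (<-cmp (sizes i) (sizes j))) cone⇒cat
  where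
  open Shuffle em sizes computable positive L isShuffle
  forward : Tri (sizes i < sizes j) (sizes i ≡ sizes j) (sizes j < sizes i) → InPrCat L g → InConeΔ⁰₃ g
  forward (tri< lt _ _) = cat⇒cone _ _ lt (i , refl) (j , refl)
  forward (tri≈ _ e _)  = ⊥-elim (i≢j e)
  forward (tri> _ _ gt) = cat⇒cone _ _ gt (j , refl) (i , refl)
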